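{- For all integers $n\geq 0$, $$a_{1^{ -1}2^{3}4^{ -1}5^{ -2}}(5n)>0,\quad a_{1^{ -1}2^{3}4^{ -1}5^{ -2}}(5n+1)>0,\quad a_{1^{ -1}2^{3}4^{ -1}5^{ -2}}(5n+2)<0,$$ $$a_{1^{ -1}2^{3}4^{ -1}5^{ -2}}(5n+3)=0,\quad a_{1^{ -1}2^{3}4^{ -1}5^{ -2}}(5n+4)=0.$$
   Context: For $|q|<1$ (or as formal power series in $q$) let $f_j:=(q^j;q^j)_\infty=\prod_{k\ge 1}(1-q^{jk})$ for each positive integer $j$. The integers $a_{1^{ -1}2^{3}4^{ -1}5^{ -2}}(n)$, $n\ge 0$, are defined by $\sum_{n=0}^\infty a_{1^{ -1}2^{3}4^{ -1}5^{ -2}}(n)q^n=\dfrac{f_2^3}{f_1f_4f_5^2}$. -}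

module Defs where

open import Data.Bool using (if_then_else_)
open import Data.Fin using (Fin; zero; suc; toℕ)
open import Data.Integer using (ℤ; 0ℤ; 1ℤ; _+_; _*_; _-_; -_)
open import Data.Integer.Properties
  using (+-*-semiring; +-identityˡ; +-identityʳ; +-inverseˡ; +-assoc;
         *-identityˡ; *-identityʳ; *-zeroʳ)
open import Data.Nat as ℕ
  using (ℕ; zero; suc; _∸_; _≡ᵇ_; _≤_; _<_; z≤n; s≤s; NonZero)
import Data.Nat.Properties as ℕ
open import Data.Vec using (Vec; []; _∷_; head; lookup)
open import Relation.Binary.PropositionalEquality

open import Algebra.Properties.Semiring.Sum +-*-semiring
  using (sum-syntax; sum⁺-syntax; sum-cong-≗)

infixl 7 _⊛_ _⊘_
infixl 6 _⊖_
infixr 8 q^_ _↑_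

-- Formal power series in q over ℤ: the value at n is the coefficient of qⁿ.
Series : Set
Series = ℕ → ℤ

-- The monomial qᵐ; q^ 0 is the unit series.
q^_ : ℕ → Series
(q^ m) n = if n ≡ᵇ m then 1ℤ else 0ℤ

_⊖_ : Series → Series → Series
(a ⊖ b) n = a n - b n

-- The library's ∑[ i ≤ n ] ranges over i : Fin (suc n), i.e. 0 ≤ i ≤ n.
_⊛_ : Series → Series → Series
(a ⊛ b) n = ∑[ i ≤ n ] (a (toℕ i) * b (n ∸ toℕ i))

_↑_ : Series → ℕ → Series
a ↑ zero  = q^ 0
a ↑ suc k = a ⊛ a ↑ k

-- Long division, meant for a divisor b with b 0 ≡ 1 (b 0 is never read):
-- c = a / b satisfies cₙ = aₙ - ∑_{1≤i≤n} bᵢ cₙ₋ᵢ.  The vector lists cₙ , … , c₀.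
quotients : Series → Series → ∀ n → Vec ℤ (suc n)
quotients a b zero    = a 0 ∷ []
quotients a b (suc n) =
  (a (suc n) - (∑[ i ≤ n ] (b (suc (toℕ i)) * lookup cs i))) ∷ cs
  where cs = quotients a b n

_⊘_ : Series → Series → Series
(a ⊘ b) n = head (quotients a b n)

-- ∏_{1≤k≤N} (1 - q^{jk})
∏1-q^ : ℕ → ℕ → Series
∏1-q^ j zero    = q^ 0
∏1-q^ j (suc N) = ∏1-q^ j N ⊛ (q^ 0 ⊖ q^ (j ℕ.* suc N))

-- f j = (q^j; q^j)_∞.  The factors with k > n do not affect the coefficient
-- of qⁿ when j ≥ 1 (see f-stable), so the infinite product has the same
-- coefficient of qⁿ as the product over 1 ≤ k ≤ n.
f : (j : ℕ) .{{_ : NonZero j}} → Series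
f j n = ∏1-q^ j n n

-- The sequence a_{1⁻¹ 2³ 4⁻¹ 5⁻²}.
a₁⁻¹2³4⁻¹5⁻² : Series
a₁⁻¹2³4⁻¹5⁻² = f 2 ↑ 3 ⊘ (f 1 ⊛ f 4 ⊛ f 5 ↑ 2)

lookup-quotients : ∀ a b n (i : Fin (suc n)) →
                   lookup (quotients a b n) i ≡ (a ⊘ b) (n ∸ toℕ i)
lookup-quotients a b zero    zero    = refl
lookup-quotients a b (suc n) zero    = refl
lookup-quotients a b (suc n) (suc i) = lookup-quotients a b n i

⊘-correct : ∀ a b → b 0 ≡ 1ℤ → b ⊛ (a ⊘ b) ≗ a
⊘-correct a b b₀≡1 zero = begin
  b 0 * a 0 + 0ℤ  ≡⟨ +-identityʳ _ ⟩
  b 0 * a 0       ≡⟨ cong (_* a 0) b₀≡1 ⟩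
  1ℤ * a 0        ≡⟨ *-identityˡ _ ⟩
  a 0             ∎
  where open ≡-Reasoning
⊘-correct a b b₀≡1 (suc n) = begin
  b 0 * (a (suc n) - s) + t  ≡⟨ cong (λ x → x * (a (suc n) - s) + t) b₀≡1 ⟩
  1ℤ * (a (suc n) - s) + t   ≡⟨ cong (_+ t) (*-identityˡ (a (suc n) - s)) ⟩
  a (suc n) - s + t          ≡⟨ cong (a (suc n) - s +_) t≡s ⟩
  a (suc n) - s + s          ≡⟨ +-assoc (a (suc n)) (- s) s ⟩
  a (suc n) + (- s + s)      ≡⟨ cong (a (suc n) +_) (+-inverseˡ s) ⟩
  a (suc n) + 0ℤ             ≡⟨ +-identityʳ _ ⟩
  a (suc n)                  ∎
  where
  open ≡-Reasoning
  s = ∑[ i ≤ n ] (b (suc (toℕ i)) * lookup (quotients a b n) i)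
  t = ∑[ i ≤ n ] (b (suc (toℕ i)) * (a ⊘ b) (n ∸ toℕ i))
  t≡s : t ≡ s
  t≡s = sum-cong-≗ {suc n}
    (λ i → cong (b (suc (toℕ i)) *_) (sym (lookup-quotients a b n i)))

a₁⁻¹2³4⁻¹5⁻²-defining : (f 1 ⊛ f 4 ⊛ f 5 ↑ 2) ⊛ a₁⁻¹2³4⁻¹5⁻² ≗ f 2 ↑ 3
a₁⁻¹2³4⁻¹5⁻²-defining = ⊘-correct (f 2 ↑ 3) (f 1 ⊛ f 4 ⊛ f 5 ↑ 2) refl

q^-vanish : ∀ {m n} → n < m → (q^ m) n ≡ 0ℤ
q^-vanish {suc m} {zero}  _         = refl
q^-vanish {suc m} {suc n} (s≤s n<m) = q^-vanish n<m

⊛-truncate : ∀ a b n → b 0 ≡ 1ℤ → (∀ k → suc k ≤ n → b (suc k) ≡ 0ℤ) →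
             (a ⊛ b) n ≡ a n
⊛-truncate a b zero b₀ bₖ =
  trans (+-identityʳ _) (trans (cong (a 0 *_) b₀) (*-identityʳ _))
⊛-truncate a b (suc n) b₀ bₖ = begin
  a 0 * b (suc n) + a′b  ≡⟨ cong (λ x → a 0 * x + a′b) (bₖ n ℕ.≤-refl) ⟩
  a 0 * 0ℤ + a′b         ≡⟨ cong (_+ a′b) (*-zeroʳ (a 0)) ⟩
  0ℤ + a′b               ≡⟨ +-identityˡ _ ⟩
  a′b                    ≡⟨ ⊛-truncate a′ b n b₀ (λ k k<n → bₖ k (ℕ.m≤n⇒m≤1+n k<n)) ⟩
  a (suc n)              ∎
  where
  open ≡-Reasoning
  a′ : Series
  a′ k = a (suc k)
  a′b = (a′ ⊛ b) n

f-stable : ∀ j .{{_ : NonZero j}} d n → ∏1-q^ j (d ℕ.+ n) n ≡ f j n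
f-stable j zero    n = refl
f-stable j (suc d) n =
  trans (⊛-truncate (∏1-q^ j (d ℕ.+ n)) (q^ 0 ⊖ q^ m) n
          (cong (λ x → 1ℤ - x) (q^-vanish (ℕ.≤-<-trans z≤n n<m)))
          (λ k k<n → cong (λ x → 0ℤ - x) (q^-vanish (ℕ.≤-<-trans k<n n<m))))
        (f-stable j d n)
  where
  m = j ℕ.* suc (d ℕ.+ n)
  n<m : n < m
  n<m = ℕ.<-≤-trans (s≤s (ℕ.m≤n+m n d)) (ℕ.m≤n*m (suc (d ℕ.+ n)) j)

{-# OPTIONS --safe #-}
-- Replacing q by -q turns f₁ into f₂³ / (f₁ f₄), so f₅² ∑ a(n) qⁿ = f₁(-q).
-- As f₅ is a series in q⁵, the subsequences of a in the classes modulo 5 come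
-- from those of the pentagonal number series f₁(-q), divided by f₁². Pentagonal
-- numbers are 0, 1 or 2 modulo 5, which gives the two vanishing classes; the
-- class of 1 gives f₅(-q). For the other two, write A and B for the triple
-- products (q², q³, q⁵; q⁵)_∞ and (q, q⁴, q⁵; q⁵)_∞. Then the classes of 0
-- and 2 of f₁ are f₅ A / B and - f₅ B / A: after multiplication by B or A these
-- are identities between products of two theta series (instances of the quintuple
-- product identity), proved by rearranging sums over ℤ². Finally, at -q, every
-- one of these products divided by f₁ is a product of factors 1 + qᵐ and
-- 1 / (1 - qᵐ), and dividing by f₁ once more makes all coefficients positive.
module Submission where

-- Positivity is not immediate: putting -q for q leaves factors 1 + qᵐ with m odd in the
-- denominators `σ T₄₁` and `σ T₃₂`, and 1 / (1 + qᵐ) has coefficients of both signs. One of the two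
-- factors f₁ in the denominator repairs this, since it contains 1 - qᵐ and (1 + qᵐ)(1 - qᵐ) = 1 -
-- q²ᵐ; for m an odd multiple of 5, the factor 1 + qᵐ cancels against the numerator. The other f₁
-- contributes 1 / (1 - q), all of whose coefficients are 1, and this turns nonnegative into
-- positive. The classes 0 and 2 each collect two residues of the summation index because 3 i² - i
-- is symmetric under i ↦ 2 - i modulo 5; class 1 belongs to the fixed point i = 1, which is why a
-- single theta series remains there. Nothing analytic is used. The coefficient of qⁿ in an infinite
-- product is that of a finite one, and in an infinite sum only finitely many terms contribute to
-- it. Jacobi's triple product is derived as the limit of a finite identity; after that, identities
-- between theta series are reindexings of ℤ or ℤ².

-- The commutative ring of formal power series.

module FormalSeries where

  open import Defs
  open import Algebra using (CommutativeRing; AbelianGroup)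
  open import Data.Fin using (toℕ) renaming (zero to fzero; suc to fsuc)
  open import Data.Fin.Properties using (toℕ≤pred[n])
  open import Data.Integer as ℤ using (ℤ; 0ℤ; 1ℤ; +_)
  import Data.Integer.Properties as ℤ
  import Data.Integer.Tactic.RingSolver as ℤ-Solver
  open import Data.Nat using (ℕ; zero; suc; _+_; _∸_; _≤_; s≤s)
  import Data.Nat.Properties as ℕ
  open import Data.Product using (_,_)
  open import Function using (_∘_)
  open import Level using (0ℓ)
  open import Relation.Binary.PropositionalEquality
  open import Relation.Nullary using (contradiction)
  open import Algebra.Properties.Group (AbelianGroup.group ℤ.+-0-abelianGroup) using () renaming (∙-cancelʳ to +-cancelʳ) public
  open import Algebra.Properties.Semiring.Sum ℤ.+-*-semiring using (sum; sum-cong-≗)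

  infix 4 _≈[_]_
  infixl 6 _⊕_
  infixr 7 _•_

  tail : Series → Series
  tail a n = a (suc n)

  _⊕_ : Series → Series → Series
  (a ⊕ b) n = a n ℤ.+ b n

  ⊝_ : Series → Series
  (⊝ a) n = ℤ.- a n

  _•_ : ℤ → Series → Series
  (c • a) n = c ℤ.* a n

  𝟎 : Series
  𝟎 _ = 0ℤ

  _≈[_]_ : Series → ℕ → Series → Set
  a ≈[ n ] b = ∀ k → k ≤ n → a k ≡ b k

  -- The basis of every passage to a limit: coefficients of a product up to qⁿ involve only
  -- coefficients of the factors up to qⁿ.
  ⊛-cong-≤ : ∀ {a a′ b b′} n → a ≈[ n ] a′ → b ≈[ n ] b′ → a ⊛ b ≈[ n ] a′ ⊛ b′
  ⊛-cong-≤ n p q k k≤n = sum-cong-≗ {suc k} λ i →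
    cong₂ ℤ._*_ (p (toℕ i) (ℕ.≤-trans (toℕ≤pred[n] i) k≤n))
                (q (k ∸ toℕ i) (ℕ.≤-trans (ℕ.m∸n≤m k (toℕ i)) k≤n))

  ⊛-cong : ∀ {a a′ b b′} → a ≗ a′ → b ≗ b′ → a ⊛ b ≗ a′ ⊛ b′
  ⊛-cong p q n = ⊛-cong-≤ n (λ k _ → p k) (λ k _ → q k) n ℕ.≤-refl

  -- The convolution unfolds at its first summand; splitting off the last one instead is what makes
  -- commutativity an induction.
  ⊛-last : ∀ a b n → (a ⊛ b) (suc n) ≡ (a ⊛ tail b) n ℤ.+ a (suc n) ℤ.* b 0
  ⊛-last a b zero =
    cong₂ ℤ._+_ (sym (ℤ.+-identityʳ (a 0 ℤ.* b 1))) (ℤ.+-identityʳ (a 1 ℤ.* b 0))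
  ⊛-last a b (suc n) = trans
    (cong (λ x → a 0 ℤ.* b (suc (suc n)) ℤ.+ x) (⊛-last (tail a) b n))
    (sym (ℤ.+-assoc (a 0 ℤ.* b (suc (suc n))) ((tail a ⊛ tail b) n) _))

  ⊛-comm : ∀ a b → a ⊛ b ≗ b ⊛ a
  ⊛-comm a b zero = cong (ℤ._+ 0ℤ) (ℤ.*-comm (a 0) (b 0))
  ⊛-comm a b (suc n) = begin
    a 0 ℤ.* b (suc n) ℤ.+ (tail a ⊛ b) n  ≡⟨ cong₂ ℤ._+_ (ℤ.*-comm (a 0) _) (⊛-comm (tail a) b n) ⟩
    b (suc n) ℤ.* a 0 ℤ.+ (b ⊛ tail a) n  ≡⟨ ℤ.+-comm (b (suc n) ℤ.* a 0) _ ⟩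
    (b ⊛ tail a) n ℤ.+ b (suc n) ℤ.* a 0  ≡⟨ ⊛-last b a n ⟨
    (b ⊛ a) (suc n)                       ∎
    where open ≡-Reasoning

  ⊛-distribʳ : ∀ c a b → (a ⊕ b) ⊛ c ≗ (a ⊛ c) ⊕ (b ⊛ c)
  ⊛-distribʳ c a b zero = ring (a 0) (b 0) (c 0)
    where
    ring : ∀ x y z → (x ℤ.+ y) ℤ.* z ℤ.+ 0ℤ ≡ x ℤ.* z ℤ.+ 0ℤ ℤ.+ (y ℤ.* z ℤ.+ 0ℤ)
    ring = ℤ-Solver.solve-∀
  ⊛-distribʳ c a b (suc n) = trans
    (cong (λ x → (a 0 ℤ.+ b 0) ℤ.* c (suc n) ℤ.+ x) (⊛-distribʳ c (tail a) (tail b) n))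
    (ring (a 0) (b 0) (c (suc n)) ((tail a ⊛ c) n) ((tail b ⊛ c) n))
    where
    ring : ∀ x y z u v → (x ℤ.+ y) ℤ.* z ℤ.+ (u ℤ.+ v) ≡ x ℤ.* z ℤ.+ u ℤ.+ (y ℤ.* z ℤ.+ v)
    ring = ℤ-Solver.solve-∀

  •-⊛ : ∀ c a b → (c • a) ⊛ b ≗ c • (a ⊛ b)
  •-⊛ c a b zero = ring c (a 0) (b 0)
    where
    ring : ∀ x y z → x ℤ.* y ℤ.* z ℤ.+ 0ℤ ≡ x ℤ.* (y ℤ.* z ℤ.+ 0ℤ)
    ring = ℤ-Solver.solve-∀
  •-⊛ c a b (suc n) = trans
    (cong (λ x → c ℤ.* a 0 ℤ.* b (suc n) ℤ.+ x) (•-⊛ c (tail a) b n))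
    (ring c (a 0) (b (suc n)) ((tail a ⊛ b) n))
    where
    ring : ∀ x y z u → x ℤ.* y ℤ.* z ℤ.+ x ℤ.* u ≡ x ℤ.* (y ℤ.* z ℤ.+ u)
    ring = ℤ-Solver.solve-∀

  ⊛-assoc : ∀ a b c → (a ⊛ b) ⊛ c ≗ a ⊛ (b ⊛ c)
  ⊛-assoc a b c zero = ring (a 0) (b 0) (c 0)
    where
    ring : ∀ x y z → (x ℤ.* y ℤ.+ 0ℤ) ℤ.* z ℤ.+ 0ℤ ≡ x ℤ.* (y ℤ.* z ℤ.+ 0ℤ) ℤ.+ 0ℤ
    ring = ℤ-Solver.solve-∀
  ⊛-assoc a b c (suc n) = begin
    -- The tail of `a ⊛ b` is definitionally `(a 0 • tail b) ⊕ (tail a ⊛ b)`.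
    (a ⊛ b) 0 ℤ.* c (suc n) ℤ.+ (((a 0 • tail b) ⊕ (tail a ⊛ b)) ⊛ c) n
      ≡⟨ cong (λ x → (a ⊛ b) 0 ℤ.* c (suc n) ℤ.+ x) (trans (⊛-distribʳ c (a 0 • tail b) (tail a ⊛ b) n)
           (cong₂ ℤ._+_ (•-⊛ (a 0) (tail b) c n) (⊛-assoc (tail a) b c n))) ⟩
    (a ⊛ b) 0 ℤ.* c (suc n) ℤ.+ (a 0 ℤ.* (tail b ⊛ c) n ℤ.+ (tail a ⊛ (b ⊛ c)) n)
      ≡⟨ ring (a 0) (b 0) (c (suc n)) ((tail b ⊛ c) n) ((tail a ⊛ (b ⊛ c)) n) ⟩
    a 0 ℤ.* (b ⊛ c) (suc n) ℤ.+ (tail a ⊛ (b ⊛ c)) n ∎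
    where
    open ≡-Reasoning
    ring : ∀ x y z u v → (x ℤ.* y ℤ.+ 0ℤ) ℤ.* z ℤ.+ (x ℤ.* u ℤ.+ v) ≡ x ℤ.* (y ℤ.* z ℤ.+ u) ℤ.+ v
    ring = ℤ-Solver.solve-∀

  ⊛-zeroˡ : ∀ a → 𝟎 ⊛ a ≗ 𝟎
  ⊛-zeroˡ a zero    = refl
  ⊛-zeroˡ a (suc n) = trans (ℤ.+-identityˡ _) (⊛-zeroˡ a n)

  ⊛-identityˡ : ∀ a → q^ 0 ⊛ a ≗ a
  ⊛-identityˡ a zero    = trans (ℤ.+-identityʳ _) (ℤ.*-identityˡ (a 0))
  ⊛-identityˡ a (suc n) = trans
    (cong₂ ℤ._+_ (ℤ.*-identityˡ (a (suc n))) (⊛-zeroˡ a n)) (ℤ.+-identityʳ _)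

  Series-commutativeRing : CommutativeRing 0ℓ 0ℓ
  Series-commutativeRing = record
    { Carrier = Series ; _≈_ = _≗_ ; _+_ = _⊕_ ; _*_ = _⊛_ ; -_ = ⊝_ ; 0# = 𝟎 ; 1# = q^ 0
    ; isCommutativeRing = record
      { isRing = record
        { +-isAbelianGroup = record
          { isGroup = record
            { isMonoid = record
              { isSemigroup = record
                { isMagma = record
                  { isEquivalence = record
                    { refl = λ _ → refl
                    ; sym = λ p n → sym (p n)
                    ; trans = λ p q n → trans (p n) (q n) }
                  ; ∙-cong = λ p q n → cong₂ ℤ._+_ (p n) (q n) }
                ; assoc = λ a b c n → ℤ.+-assoc (a n) (b n) (c n) }
              ; identity = (λ a n → ℤ.+-identityˡ (a n)) , (λ a n → ℤ.+-identityʳ (a n)) }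
            ; inverse = (λ a n → ℤ.+-inverseˡ (a n)) , (λ a n → ℤ.+-inverseʳ (a n))
            ; ⁻¹-cong = λ p n → cong ℤ.-_ (p n) }
          ; comm = λ a b n → ℤ.+-comm (a n) (b n) }
        ; *-cong = ⊛-cong
        ; *-assoc = ⊛-assoc
        ; *-identity = ⊛-identityˡ , λ a n → trans (⊛-comm a (q^ 0) n) (⊛-identityˡ a n)
        ; distrib = (λ a b c n → trans (⊛-comm a (b ⊕ c) n) (trans (⊛-distribʳ a b c n)
                      (cong₂ ℤ._+_ (⊛-comm b a n) (⊛-comm c a n))))
                  , ⊛-distribʳ }
      ; *-comm = ⊛-comm } }

  ⊛-identityʳ : ∀ a → a ⊛ q^ 0 ≗ a
  ⊛-identityʳ a n = trans (⊛-comm a (q^ 0) n) (⊛-identityˡ a n)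

  q^-+ : ∀ m n → q^ m ⊛ q^ n ≗ q^ (m + n)
  q^-+ zero    n k       = ⊛-identityˡ (q^ n) k
  q^-+ (suc m) n zero    = refl
  q^-+ (suc m) n (suc k) = trans (ℤ.+-identityˡ _) (q^-+ m n k)

  q^-self : ∀ n → (q^ n) n ≡ 1ℤ
  q^-self zero    = refl
  q^-self (suc n) = q^-self n

  q^-off : ∀ m n → n ≢ m → (q^ m) n ≡ 0ℤ
  q^-off zero    zero    n≢m = contradiction refl n≢m
  q^-off zero    (suc n) n≢m = refl
  q^-off (suc m) zero    n≢m = refl
  q^-off (suc m) (suc n) n≢m = q^-off m n (n≢m ∘ cong suc)

  -- With constant term 1 in d, the coefficient of qⁿ on either side determines the n-th coefficient
  -- of the other factor once the earlier ones are known. The bound m in `go` makes this a strong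
  -- induction.
  ⊛-cancelˡ : ∀ d {a b} → d 0 ≡ 1ℤ → d ⊛ a ≗ d ⊛ b → a ≗ b
  ⊛-cancelˡ d {a} {b} d₀ p n = go n n ℕ.≤-refl
    where
    head-cancel : ∀ {x y u v} → d 0 ℤ.* x ℤ.+ u ≡ d 0 ℤ.* y ℤ.+ v → u ≡ v → x ≡ y
    head-cancel {x} {y} {u} e refl = begin
      x           ≡⟨ ℤ.*-identityˡ x ⟨
      1ℤ ℤ.* x    ≡⟨ cong (ℤ._* x) d₀ ⟨
      d 0 ℤ.* x   ≡⟨ +-cancelʳ u (d 0 ℤ.* x) (d 0 ℤ.* y) e ⟩
      d 0 ℤ.* y   ≡⟨ cong (ℤ._* y) d₀ ⟩
      1ℤ ℤ.* y    ≡⟨ ℤ.*-identityˡ y ⟩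
      y           ∎
      where open ≡-Reasoning
    go : ∀ m n → n ≤ m → a n ≡ b n
    go m       zero    _         = head-cancel (p 0) refl
    go (suc m) (suc n) (s≤s n≤m) = head-cancel (p (suc n))
      (⊛-cong-≤ {tail d} n (λ _ _ → refl) (λ k k≤n → go m k (ℕ.≤-trans k≤n n≤m)) n ℕ.≤-refl)

-- Sums of finite support over arbitrary index sets.

module FiniteSums where

  open import Data.Integer as ℤ using (ℤ; 0ℤ)
  import Data.Integer.Properties as ℤ
  open import Data.List using (List; []; _∷_; _++_)
  open import Data.List.Membership.Propositional using (_∈_)
  open import Data.List.Membership.Propositional.Properties using (∈-∃++)
  open import Data.List.Relation.Binary.Permutation.Propositional using (_↭_; refl; prep; swap; trans; ↭-sym; ↭⇒↭ₛ)
  open import Data.List.Relation.Binary.Permutation.Propositional.Properties using (shift; ∈-resp-↭)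
  import Data.List.Relation.Binary.Permutation.Setoid.Properties as Setoid-↭
  open import Data.List.Relation.Unary.All as All using ()
  open import Data.List.Relation.Unary.AllPairs using ([]; _∷_)
  open import Data.List.Relation.Unary.Any using (here; there)
  open import Data.List.Relation.Unary.Unique.Propositional using (Unique)
  open import Data.Product using (_×_; _,_; proj₁; proj₂; ∃; ∃₂)
  open import Data.Sum using (_⊎_; inj₁; inj₂; [_,_]′)
  open import Function using (_∘_)
  open import Relation.Binary.PropositionalEquality as ≡ using (_≡_; _≢_; _≗_; refl; cong; cong₂; sym; module ≡-Reasoning)
  open import Relation.Nullary using (yes; no; contradiction)
  open import Algebra.Properties.CommutativeSemigroup ℤ.+-commutativeSemigroup using (x∙yz≈y∙xz; interchange)

  infix 4 _⇒_

  private variable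
    I J : Set

  ∑ : (I → ℤ) → List I → ℤ
  ∑ g []       = 0ℤ
  ∑ g (i ∷ is) = g i ℤ.+ ∑ g is

  -- g ⇒ s: the function g has finite support and its values add up to s.
  record _⇒_ {I : Set} (g : I → ℤ) (s : ℤ) : Set where
    field
      support : List I
      unique  : Unique support
      covers  : ∀ i → g i ≢ 0ℤ → i ∈ support
      total   : ∑ g support ≡ s

  ∑-cong : ∀ {g h : I → ℤ} → g ≗ h → ∀ is → ∑ g is ≡ ∑ h is
  ∑-cong p []       = refl
  ∑-cong p (i ∷ is) = cong₂ ℤ._+_ (p i) (∑-cong p is)

  ∑-++ : ∀ (g : I → ℤ) is js → ∑ g (is ++ js) ≡ ∑ g is ℤ.+ ∑ g js
  ∑-++ g []       js = sym (ℤ.+-identityˡ _)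
  ∑-++ g (i ∷ is) js = ≡.trans (cong (λ x → g i ℤ.+ x) (∑-++ g is js)) (sym (ℤ.+-assoc (g i) _ _))

  ∑-+ : ∀ (g h : I → ℤ) is → ∑ (λ i → g i ℤ.+ h i) is ≡ ∑ g is ℤ.+ ∑ h is
  ∑-+ g h []       = refl
  ∑-+ g h (i ∷ is) = ≡.trans (cong (λ x → g i ℤ.+ h i ℤ.+ x) (∑-+ g h is)) (interchange (g i) (h i) _ _)

  ∑-neg : ∀ (g : I → ℤ) is → ∑ (λ i → ℤ.- g i) is ≡ ℤ.- ∑ g is
  ∑-neg g []       = refl
  ∑-neg g (i ∷ is) = ≡.trans (cong (λ x → ℤ.- g i ℤ.+ x) (∑-neg g is)) (sym (ℤ.neg-distrib-+ (g i) _))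

  ∑-* : ∀ c (g : I → ℤ) is → ∑ (λ i → c ℤ.* g i) is ≡ c ℤ.* ∑ g is
  ∑-* c g []       = sym (ℤ.*-zeroʳ c)
  ∑-* c g (i ∷ is) = ≡.trans (cong (λ x → c ℤ.* g i ℤ.+ x) (∑-* c g is)) (sym (ℤ.*-distribˡ-+ c (g i) _))

  ∑-↭ : ∀ (g : I → ℤ) {is js} → is ↭ js → ∑ g is ≡ ∑ g js
  ∑-↭ g refl         = refl
  ∑-↭ g (prep i p)   = cong (λ x → g i ℤ.+ x) (∑-↭ g p)
  ∑-↭ g (swap i j p) = ≡.trans (cong (λ x → g i ℤ.+ (g j ℤ.+ x)) (∑-↭ g p)) (x∙yz≈y∙xz (g i) (g j) _)
  ∑-↭ g (trans p p′) = ≡.trans (∑-↭ g p) (∑-↭ g p′)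

  ∑-zero : ∀ (g : I → ℤ) is → (∀ i → i ∈ is → g i ≡ 0ℤ) → ∑ g is ≡ 0ℤ
  ∑-zero g []       p = refl
  ∑-zero g (i ∷ is) p = cong₂ ℤ._+_ (p i (here refl)) (∑-zero g is (λ j → p j ∘ there))

  -- The two lists may differ in entries where g vanishes. A head with nonzero value is moved to the
  -- front of the other list by a permutation, and uniqueness carries both inclusions over to the
  -- remaining entries.
  ∑-same-support : ∀ (g : I → ℤ) {is js} → Unique is → Unique js →
                   (∀ i → g i ≢ 0ℤ → i ∈ is → i ∈ js) →
                   (∀ i → g i ≢ 0ℤ → i ∈ js → i ∈ is) → ∑ g is ≡ ∑ g js
  ∑-same-support g {[]} {js} _ _ _ back = sym (∑-zero g js vanish)
    where
    vanish : ∀ i → i ∈ js → g i ≡ 0ℤ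
    vanish i i∈js with g i ℤ.≟ 0ℤ
    ... | yes gi≡0 = gi≡0
    ... | no  gi≢0 with () ← back i gi≢0 i∈js
  ∑-same-support g {i ∷ is} {js} (i∉is ∷ uis) ujs to back with g i ℤ.≟ 0ℤ
  ... | yes gi≡0 = ≡.trans (cong (ℤ._+ ∑ g is) gi≡0) (≡.trans (ℤ.+-identityˡ _)
          (∑-same-support g uis ujs (λ j nz → to j nz ∘ there) back′))
    where
    back′ : ∀ j → g j ≢ 0ℤ → j ∈ js → j ∈ is
    back′ j nz j∈js with back j nz j∈js
    ... | here refl  = contradiction gi≡0 nz
    ... | there j∈is = j∈is
  ... | no gi≢0 with ys , zs , refl ← ∈-∃++ (to i gi≢0 (here refl))
                with p ← shift i ys zs
                with i∉ks ∷ uks ← Setoid-↭.Unique-resp-↭ (≡.setoid _) (↭⇒↭ₛ p) ujs = ≡.trans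
          (cong (λ x → g i ℤ.+ x) (∑-same-support g uis uks to′ back′)) (sym (∑-↭ g p))
    where
    to′ : ∀ j → g j ≢ 0ℤ → j ∈ is → j ∈ ys ++ zs
    to′ j nz j∈is with ∈-resp-↭ p (to j nz (there j∈is))
    ... | here refl  = contradiction refl (All.lookup i∉is j∈is)
    ... | there j∈ks = j∈ks
    back′ : ∀ j → g j ≢ 0ℤ → j ∈ ys ++ zs → j ∈ is
    back′ j nz j∈ks with back j nz (∈-resp-↭ (↭-sym p) (there j∈ks))
    ... | here refl  = contradiction refl (All.lookup i∉ks j∈ks)
    ... | there j∈is = j∈is

  -- The principle behind the identities between infinite sums: exhibit both sides as totals of the
  -- same function.
  ⇒-functional : ∀ {g : I → ℤ} {s t} → g ⇒ s → g ⇒ t → s ≡ t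
  ⇒-functional {g = g} p q = ≡.trans (sym (total p)) (≡.trans
    (∑-same-support g (unique p) (unique q) (λ i nz _ → covers q i nz) (λ i nz _ → covers p i nz))
    (total q))
    where open _⇒_

  ⇒-cong : ∀ {g h : I → ℤ} {s} → g ≗ h → g ⇒ s → h ⇒ s
  ⇒-cong g≗h p = record
    { support = support ; unique = unique
    ; covers  = λ i nz → covers i (nz ∘ ≡.trans (sym (g≗h i)))
    ; total   = ≡.trans (sym (∑-cong g≗h support)) total }
    where open _⇒_ p

  ⇒-neg : ∀ {g : I → ℤ} {s} → g ⇒ s → (λ i → ℤ.- g i) ⇒ ℤ.- s
  ⇒-neg {g = g} p = record
    { support = support ; unique = unique
    ; covers  = λ i nz → covers i (nz ∘ cong (λ x → ℤ.- x))
    ; total   = ≡.trans (∑-neg g support) (cong (λ x → ℤ.- x) total) }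
    where open _⇒_ p

  ⇒-* : ∀ c {g : I → ℤ} {s} → g ⇒ s → (λ i → c ℤ.* g i) ⇒ c ℤ.* s
  ⇒-* c {g} p = record
    { support = support ; unique = unique
    ; covers  = λ i nz → covers i (nz ∘ λ gi≡0 → ≡.trans (cong (λ x → c ℤ.* x) gi≡0) (ℤ.*-zeroʳ c))
    ; total   = ≡.trans (∑-* c g support) (cong (λ x → c ℤ.* x) total) }
    where open _⇒_ p

  ⇒-zero : ∀ {g : I → ℤ} → (∀ i → g i ≡ 0ℤ) → g ⇒ 0ℤ
  ⇒-zero g≡0 = record
    { support = [] ; unique = [] ; covers = λ i nz → contradiction (g≡0 i) nz ; total = refl }

  -- Reindexing along an injection that reaches every nonzero term; surjectivity is not demanded.
  -- The support is pulled back entry by entry, and zeros are dropped because a preimage is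
  -- available only at nonzero terms.
  ⇒-pullback : ∀ {g : I → ℤ} {s} (φ : J → I) → (∀ {x y} → φ x ≡ φ y → x ≡ y) →
               (∀ i → g i ≢ 0ℤ → ∃ λ j → φ j ≡ i) → g ⇒ s → g ∘ φ ⇒ s
  ⇒-pullback {I} {J} {g} φ φ-inj preimage p = record
    { support = preimages support
    ; unique  = preimages-unique unique
    ; covers  = λ j nz → ∈-preimages support nz (covers (φ j) nz)
    ; total   = ≡.trans (preimages-total support) total }
    where
    open _⇒_ p
    preimages : List I → List J
    preimages []       = []
    preimages (i ∷ is) with g i ℤ.≟ 0ℤ
    ... | yes _ = preimages is
    ... | no nz = proj₁ (preimage i nz) ∷ preimages is
    preimages-∈ : ∀ is {j} → j ∈ preimages is → φ j ∈ is
    preimages-∈ (i ∷ is) j∈ with g i ℤ.≟ 0ℤ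
    ... | yes _ = there (preimages-∈ is j∈)
    preimages-∈ (i ∷ is) (here refl) | no nz = here (proj₂ (preimage i nz))
    preimages-∈ (i ∷ is) (there j∈)  | no _  = there (preimages-∈ is j∈)
    ∈-preimages : ∀ is {j} → g (φ j) ≢ 0ℤ → φ j ∈ is → j ∈ preimages is
    ∈-preimages (i ∷ is) nz j∈ with g i ℤ.≟ 0ℤ
    ∈-preimages (i ∷ is) nz (here refl) | yes z = contradiction z nz
    ∈-preimages (i ∷ is) nz (there j∈)  | yes _ = ∈-preimages is nz j∈
    ∈-preimages (i ∷ is) nz (here refl) | no nz′ = here (φ-inj (sym (proj₂ (preimage i nz′))))
    ∈-preimages (i ∷ is) nz (there j∈)  | no _   = there (∈-preimages is nz j∈)
    preimages-unique : ∀ {is} → Unique is → Unique (preimages is)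
    preimages-unique [] = []
    preimages-unique {i ∷ is} (i∉is ∷ u) with g i ℤ.≟ 0ℤ
    ... | yes _ = preimages-unique u
    ... | no nz = All.tabulate (λ {j} j∈ eq → All.lookup i∉is (preimages-∈ is j∈)
                    (≡.trans (sym (proj₂ (preimage i nz))) (cong φ eq))) ∷ preimages-unique u
    preimages-total : ∀ is → ∑ (g ∘ φ) (preimages is) ≡ ∑ g is
    preimages-total []       = refl
    preimages-total (i ∷ is) with g i ℤ.≟ 0ℤ
    ... | yes z = ≡.trans (preimages-total is) (≡.trans (sym (ℤ.+-identityˡ _)) (cong (ℤ._+ ∑ g is) (sym z)))
    ... | no nz = cong₂ ℤ._+_ (cong g (proj₂ (preimage i nz))) (preimages-total is)

  -- g is the sum of its two extensions by zero, and each of these is pulled back along its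
  -- injection.
  ⇒-split : ∀ {g : I ⊎ J → ℤ} {s} → g ⇒ s →
            ∃₂ λ s₁ s₂ → g ∘ inj₁ ⇒ s₁ × g ∘ inj₂ ⇒ s₂ × s ≡ s₁ ℤ.+ s₂
  ⇒-split {I} {J} {g} {s} p = ∑ g₁ support , ∑ g₂ support ,
    ⇒-pullback inj₁ (λ where refl → refl) from₁ (restrict g₁ (λ where (inj₁ i) → λ nz → nz ; (inj₂ j) → λ nz _ → nz refl)) ,
    ⇒-pullback inj₂ (λ where refl → refl) from₂ (restrict g₂ (λ where (inj₁ i) → λ nz _ → nz refl ; (inj₂ j) → λ nz → nz)) ,
    ≡.trans (sym total) (≡.trans (∑-cong g≗g₁+g₂ support) (∑-+ g₁ g₂ support))
    where
    open _⇒_ p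
    g₁ g₂ : I ⊎ J → ℤ
    g₁ = [ g ∘ inj₁ , (λ _ → 0ℤ) ]′
    g₂ = [ (λ _ → 0ℤ) , g ∘ inj₂ ]′
    g≗g₁+g₂ : g ≗ λ x → g₁ x ℤ.+ g₂ x
    g≗g₁+g₂ (inj₁ i) = sym (ℤ.+-identityʳ _)
    g≗g₁+g₂ (inj₂ j) = sym (ℤ.+-identityˡ _)
    restrict : ∀ h → (∀ x → h x ≢ 0ℤ → g x ≢ 0ℤ) → h ⇒ ∑ h support
    restrict h h⊆g = record
      { support = support ; unique = unique ; covers = λ x nz → covers x (h⊆g x nz) ; total = refl }
    from₁ : ∀ x → g₁ x ≢ 0ℤ → ∃ λ i → inj₁ i ≡ x
    from₁ (inj₁ i) _  = i , refl
    from₁ (inj₂ j) nz = contradiction refl nz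
    from₂ : ∀ x → g₂ x ≢ 0ℤ → ∃ λ j → inj₂ j ≡ x
    from₂ (inj₁ i) nz = contradiction refl nz
    from₂ (inj₂ j) _  = j , refl

-- A finite form of Jacobi's triple product in a commutative ring.

module FiniteIdentities where

  open import Algebra using (CommutativeRing)
  open import Data.Integer as ℤ using (ℤ; _⊖_)
  import Data.Integer.Properties as ℤ
  open import Data.Nat as ℕ using (ℕ; zero; suc)
  import Data.Nat.Properties as ℕ
  open import Relation.Binary.PropositionalEquality as ≡ using (_≡_)
  import Algebra.Solver.Ring.NaturalCoefficients.Default as SemiringSolver

  module FiniteProducts {c ℓ} (R : CommutativeRing c ℓ) where

    open CommutativeRing R hiding (zero)

    ∏[_] : ℕ → (ℕ → Carrier) → Carrier
    ∏[ zero ]  u = 1#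
    ∏[ suc n ] u = ∏[ n ] u * u n

  module FiniteTripleProduct {c ℓ} (R : CommutativeRing c ℓ) where

    open CommutativeRing R hiding (zero)
    open FiniteProducts R
    open import Relation.Binary.Reasoning.Setoid setoid
    open SemiringSolver commutativeSemiring using (solve; _:=_; _:+_; _:*_; con)
    open import Algebra.Properties.Ring (CommutativeRing.ring R) using (-‿distribˡ-*; -‿distribʳ-*)

    -- Sum over the antidiagonal i + k = L. Carrying both indices avoids the subtraction L - i.
    Δ : ℕ → (ℕ → ℕ → Carrier) → Carrier
    Δ zero    F = F 0 0
    Δ (suc L) F = F 0 (suc L) + Δ L (λ i k → F (suc i) k)

    Δ-cong : ∀ L {F G} → (∀ i k → i ℕ.+ k ≡ L → F i k ≈ G i k) → Δ L F ≈ Δ L G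
    Δ-cong zero    p = p 0 0 ≡.refl
    Δ-cong (suc L) p = +-cong (p 0 (suc L) ≡.refl) (Δ-cong L (λ i k e → p (suc i) k (≡.cong suc e)))

    Δ-last : ∀ L F → Δ (suc L) F ≈ Δ L (λ i k → F i (suc k)) + F (suc L) 0
    Δ-last zero    F = refl
    Δ-last (suc L) F = trans (+-congˡ (Δ-last L (λ i → F (suc i)))) (sym (+-assoc _ _ _))

    Δ-+ : ∀ L F G → Δ L (λ i k → F i k + G i k) ≈ Δ L F + Δ L G
    Δ-+ zero    F G = refl
    Δ-+ (suc L) F G = trans (+-congˡ (Δ-+ L (λ i → F (suc i)) (λ i → G (suc i)))) (lem _ _ _ _)
      where
      lem : ∀ w x y z → w + x + (y + z) ≈ w + y + (x + z)
      lem = solve 4 (λ w x y z → w :+ x :+ (y :+ z) := w :+ y :+ (x :+ z)) refl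

    Δ-* : ∀ L a F → a * Δ L F ≈ Δ L (λ i k → a * F i k)
    Δ-* zero    a F = refl
    Δ-* (suc L) a F = trans (distribˡ a _ _) (+-congˡ (Δ-* L a (λ i → F (suc i))))

    -- Here `Q n` is the n-th power of Q and `r n` the reciprocal of (1 - Q) ... (1 - Qⁿ). For i + k
    -- = L the product `r i * r k` is a Gaussian binomial coefficient times `r L`, so the q-binomial
    -- expansion is available without dividing polynomials.
    module _
      (Q r : ℕ → Carrier) (Q-0 : Q 0 ≈ 1#) (Q-+ : ∀ m n → Q (m ℕ.+ n) ≈ Q m * Q n)
      (cancel : ∀ n {a b} → (1# - Q (suc n)) * a ≈ (1# - Q (suc n)) * b → a ≈ b)
      (r-0 : r 0 ≈ 1#) (r-suc : ∀ n → (1# - Q (suc n)) * r (suc n) ≈ r n) where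

      -- Removes the end of the antidiagonal where one index is 0, so that `r-suc` applies to all
      -- other terms.
      1-Q0 : ∀ a b → a * ((1# - Q 0) * b) ≈ 0#
      1-Q0 a b = begin
        a * ((1# - Q 0) * b)  ≈⟨ *-congˡ (*-congʳ (+-congˡ (-‿cong Q-0))) ⟩
        a * ((1# - 1#) * b)   ≈⟨ *-congˡ (trans (*-congʳ (-‿inverseʳ 1#)) (zeroˡ b)) ⟩
        a * 0#                ≈⟨ zeroʳ a ⟩
        0#                    ∎

      1-Q+ : ∀ i k → 1# - Q (i ℕ.+ k) ≈ (1# - Q k) + Q k * (1# - Q i)
      1-Q+ i k = begin
        1# - Q (i ℕ.+ k)                     ≈⟨ +-congˡ (-‿cong (trans (Q-+ i k) (*-comm _ _))) ⟩
        1# - Q k * Q i                       ≈⟨ +-congʳ (trans (+-congˡ (-‿inverseˡ (Q k))) (+-identityʳ 1#)) ⟨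
        1# + (- Q k + Q k) - Q k * Q i       ≈⟨ +-congʳ (+-assoc _ _ _) ⟨
        (1# - Q k) + Q k - Q k * Q i         ≈⟨ +-assoc _ _ _ ⟩
        (1# - Q k) + (Q k - Q k * Q i)       ≈⟨ +-congˡ (+-cong (*-identityʳ (Q k)) (sym (-‿distribʳ-* _ _))) ⟨
        (1# - Q k) + (Q k * 1# + Q k * - Q i)  ≈⟨ +-congˡ (distribˡ _ _ _) ⟨
        (1# - Q k) + Q k * (1# - Q i)        ∎

      1-distrib : ∀ a b c → (1# - a) * (b * c) ≈ b * c + - (a * b) * c
      1-distrib a b c = trans (distribʳ _ _ _) (+-cong (*-identityˡ _)
        (trans (sym (*-assoc _ _ _)) (*-congʳ (sym (-‿distribˡ-* a b)))))

      -- Both recurrences come from splitting 1 - Q^{i+k} as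
      -- (1 - Q^k) + Q^k (1 - Q^i), or the same with i and k exchanged.
      pascalˡ : ∀ L (T : ℕ → ℕ → Carrier) → (1# - Q (suc L)) * Δ (suc L) (λ i k → T i k * (r i * r k)) ≈
        Δ L (λ i k → T i (suc k) * (r i * r k)) + Δ L (λ i k → Q k * T (suc i) k * (r i * r k))
      pascalˡ L T = begin
        (1# - Q (suc L)) * Δ (suc L) (λ i k → T i k * (r i * r k))
          ≈⟨ Δ-* (suc L) _ (λ i k → T i k * (r i * r k)) ⟩
        Δ (suc L) (λ i k → (1# - Q (suc L)) * (T i k * (r i * r k)))
          ≈⟨ Δ-cong (suc L) split ⟩
        Δ (suc L) (λ i k → A i k + B i k)
          ≈⟨ Δ-+ (suc L) A B ⟩
        Δ (suc L) A + Δ (suc L) B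
          ≈⟨ +-cong (trans (Δ-last L A) (+-cong (Δ-cong L λ i k _ → A-suc i k) (1-Q0 _ _)))
                    (+-cong (1-Q0 _ _) (Δ-cong L λ i k _ → B-suc i k)) ⟩
        Δ L (λ i k → T i (suc k) * (r i * r k)) + 0# + (0# + Δ L (λ i k → Q k * T (suc i) k * (r i * r k)))
          ≈⟨ +-cong (+-identityʳ _) (+-identityˡ _) ⟩
        Δ L (λ i k → T i (suc k) * (r i * r k)) + Δ L (λ i k → Q k * T (suc i) k * (r i * r k)) ∎
        where
        A B : ℕ → ℕ → Carrier
        A i k = T i k * r i * ((1# - Q k) * r k)
        B i k = Q k * T i k * r k * ((1# - Q i) * r i)
        split : ∀ i k → i ℕ.+ k ≡ suc L → (1# - Q (suc L)) * (T i k * (r i * r k)) ≈ A i k + B i k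
        split i k e = begin
          (1# - Q (suc L)) * (T i k * (r i * r k))  ≡⟨ ≡.cong (λ n → (1# - Q n) * (T i k * (r i * r k))) e ⟨
          (1# - Q (i ℕ.+ k)) * (T i k * (r i * r k))  ≈⟨ *-congʳ (1-Q+ i k) ⟩
          (1# - Q k + Q k * (1# - Q i)) * (T i k * (r i * r k))  ≈⟨ lem (1# - Q k) (1# - Q i) (Q k) (T i k) (r i) (r k) ⟩
          A i k + B i k ∎
          where
          lem : ∀ u v q t ri rk → (u + q * v) * (t * (ri * rk)) ≈
                t * ri * (u * rk) + q * t * rk * (v * ri)
          lem = solve 6 (λ u v q t ri rk →
            (u :+ q :* v) :* (t :* (ri :* rk)) :=
            t :* ri :* (u :* rk) :+ q :* t :* rk :* (v :* ri)) refl
        A-suc : ∀ i k → A i (suc k) ≈ T i (suc k) * (r i * r k)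
        A-suc i k = trans (*-congˡ (r-suc k)) (*-assoc _ _ _)
        B-suc : ∀ i k → B (suc i) k ≈ Q k * T (suc i) k * (r i * r k)
        B-suc i k = trans (*-congˡ (r-suc i)) (trans (*-assoc _ _ _) (*-congˡ (*-comm _ _)))

      pascalʳ : ∀ L (T : ℕ → ℕ → Carrier) → (1# - Q (suc L)) * Δ (suc L) (λ i k → T i k * (r i * r k)) ≈
        Δ L (λ i k → T (suc i) k * (r i * r k)) + Δ L (λ i k → Q i * T i (suc k) * (r i * r k))
      pascalʳ L T = begin
        (1# - Q (suc L)) * Δ (suc L) (λ i k → T i k * (r i * r k))
          ≈⟨ Δ-* (suc L) _ (λ i k → T i k * (r i * r k)) ⟩
        Δ (suc L) (λ i k → (1# - Q (suc L)) * (T i k * (r i * r k)))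
          ≈⟨ Δ-cong (suc L) split ⟩
        Δ (suc L) (λ i k → A i k + B i k)
          ≈⟨ Δ-+ (suc L) A B ⟩
        Δ (suc L) A + Δ (suc L) B
          ≈⟨ +-cong (+-cong (1-Q0 _ _) (Δ-cong L λ i k _ → A-suc i k))
                    (trans (Δ-last L B) (+-cong (Δ-cong L λ i k _ → B-suc i k) (1-Q0 _ _))) ⟩
        0# + Δ L (λ i k → T (suc i) k * (r i * r k)) + (Δ L (λ i k → Q i * T i (suc k) * (r i * r k)) + 0#)
          ≈⟨ +-cong (+-identityˡ _) (+-identityʳ _) ⟩
        Δ L (λ i k → T (suc i) k * (r i * r k)) + Δ L (λ i k → Q i * T i (suc k) * (r i * r k)) ∎
        where
        A B : ℕ → ℕ → Carrier
        A i k = T i k * r k * ((1# - Q i) * r i)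
        B i k = Q i * T i k * r i * ((1# - Q k) * r k)
        split : ∀ i k → i ℕ.+ k ≡ suc L → (1# - Q (suc L)) * (T i k * (r i * r k)) ≈ A i k + B i k
        split i k e = begin
          (1# - Q (suc L)) * (T i k * (r i * r k))  ≡⟨ ≡.cong (λ n → (1# - Q n) * (T i k * (r i * r k))) e ⟨
          (1# - Q (i ℕ.+ k)) * (T i k * (r i * r k))  ≡⟨ ≡.cong (λ n → (1# - Q n) * (T i k * (r i * r k))) (ℕ.+-comm i k) ⟩
          (1# - Q (k ℕ.+ i)) * (T i k * (r i * r k))  ≈⟨ *-congʳ (1-Q+ k i) ⟩
          (1# - Q i + Q i * (1# - Q k)) * (T i k * (r i * r k))  ≈⟨ lem (1# - Q i) (1# - Q k) (Q i) (T i k) (r i) (r k) ⟩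
          A i k + B i k ∎
          where
          lem : ∀ u v q t ri rk → (u + q * v) * (t * (ri * rk)) ≈
                t * rk * (u * ri) + q * t * ri * (v * rk)
          lem = solve 6 (λ u v q t ri rk →
            (u :+ q :* v) :* (t :* (ri :* rk)) :=
            t :* rk :* (u :* ri) :+ q :* t :* ri :* (v :* rk)) refl
        A-suc : ∀ i k → A (suc i) k ≈ T (suc i) k * (r i * r k)
        A-suc i k = trans (*-congˡ (r-suc i)) (trans (*-assoc _ _ _) (*-congˡ (*-comm _ _)))
        B-suc : ∀ i k → B i (suc k) ≈ Q i * T i (suc k) * (r i * r k)
        B-suc i k = trans (*-congˡ (r-suc k)) (*-assoc _ _ _)

      -- The model is t j = (-1)ʲ xʲ Q^(j(j-1)/2) with x y = Q. The last two hypotheses are t (j +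
      -- 1) = - x Qʲ t j and t (j - 1) = - y Q⁻ʲ t j for j = i - M, multiplied by a power of Q so
      -- that only natural exponents occur.
      module _
        (x y : Carrier) (t : ℤ → Carrier) (t-0 : t (0 ⊖ 0) ≈ 1#)
        (t-x : ∀ M N i k → i ℕ.+ k ≡ M ℕ.+ N → - (x * Q N * t (i ⊖ M)) ≈ Q k * t (suc i ⊖ M))
        (t-y : ∀ M i → - (y * Q M * t (i ⊖ M)) ≈ Q i * t (i ⊖ suc M)) where

        X Y : ℕ → Carrier
        X k = 1# - x * Q k
        Y k = 1# - y * Q k

        term : ℕ → ℕ → ℕ → Carrier
        term M i k = t (i ⊖ M) * (r i * r k)

        -- Induction on the number of factors, removing those in x first and then those in y.
        -- Multiplication by 1 - Q^(L+1) lowers r (L + 1) to r L, so the last factor acts on the sum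
        -- for L; its two terms yield the two sums of `pascalˡ` for a factor in x and of `pascalʳ`
        -- for a factor in y.
        finiteTripleProduct : ∀ M N L → M ℕ.+ N ≡ L →
          ∏[ N ] X * ∏[ M ] Y * r L ≈ Δ L (term M)
        finiteTripleProduct zero zero .0 ≡.refl = begin
          1# * 1# * r 0           ≈⟨ *-congʳ (*-identityˡ 1#) ⟩
          1# * r 0                ≈⟨ *-cong (sym t-0) (trans (sym (*-identityˡ _)) (*-congʳ (sym r-0))) ⟩
          t (0 ⊖ 0) * (r 0 * r 0) ∎
        finiteTripleProduct (suc M) zero (suc L) ≡.refl = cancel L (begin
          (1# - Q (suc L)) * (1# * (∏[ M ] Y * Y M) * r (suc L))
            ≈⟨ lem₁ _ _ _ _ ⟩
          Y M * (1# * ∏[ M ] Y * ((1# - Q (suc L)) * r (suc L)))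
            ≈⟨ *-congˡ (trans (*-congˡ (r-suc L)) (finiteTripleProduct M zero L ≡.refl)) ⟩
          Y M * Δ L (term M)
            ≈⟨ Δ-* L _ _ ⟩
          Δ L (λ i k → Y M * term M i k)
            ≈⟨ Δ-cong L (λ i k _ → step i k) ⟩
          Δ L (λ i k → t (suc i ⊖ suc M) * (r i * r k) + Q i * t (i ⊖ suc M) * (r i * r k))
            ≈⟨ Δ-+ L _ _ ⟩
          Δ L (λ i k → t (suc i ⊖ suc M) * (r i * r k)) + Δ L (λ i k → Q i * t (i ⊖ suc M) * (r i * r k))
            ≈⟨ pascalʳ L (λ i _ → t (i ⊖ suc M)) ⟨
          (1# - Q (suc L)) * Δ (suc L) (term (suc M)) ∎)
          where
          lem₁ : ∀ a b c d → a * (1# * (b * c) * d) ≈ c * (1# * b * (a * d))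
          lem₁ = solve 4 (λ a b c d → a :* (con 1 :* (b :* c) :* d) := c :* (con 1 :* b :* (a :* d))) refl
          step : ∀ i k → Y M * term M i k ≈
                 t (suc i ⊖ suc M) * (r i * r k) + Q i * t (i ⊖ suc M) * (r i * r k)
          step i k = begin
            Y M * term M i k
              ≈⟨ 1-distrib (y * Q M) (t (i ⊖ M)) (r i * r k) ⟩
            t (i ⊖ M) * (r i * r k) + - (y * Q M * t (i ⊖ M)) * (r i * r k)
              ≈⟨ +-congˡ (*-congʳ (t-y M i)) ⟩
            t (i ⊖ M) * (r i * r k) + Q i * t (i ⊖ suc M) * (r i * r k)
              ≡⟨ ≡.cong (λ z → t z * (r i * r k) + Q i * t (i ⊖ suc M) * (r i * r k)) (ℤ.[1+m]⊖[1+n]≡m⊖n i M) ⟨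
            t (suc i ⊖ suc M) * (r i * r k) + Q i * t (i ⊖ suc M) * (r i * r k) ∎
        finiteTripleProduct M (suc N) zero e with () ← ≡.trans (≡.sym (ℕ.+-suc M N)) e
        finiteTripleProduct M (suc N) (suc L) e = cancel L (begin
          (1# - Q (suc L)) * (∏[ N ] X * X N * ∏[ M ] Y * r (suc L))
            ≈⟨ lem₁ _ _ _ _ _ ⟩
          X N * (∏[ N ] X * ∏[ M ] Y * ((1# - Q (suc L)) * r (suc L)))
            ≈⟨ *-congˡ (trans (*-congˡ (r-suc L)) (finiteTripleProduct M N L M+N≡L)) ⟩
          X N * Δ L (term M)
            ≈⟨ Δ-* L _ _ ⟩
          Δ L (λ i k → X N * term M i k)
            ≈⟨ Δ-cong L step ⟩
          Δ L (λ i k → t (i ⊖ M) * (r i * r k) + Q k * t (suc i ⊖ M) * (r i * r k))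
            ≈⟨ Δ-+ L _ _ ⟩
          Δ L (λ i k → t (i ⊖ M) * (r i * r k)) + Δ L (λ i k → Q k * t (suc i ⊖ M) * (r i * r k))
            ≈⟨ pascalˡ L (λ i _ → t (i ⊖ M)) ⟨
          (1# - Q (suc L)) * Δ (suc L) (term M) ∎)
          where
          M+N≡L : M ℕ.+ N ≡ L
          M+N≡L = ℕ.suc-injective (≡.trans (≡.sym (ℕ.+-suc M N)) e)
          lem₁ : ∀ a b c d e → a * (b * c * d * e) ≈ c * (b * d * (a * e))
          lem₁ = solve 5 (λ a b c d e → a :* (b :* c :* d :* e) := c :* (b :* d :* (a :* e))) refl
          step : ∀ i k → i ℕ.+ k ≡ L → X N * term M i k ≈
                 t (i ⊖ M) * (r i * r k) + Q k * t (suc i ⊖ M) * (r i * r k)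
          step i k e′ = begin
            X N * term M i k
              ≈⟨ 1-distrib (x * Q N) (t (i ⊖ M)) (r i * r k) ⟩
            t (i ⊖ M) * (r i * r k) + - (x * Q N * t (i ⊖ M)) * (r i * r k)
              ≈⟨ +-congˡ (*-congʳ (t-x M N i k (≡.trans e′ (≡.sym M+N≡L)))) ⟩
            t (i ⊖ M) * (r i * r k) + Q k * t (suc i ⊖ M) * (r i * r k) ∎

  module Inverses {c ℓ} (R : CommutativeRing c ℓ) where

    open CommutativeRing R
    open SemiringSolver commutativeSemiring using (solve; _:=_; _:*_)

    insert-inverse : ∀ x p r → p * r ≈ 1# → x * p ≈ (p * p) * (x * r)
    insert-inverse x p r pr≈1 = trans (trans (sym (*-identityʳ _)) (*-congˡ (sym pr≈1)))
      (solve 3 (λ x p r → x :* p :* (p :* r) := (p :* p) :* (x :* r)) refl x p r)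

    cancel-inverse : ∀ x p r → p * r ≈ 1# → (p * p) * ((r * r) * x) ≈ x
    cancel-inverse x p r pr≈1 = trans
      (solve 3 (λ x p r → (p :* p) :* ((r :* r) :* x) := (p :* r) :* ((p :* r) :* x)) refl x p r)
      (trans (*-cong pr≈1 (*-congʳ pr≈1)) (trans (*-identityˡ _) (*-identityˡ x)))

-- Convergent products, signs, and the exponents of theta series.

module InfiniteProducts where

  open import Defs renaming (_⊖_ to _⊝⊝_)
  open FormalSeries
  open FiniteIdentities
  open import Algebra using (CommutativeRing)
  open import Data.Integer as ℤ using (ℤ; 0ℤ; 1ℤ; +_; -[1+_]; _⊖_)
  import Data.Integer.Properties as ℤ
  import Data.Integer.Tactic.RingSolver as ℤ-Solver
  open import Data.Nat using (ℕ; zero; suc; _+_; _*_; _∸_; _≤_; _<_; NonZero)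
  import Data.Nat.Properties as ℕ
  open import Data.Product using (_,_)
  open import Function using (_∘_)
  open import Level using (0ℓ)
  open import Relation.Binary.PropositionalEquality

  -- The ring modulo q^(n+1), with whole series as representatives. Limits become equational
  -- reasoning in this ring for each n.
  truncated : ℕ → CommutativeRing 0ℓ 0ℓ
  truncated n = record
    { Carrier = Series ; _≈_ = _≈[ n ]_ ; _+_ = _⊕_ ; _*_ = _⊛_ ; -_ = ⊝_ ; 0# = 𝟎 ; 1# = q^ 0
    ; isCommutativeRing = record
      { isRing = record
        { +-isAbelianGroup = record
          { isGroup = record
            { isMonoid = record
              { isSemigroup = record
                { isMagma = record
                  { isEquivalence = record
                    { refl = λ _ _ → refl
                    ; sym = λ p k k≤n → sym (p k k≤n)
                    ; trans = λ p q k k≤n → trans (p k k≤n) (q k k≤n) }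
                  ; ∙-cong = λ p q k k≤n → cong₂ ℤ._+_ (p k k≤n) (q k k≤n) }
                ; assoc = λ a b c k _ → S.+-assoc a b c k }
              ; identity = (λ a k _ → S.+-identityˡ a k) , (λ a k _ → S.+-identityʳ a k) }
            ; inverse = (λ a k _ → S.-‿inverseˡ a k) , (λ a k _ → S.-‿inverseʳ a k)
            ; ⁻¹-cong = λ p k k≤n → cong (λ z → ℤ.- z) (p k k≤n) }
          ; comm = λ a b k _ → S.+-comm a b k }
        ; *-cong = ⊛-cong-≤ n
        ; *-assoc = λ a b c k _ → S.*-assoc a b c k
        ; *-identity = (λ a k _ → S.*-identityˡ a k) , (λ a k _ → S.*-identityʳ a k)
        ; distrib = (λ a b c k _ → S.distribˡ a b c k) , (λ a b c k _ → S.distribʳ a b c k) }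
      ; *-comm = λ a b k _ → S.*-comm a b k } }
    where module S = CommutativeRing Series-commutativeRing

  module S = CommutativeRing Series-commutativeRing
  module T n = CommutativeRing (truncated n)

  open FiniteProducts Series-commutativeRing public

  ≗⇒≈ : ∀ {a b n} → a ≗ b → a ≈[ n ] b
  ≗⇒≈ p k _ = p k

  ≈-weaken : ∀ {a b m n} → m ≤ n → a ≈[ n ] b → a ≈[ m ] b
  ≈-weaken m≤n p k k≤m = p k (ℕ.≤-trans k≤m m≤n)

  q^-≈0 : ∀ {m n} → n < m → q^ m ≈[ n ] 𝟎
  q^-≈0 n<m k k≤n = q^-vanish (ℕ.≤-<-trans k≤n n<m)

  -- Factor k is 1 modulo q^(k+1), so it leaves all coefficients up to qᵏ unchanged: this is the
  -- form of convergence used for products.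
  Admissible : (ℕ → Series) → Set
  Admissible u = ∀ k → u k ≈[ k ] q^ 0

  1-q^-≈1 : ∀ {m n} → n < m → q^ 0 ⊝⊝ q^ m ≈[ n ] q^ 0
  1-q^-≈1 n<m k k≤n = trans (cong (λ z → (q^ 0) k ℤ.- z) (q^-≈0 n<m k k≤n)) (ℤ.+-identityʳ _)

  ⊛-≈1 : ∀ {a b} n → a ≈[ n ] q^ 0 → b ≈[ n ] q^ 0 → a ⊛ b ≈[ n ] q^ 0
  ⊛-≈1 n p q = T.trans n (T.*-cong n p q) (T.*-identityˡ n (q^ 0))

  ∏-stable : ∀ {u} → Admissible u → ∀ {n m} → n ≤ m → ∏[ m ] u ≈[ n ] ∏[ n ] u
  ∏-stable {u} adm {n} {m} n≤m = subst (λ x → ∏[ x ] u ≈[ n ] ∏[ n ] u) (ℕ.m∸n+n≡m n≤m) (go (m ∸ n))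
    where
    go : ∀ d → ∏[ d + n ] u ≈[ n ] ∏[ n ] u
    go zero    = T.refl n
    go (suc d) = T.trans n (T.*-cong n (go d) (≈-weaken (ℕ.m≤n+m n d) (adm (d + n)))) (T.*-identityʳ n _)

  ∏-cong : ∀ {u v} → (∀ k → u k ≗ v k) → ∀ n → ∏[ n ] u ≗ ∏[ n ] v
  ∏-cong p zero    = S.refl
  ∏-cong p (suc n) = ⊛-cong (∏-cong p n) (p n)

  ∏-⊛ : ∀ u v n → ∏[ n ] (λ k → u k ⊛ v k) ≗ ∏[ n ] u ⊛ ∏[ n ] v
  ∏-⊛ u v zero    = S.sym (⊛-identityˡ (q^ 0))
  ∏-⊛ u v (suc n) = S.trans (S.*-congʳ (∏-⊛ u v n))
    (interchange (∏[ n ] u) (∏[ n ] v) (u n) (v n))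
    where open import Algebra.Properties.CommutativeSemigroup S.*-commutativeSemigroup using (interchange)

  ∏-0 : ∀ {u} → (∀ k → u k 0 ≡ 1ℤ) → ∀ n → (∏[ n ] u) 0 ≡ 1ℤ
  ∏-0 p zero    = refl
  ∏-0 {u} p (suc n) = cong₂ (λ x y → x ℤ.* y ℤ.+ 0ℤ) (∏-0 {u} p n) (p n)

  -- Products of admissible factors converge; as for f, the coefficient of qⁿ
  -- is that of the product of the first n factors.
  ∏∞ : (ℕ → Series) → Series
  ∏∞ u n = (∏[ n ] u) n

  ∏∞-≈ : ∀ {u} → Admissible u → ∀ {n m} → n ≤ m → ∏∞ u ≈[ n ] ∏[ m ] u
  ∏∞-≈ adm n≤m k k≤n = sym (∏-stable adm (ℕ.≤-trans k≤n n≤m) k ℕ.≤-refl)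

  ∏∞-cong : ∀ {u v} → (∀ k → u k ≗ v k) → ∏∞ u ≗ ∏∞ v
  ∏∞-cong p n = ∏-cong p n n

  ∏∞-⊛ : ∀ {u v} → Admissible u → Admissible v → ∏∞ (λ k → u k ⊛ v k) ≗ ∏∞ u ⊛ ∏∞ v
  ∏∞-⊛ {u} {v} admu admv n = trans (∏-⊛ u v n n)
    (sym (⊛-cong-≤ n (∏∞-≈ admu ℕ.≤-refl) (∏∞-≈ admv ℕ.≤-refl) n ℕ.≤-refl))

  ∏-+ : ∀ u m n → ∏[ m + n ] u ≗ ∏[ m ] u ⊛ ∏[ n ] (λ k → u (m + k))
  ∏-+ u m zero    = S.trans (λ k → cong (λ z → (∏[ z ] u) k) (ℕ.+-identityʳ m)) (S.sym (⊛-identityʳ _))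
  ∏-+ u m (suc n) = S.trans (λ k → cong (λ z → (∏[ z ] u) k) (ℕ.+-suc m n))
    (S.trans (S.*-congʳ (∏-+ u m n)) (⊛-assoc (∏[ m ] u) (∏[ n ] (λ k → u (m + k))) (u (m + n))))

  ∏-blocks : ∀ b u n → ∏[ n * b ] u ≗ ∏[ n ] (λ k → ∏[ b ] (λ i → u (k * b + i)))
  ∏-blocks b u zero    = S.refl
  ∏-blocks b u (suc n) = S.trans (λ k → cong (λ z → (∏[ z ] u) k) (ℕ.+-comm b (n * b)))
    (S.trans (∏-+ u (n * b) b) (S.*-congʳ (∏-blocks b u n)))

  -- As b is at least 1, the first n blocks contain the first n factors, and the further ones do not
  -- affect the coefficient of qⁿ.
  ∏∞-blocks : ∀ b .{{_ : NonZero b}} {u} → Admissible u → ∏∞ u ≗ ∏∞ (λ k → ∏[ b ] (λ i → u (k * b + i)))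
  ∏∞-blocks b {u} adm n = trans (∏∞-≈ adm (ℕ.m≤m*n n b) n ℕ.≤-refl) (∏-blocks b u n n)

  2*-injective : ∀ {m n} → + m ℤ.+ + m ≡ + n ℤ.+ + n → m ≡ n
  2*-injective {m} {n} eq = ℕ.*-cancelˡ-≡ m n 2 (begin
    m + (m + 0) ≡⟨ cong (λ z → m + z) (ℕ.+-identityʳ m) ⟩
    m + m       ≡⟨ ℤ.+-injective eq ⟩
    n + n       ≡⟨ cong (λ z → n + z) (ℕ.+-identityʳ n) ⟨
    n + (n + 0) ∎)
    where open ≡-Reasoning

  alt : ℕ → ℤ
  alt zero    = 1ℤ
  alt (suc n) = ℤ.- alt n

  alt-+ : ∀ m n → alt (m + n) ≡ alt m ℤ.* alt n
  alt-+ zero    n = sym (ℤ.*-identityˡ _)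
  alt-+ (suc m) n = trans (cong (λ z → ℤ.- z) (alt-+ m n)) (ℤ.neg-distribˡ-* (alt m) (alt n))

  sgn : ℤ → ℤ
  sgn j = alt ℤ.∣ j ∣

  sgn-⊖ : ∀ m n → sgn (m ⊖ n) ≡ alt (m + n)
  sgn-⊖ m       zero    = cong alt (sym (ℕ.+-identityʳ m))
  sgn-⊖ zero    (suc n) = refl
  sgn-⊖ (suc m) (suc n) = begin
    sgn (suc m ⊖ suc n)      ≡⟨ cong sgn (ℤ.[1+m]⊖[1+n]≡m⊖n m n) ⟩
    sgn (m ⊖ n)              ≡⟨ sgn-⊖ m n ⟩
    alt (m + n)              ≡⟨ ℤ.neg-involutive _ ⟨
    alt (suc (suc (m + n)))  ≡⟨ cong (alt ∘ suc) (ℕ.+-suc m n) ⟨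
    alt (suc m + suc n)      ∎
    where open ≡-Reasoning

  sgn-+ : ∀ i j → sgn (i ℤ.+ j) ≡ sgn i ℤ.* sgn j
  sgn-+ (+ m)    (+ n)    = alt-+ m n
  sgn-+ (+ m)    -[1+ n ] = trans (sgn-⊖ m (suc n)) (alt-+ m (suc n))
  sgn-+ -[1+ m ] (+ n)    = trans (sgn-⊖ n (suc m)) (trans (alt-+ n (suc m)) (ℤ.*-comm (alt n) _))
  sgn-+ -[1+ m ] -[1+ n ] = trans (cong (alt ∘ suc) (sym (ℕ.+-suc m n))) (alt-+ (suc m) (suc n))

  -- n (n - 1) / 2
  tri : ℕ → ℕ
  tri zero    = 0
  tri (suc n) = n + tri n

  -- ((s + s′) j² + (s - s′) j) / 2, see 2expo
  expo : ℕ → ℕ → ℤ → ℕ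
  expo s s′ (+ n)    = s * n + (s + s′) * tri n
  expo s s′ -[1+ n ] = s′ * suc n + (s + s′) * tri (suc n)

  2tri : ∀ n → + tri n ℤ.+ + tri n ≡ + n ℤ.* + n ℤ.- + n
  2tri zero    = refl
  2tri (suc n) = trans (lem₁ (+ n) (+ tri n)) (trans (cong (λ z → + n ℤ.+ + n ℤ.+ z) (2tri n)) (lem₂ (+ n)))
    where
    lem₁ : ∀ n t → n ℤ.+ t ℤ.+ (n ℤ.+ t) ≡ n ℤ.+ n ℤ.+ (t ℤ.+ t)
    lem₁ = ℤ-Solver.solve-∀
    lem₂ : ∀ n → n ℤ.+ n ℤ.+ (n ℤ.* n ℤ.- n) ≡ (1ℤ ℤ.+ n) ℤ.* (1ℤ ℤ.+ n) ℤ.- (1ℤ ℤ.+ n)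
    lem₂ = ℤ-Solver.solve-∀

  private
    pos-expo : ∀ u s s′ n → + (u * n + (s + s′) * tri n) ≡ + u ℤ.* + n ℤ.+ (+ s ℤ.+ + s′) ℤ.* + tri n
    pos-expo u s s′ n = cong₂ ℤ._+_ (ℤ.pos-* u n) (ℤ.pos-* (s + s′) (tri n))
    double : ∀ u n w t → u ℤ.* n ℤ.+ w ℤ.* t ℤ.+ (u ℤ.* n ℤ.+ w ℤ.* t) ≡ u ℤ.* n ℤ.+ u ℤ.* n ℤ.+ w ℤ.* (t ℤ.+ t)
    double = ℤ-Solver.solve-∀

  -- Exponents of q must be natural numbers, hence the case distinction in `expo`; doubled and read
  -- in ℤ, both cases are one polynomial in j, which the ring solver can handle.
  2expo : ∀ s s′ j → + expo s s′ j ℤ.+ + expo s s′ j ≡ (+ s ℤ.+ + s′) ℤ.* (j ℤ.* j) ℤ.+ (+ s ℤ.- + s′) ℤ.* j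
  2expo s s′ (+ n) = begin
    + expo s s′ (+ n) ℤ.+ + expo s s′ (+ n)
      ≡⟨ cong₂ ℤ._+_ (pos-expo s s s′ n) (pos-expo s s s′ n) ⟩
    _ ≡⟨ double (+ s) (+ n) (+ s ℤ.+ + s′) (+ tri n) ⟩
    + s ℤ.* + n ℤ.+ + s ℤ.* + n ℤ.+ (+ s ℤ.+ + s′) ℤ.* (+ tri n ℤ.+ + tri n)
      ≡⟨ cong (λ z → + s ℤ.* + n ℤ.+ + s ℤ.* + n ℤ.+ (+ s ℤ.+ + s′) ℤ.* z) (2tri n) ⟩
    _ ≡⟨ lem (+ s) (+ s′) (+ n) ⟩
    _ ∎
    where
    open ≡-Reasoning
    lem : ∀ s s′ n → s ℤ.* n ℤ.+ s ℤ.* n ℤ.+ (s ℤ.+ s′) ℤ.* (n ℤ.* n ℤ.- n)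
                   ≡ (s ℤ.+ s′) ℤ.* (n ℤ.* n) ℤ.+ (s ℤ.- s′) ℤ.* n
    lem = ℤ-Solver.solve-∀
  2expo s s′ -[1+ n ] = begin
    + expo s s′ -[1+ n ] ℤ.+ + expo s s′ -[1+ n ]
      ≡⟨ cong₂ ℤ._+_ (pos-expo s′ s s′ (suc n)) (pos-expo s′ s s′ (suc n)) ⟩
    _ ≡⟨ double (+ s′) (+ suc n) (+ s ℤ.+ + s′) (+ tri (suc n)) ⟩
    + s′ ℤ.* + suc n ℤ.+ + s′ ℤ.* + suc n ℤ.+ (+ s ℤ.+ + s′) ℤ.* (+ tri (suc n) ℤ.+ + tri (suc n))
      ≡⟨ cong (λ z → + s′ ℤ.* + suc n ℤ.+ + s′ ℤ.* + suc n ℤ.+ (+ s ℤ.+ + s′) ℤ.* z) (2tri (suc n)) ⟩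
    _ ≡⟨ lem (+ s) (+ s′) (+ suc n) ⟩
    _ ∎
    where
    open ≡-Reasoning
    lem : ∀ s s′ n → s′ ℤ.* n ℤ.+ s′ ℤ.* n ℤ.+ (s ℤ.+ s′) ℤ.* (n ℤ.* n ℤ.- n)
                   ≡ (s ℤ.+ s′) ℤ.* (ℤ.- n ℤ.* ℤ.- n) ℤ.+ (s ℤ.- s′) ℤ.* ℤ.- n
    lem = ℤ-Solver.solve-∀

  -- The linear part alone is this large. Therefore only terms with ∣j∣ ≤ n reach the coefficient of
  -- qⁿ in a theta series.
  ∣j∣≤expo : ∀ s s′ .{{_ : NonZero s}} .{{_ : NonZero s′}} j → ℤ.∣ j ∣ ≤ expo s s′ j
  ∣j∣≤expo s s′ (+ n)    = ℕ.≤-trans (ℕ.m≤n*m n s) (ℕ.m≤m+n _ _)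
  ∣j∣≤expo s s′ -[1+ n ] = ℕ.≤-trans (ℕ.m≤n*m (suc n) s′) (ℕ.m≤m+n _ _)

  q^-•q^ : ∀ c m n → q^ m ⊛ (c • q^ n) ≗ c • q^ (m + n)
  q^-•q^ c m n = S.trans (⊛-comm (q^ m) (c • q^ n)) (S.trans (•-⊛ c (q^ n) (q^ m))
    (λ k → cong (λ z → c ℤ.* z) (trans (⊛-comm (q^ n) (q^ m) k) (q^-+ m n k))))

-- Jacobi's triple product identity.

module TripleProduct where

  open import Defs renaming (_⊖_ to _⊝⊝_)
  open FormalSeries
  open FiniteSums
  open FiniteIdentities
  open InfiniteProducts
  open import Data.Integer as ℤ using (ℤ; 0ℤ; 1ℤ; +_; -[1+_]; _⊖_)
  import Data.Integer.Properties as ℤ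
  import Data.Integer.Tactic.RingSolver as ℤ-Solver
  open import Data.List using (List; applyUpTo)
  open import Data.List.Membership.Propositional using (_∈_)
  open import Data.List.Membership.Propositional.Properties using (∈-applyUpTo⁺)
  open import Data.List.Relation.Unary.Unique.Propositional using (Unique)
  import Data.List.Relation.Unary.Unique.Propositional.Properties as Unique
  open import Data.Nat using (ℕ; zero; suc; _+_; _*_; _∸_; _≤_; _<_; z≤n; s≤s; NonZero)
  import Data.Nat as ℕ
  import Data.Nat.Properties as ℕ
  import Data.Nat.Tactic.RingSolver as ℕ-Solver
  open import Data.Sum using (inj₁; inj₂)
  open import Function using (_∘_)
  open import Relation.Binary.PropositionalEquality
  open import Relation.Nullary using (yes; no; contradiction)

  open Inverses Series-commutativeRing using (insert-inverse; cancel-inverse)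

  -- The term of index j in Jacobi's theta series. For s = 1 and s′ = 2 the exponents are the
  -- generalized pentagonal numbers j (3 j - 1) / 2.
  θ : ℕ → ℕ → ℤ → Series
  θ s s′ j = sgn j • q^ expo s s′ j

  -- The k-th factor of (q^s, q^s′, q^(s+s′); q^(s+s′))_∞.
  tripleFactor : ℕ → ℕ → ℕ → Series
  tripleFactor s s′ k =
    (q^ 0 ⊝⊝ q^ (s + (s + s′) * k)) ⊛ (q^ 0 ⊝⊝ q^ (s′ + (s + s′) * k)) ⊛
    (q^ 0 ⊝⊝ q^ ((s + s′) * suc k))

  symmetricRange : ℕ → List ℤ
  symmetricRange n = applyUpTo (_⊖ n) (suc (n + n))

  ⊖-injective : ∀ n {i j} → i ⊖ n ≡ j ⊖ n → i ≡ j
  ⊖-injective n {i} {j} p = ℤ.+-injective (+-cancelʳ (ℤ.- (+ n)) (+ i) (+ j)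
    (trans (ℤ.m-n≡m⊖n i n) (trans p (sym (ℤ.m-n≡m⊖n j n)))))

  symmetricRange-unique : ∀ n → Unique (symmetricRange n)
  symmetricRange-unique n = Unique.applyUpTo⁺₁ (_⊖ n) (suc (n + n)) (λ i<j _ → ℕ.<⇒≢ i<j ∘ ⊖-injective n)

  ∈-symmetricRange : ∀ {n} j → ℤ.∣ j ∣ ≤ n → j ∈ symmetricRange n
  ∈-symmetricRange {n} (+ m) m≤n = subst (_∈ symmetricRange n)
    (trans (ℤ.⊖-≥ (ℕ.m≤n+m n m)) (cong +_ (ℕ.m+n∸n≡m m n)))
    (∈-applyUpTo⁺ (_⊖ n) (s≤s (ℕ.+-monoˡ-≤ n m≤n)))
  ∈-symmetricRange {n} -[1+ m ] m<n = subst (_∈ symmetricRange n)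
    (trans (ℤ.⊖-≤ (ℕ.m∸n≤m n (suc m))) (cong (λ z → ℤ.- + z) (ℕ.m∸[m∸n]≡n m<n)))
    (∈-applyUpTo⁺ (_⊖ n) (s≤s (ℕ.≤-trans (ℕ.m∸n≤m n (suc m)) (ℕ.m≤m+n n n))))

  open FiniteTripleProduct Series-commutativeRing using (Δ; Δ-*; finiteTripleProduct)

  Δ-applyUpTo : ∀ L (u : ℤ → Series) (φ : ℕ → ℤ) n →
                Δ L (λ i _ → u (φ i)) n ≡ ∑ (λ j → u j n) (applyUpTo φ (suc L))
  Δ-applyUpTo zero    u φ n = sym (ℤ.+-identityʳ _)
  Δ-applyUpTo (suc L) u φ n = cong (λ z → u (φ 0) n ℤ.+ z) (Δ-applyUpTo L u (φ ∘ suc) n)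

  Δ-cong-≤ : ∀ n L {F G : ℕ → ℕ → Series} →
             (∀ i k → i + k ≡ L → F i k ≈[ n ] G i k) → Δ L F ≈[ n ] Δ L G
  Δ-cong-≤ n zero    F≈G = F≈G 0 0 refl
  Δ-cong-≤ n (suc L) F≈G k k≤n = cong₂ ℤ._+_ (F≈G 0 (suc L) refl k k≤n)
    (Δ-cong-≤ n L (λ i j eq → F≈G (suc i) j (cong suc eq)) k k≤n)

  θ-support : ∀ s s′ .{{_ : NonZero s}} .{{_ : NonZero s′}} j n → θ s s′ j n ≢ 0ℤ → ℤ.∣ j ∣ ≤ n
  θ-support s s′ j n nz with ℤ.∣ j ∣ ℕ.≤? n
  ... | yes j≤n = j≤n
  ... | no  j≰n = contradiction
    (trans (cong (λ z → sgn j ℤ.* z) (q^-vanish (ℕ.<-≤-trans (ℕ.≰⇒> j≰n) (∣j∣≤expo s s′ j)))) (ℤ.*-zeroʳ (sgn j)))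
    nz

  module _ (s s′ : ℕ) .{{_ : NonZero s}} .{{_ : NonZero s′}} where

    private
      a : ℕ
      a = s + s′

      instance
        a≢0 : NonZero a
        a≢0 = ℕ.>-nonZero (ℕ.<-≤-trans (ℕ.>-nonZero⁻¹ s) (ℕ.m≤m+n s s′))

      Q p r : ℕ → Series
      Q n = q^ (a * n)
      p n = ∏[ n ] (λ k → q^ 0 ⊝⊝ Q (suc k))
      r n = q^ 0 ⊘ p n

      Q-0 : Q 0 ≗ q^ 0
      Q-0 n = cong (λ z → (q^ z) n) (ℕ.*-zeroʳ a)

      Q-+ : ∀ m n → Q (m + n) ≗ Q m ⊛ Q n
      Q-+ m n k = trans (cong (λ z → (q^ z) k) (ℕ.*-distribˡ-+ a m n)) (sym (q^-+ (a * m) (a * n) k))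

      n<a*[1+n] : ∀ n → n < a * suc n
      n<a*[1+n] n = ℕ.m≤n*m (suc n) a

      1-Q-0 : ∀ n → (q^ 0 ⊝⊝ Q (suc n)) 0 ≡ 1ℤ
      1-Q-0 n = 1-q^-≈1 (ℕ.≤-<-trans z≤n (n<a*[1+n] n)) 0 z≤n

      p-0 : ∀ n → p n 0 ≡ 1ℤ
      p-0 = ∏-0 1-Q-0

      p⊛r : ∀ n → p n ⊛ r n ≗ q^ 0
      p⊛r n = ⊘-correct (q^ 0) (p n) (p-0 n)

      r-suc : ∀ n → (q^ 0 ⊝⊝ Q (suc n)) ⊛ r (suc n) ≗ r n
      r-suc n = ⊛-cancelˡ (p n) (p-0 n) (λ k → begin
        (p n ⊛ ((q^ 0 ⊝⊝ Q (suc n)) ⊛ r (suc n))) k  ≡⟨ ⊛-assoc (p n) (q^ 0 ⊝⊝ Q (suc n)) (r (suc n)) k ⟨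
        (p (suc n) ⊛ r (suc n)) k                    ≡⟨ p⊛r (suc n) k ⟩
        (q^ 0) k                                     ≡⟨ p⊛r n k ⟨
        (p n ⊛ r n) k                                ∎)
        where open ≡-Reasoning

      q^•-cong : ∀ {c d m n} → c ≡ d → m ≡ n → c • q^ m ≗ d • q^ n
      q^•-cong refl refl k = refl

      i+k≡M+N⇒N : ∀ M N i k → i + k ≡ M + N → + N ≡ i ⊖ M ℤ.+ + k
      i+k≡M+N⇒N M N i k eq = begin
        + N                        ≡⟨ lem₁ (+ M) (+ N) ⟩
        (+ M ℤ.+ + N) ℤ.- + M      ≡⟨ cong (λ z → z ℤ.- + M) (cong +_ eq) ⟨
        (+ i ℤ.+ + k) ℤ.- + M      ≡⟨ lem₂ (+ i) (+ k) (+ M) ⟩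
        + i ℤ.- + M ℤ.+ + k        ≡⟨ cong (ℤ._+ + k) (ℤ.m-n≡m⊖n i M) ⟩
        i ⊖ M ℤ.+ + k              ∎
        where
        open ≡-Reasoning
        lem₁ : ∀ m n → n ≡ (m ℤ.+ n) ℤ.- m
        lem₁ = ℤ-Solver.solve-∀
        lem₂ : ∀ i k m → (i ℤ.+ k) ℤ.- m ≡ i ℤ.- m ℤ.+ k
        lem₂ = ℤ-Solver.solve-∀

      -- The exponent grows by s + (s + s′) v from v to v + 1. As v may be negative, it is written
      -- as a difference m - n of naturals and the negative part is moved to the other side.
      expo-suc : ∀ v m n → + m ≡ v ℤ.+ + n → s + a * m + expo s s′ v ≡ a * n + expo s s′ (1ℤ ℤ.+ v)
      expo-suc v m n eq = 2*-injective (begin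
        + (s + a * m + expo s s′ v) ℤ.+ + (s + a * m + expo s s′ v)
          ≡⟨ cong₂ ℤ._+_ lhs lhs ⟩
        _ ≡⟨ double (+ s) ((+ s ℤ.+ + s′) ℤ.* (v ℤ.+ + n)) (+ expo s s′ v) ⟩
        _ ≡⟨ cong (λ z → + s ℤ.+ + s ℤ.+ ((+ s ℤ.+ + s′) ℤ.* (v ℤ.+ + n) ℤ.+ (+ s ℤ.+ + s′) ℤ.* (v ℤ.+ + n)) ℤ.+ z) (2expo s s′ v) ⟩
        _ ≡⟨ poly (+ s) (+ s′) v (+ n) ⟩
        _ ≡⟨ cong (λ z → (+ s ℤ.+ + s′) ℤ.* + n ℤ.+ (+ s ℤ.+ + s′) ℤ.* + n ℤ.+ z) (2expo s s′ (1ℤ ℤ.+ v)) ⟨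
        _ ≡⟨ double′ ((+ s ℤ.+ + s′) ℤ.* + n) (+ expo s s′ (1ℤ ℤ.+ v)) ⟩
        _ ≡⟨ cong₂ ℤ._+_ rhs rhs ⟨
        + (a * n + expo s s′ (1ℤ ℤ.+ v)) ℤ.+ + (a * n + expo s s′ (1ℤ ℤ.+ v)) ∎)
        where
        open ≡-Reasoning
        lhs : + (s + a * m + expo s s′ v) ≡ + s ℤ.+ (+ s ℤ.+ + s′) ℤ.* (v ℤ.+ + n) ℤ.+ + expo s s′ v
        lhs = cong (λ z → + s ℤ.+ z ℤ.+ + expo s s′ v) (trans (ℤ.pos-* a m) (cong (λ z → + a ℤ.* z) eq))
        rhs : + (a * n + expo s s′ (1ℤ ℤ.+ v)) ≡ (+ s ℤ.+ + s′) ℤ.* + n ℤ.+ + expo s s′ (1ℤ ℤ.+ v)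
        rhs = cong (λ z → z ℤ.+ + expo s s′ (1ℤ ℤ.+ v)) (ℤ.pos-* a n)
        double : ∀ x y z → x ℤ.+ y ℤ.+ z ℤ.+ (x ℤ.+ y ℤ.+ z) ≡ x ℤ.+ x ℤ.+ (y ℤ.+ y) ℤ.+ (z ℤ.+ z)
        double = ℤ-Solver.solve-∀
        double′ : ∀ x y → x ℤ.+ x ℤ.+ (y ℤ.+ y) ≡ x ℤ.+ y ℤ.+ (x ℤ.+ y)
        double′ = ℤ-Solver.solve-∀
        poly : ∀ s s′ v n →
          s ℤ.+ s ℤ.+ ((s ℤ.+ s′) ℤ.* (v ℤ.+ n) ℤ.+ (s ℤ.+ s′) ℤ.* (v ℤ.+ n))
            ℤ.+ ((s ℤ.+ s′) ℤ.* (v ℤ.* v) ℤ.+ (s ℤ.- s′) ℤ.* v) ≡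
          (s ℤ.+ s′) ℤ.* n ℤ.+ (s ℤ.+ s′) ℤ.* n
            ℤ.+ ((s ℤ.+ s′) ℤ.* ((1ℤ ℤ.+ v) ℤ.* (1ℤ ℤ.+ v)) ℤ.+ (s ℤ.- s′) ℤ.* (1ℤ ℤ.+ v))
        poly = ℤ-Solver.solve-∀

      θ-x : ∀ M N i k → i + k ≡ M + N →
            ⊝ (q^ s ⊛ Q N ⊛ θ s s′ (i ⊖ M)) ≗ Q k ⊛ θ s s′ (suc i ⊖ M)
      θ-x M N i k eq n = begin
        ℤ.- (q^ s ⊛ Q N ⊛ θ s s′ (i ⊖ M)) n
          ≡⟨ cong (λ z → ℤ.- z) (⊛-cong {b = θ s s′ (i ⊖ M)} (q^-+ s (a * N)) (λ _ → refl) n) ⟩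
        ℤ.- (q^ (s + a * N) ⊛ θ s s′ (i ⊖ M)) n
          ≡⟨ cong (λ z → ℤ.- z) (q^-•q^ (sgn (i ⊖ M)) (s + a * N) (expo s s′ (i ⊖ M)) n) ⟩
        ℤ.- (sgn (i ⊖ M) • q^ (s + a * N + expo s s′ (i ⊖ M))) n
          ≡⟨ ℤ.neg-distribˡ-* (sgn (i ⊖ M)) _ ⟩
        ((ℤ.- sgn (i ⊖ M)) • q^ (s + a * N + expo s s′ (i ⊖ M))) n
          ≡⟨ q^•-cong signs exponents n ⟩
        (sgn (suc i ⊖ M) • q^ (a * k + expo s s′ (suc i ⊖ M))) n
          ≡⟨ q^-•q^ (sgn (suc i ⊖ M)) (a * k) (expo s s′ (suc i ⊖ M)) n ⟨
        (Q k ⊛ θ s s′ (suc i ⊖ M)) n ∎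
        where
        open ≡-Reasoning
        signs : ℤ.- sgn (i ⊖ M) ≡ sgn (suc i ⊖ M)
        signs = trans (cong (λ z → ℤ.- z) (sgn-⊖ i M)) (sym (sgn-⊖ (suc i) M))
        exponents : s + a * N + expo s s′ (i ⊖ M) ≡ a * k + expo s s′ (suc i ⊖ M)
        exponents = trans (expo-suc (i ⊖ M) N k (i+k≡M+N⇒N M N i k eq))
          (cong (λ z → a * k + expo s s′ z) (ℤ.distribʳ-⊖-+-pos 1 i M))

      θ-y : ∀ M i → ⊝ (q^ s′ ⊛ Q M ⊛ θ s s′ (i ⊖ M)) ≗ Q i ⊛ θ s s′ (i ⊖ suc M)
      θ-y M i n = begin
        ℤ.- (q^ s′ ⊛ Q M ⊛ θ s s′ (i ⊖ M)) n
          ≡⟨ cong (λ z → ℤ.- z) (⊛-cong {b = θ s s′ (i ⊖ M)} (q^-+ s′ (a * M)) (λ _ → refl) n) ⟩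
        ℤ.- (q^ (s′ + a * M) ⊛ θ s s′ (i ⊖ M)) n
          ≡⟨ cong (λ z → ℤ.- z) (q^-•q^ (sgn (i ⊖ M)) (s′ + a * M) (expo s s′ (i ⊖ M)) n) ⟩
        ℤ.- (sgn (i ⊖ M) • q^ (s′ + a * M + expo s s′ (i ⊖ M))) n
          ≡⟨ ℤ.neg-distribˡ-* (sgn (i ⊖ M)) _ ⟩
        ((ℤ.- sgn (i ⊖ M)) • q^ (s′ + a * M + expo s s′ (i ⊖ M))) n
          ≡⟨ q^•-cong signs exponents n ⟩
        (sgn (i ⊖ suc M) • q^ (a * i + expo s s′ (i ⊖ suc M))) n
          ≡⟨ q^-•q^ (sgn (i ⊖ suc M)) (a * i) (expo s s′ (i ⊖ suc M)) n ⟨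
        (Q i ⊛ θ s s′ (i ⊖ suc M)) n ∎
        where
        open ≡-Reasoning
        signs : ℤ.- sgn (i ⊖ M) ≡ sgn (i ⊖ suc M)
        signs = trans (cong (λ z → ℤ.- z) (sgn-⊖ i M)) (trans (cong alt (sym (ℕ.+-suc i M))) (sym (sgn-⊖ i (suc M))))
        1+[i⊖1+M] : 1ℤ ℤ.+ (i ⊖ suc M) ≡ i ⊖ M
        1+[i⊖1+M] = trans (ℤ.distribʳ-⊖-+-pos 1 i (suc M)) (ℤ.[1+m]⊖[1+n]≡m⊖n i M)
        exponents : s′ + a * M + expo s s′ (i ⊖ M) ≡ a * i + expo s s′ (i ⊖ suc M)
        -- Adding s completes s′ + a M to a (M + 1), and then the recurrence applies at v = i - M -
        -- 1.
        exponents = ℕ.+-cancelˡ-≡ s _ _ (begin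
          s + (s′ + a * M + expo s s′ (i ⊖ M))              ≡⟨ lem s s′ M (expo s s′ (i ⊖ M)) ⟩
          a * suc M + expo s s′ (i ⊖ M)                     ≡⟨ cong (λ z → a * suc M + expo s s′ z) 1+[i⊖1+M] ⟨
          a * suc M + expo s s′ (1ℤ ℤ.+ (i ⊖ suc M))        ≡⟨ expo-suc (i ⊖ suc M) i (suc M) (i+k≡M+N⇒N (suc M) i i (suc M) (ℕ.+-comm i (suc M))) ⟨
          s + a * i + expo s s′ (i ⊖ suc M)                 ≡⟨ ℕ.+-assoc s (a * i) _ ⟩
          s + (a * i + expo s s′ (i ⊖ suc M))               ∎)
          where
          lem : ∀ s s′ M e → s + (s′ + (s + s′) * M + e) ≡ (s + s′) * suc M + e
          lem = ℕ-Solver.solve-∀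

      θ-0 : θ s s′ (0 ⊖ 0) ≗ q^ 0
      θ-0 n = trans (ℤ.*-identityˡ _) (cong (λ z → (q^ z) n) (cong₂ _+_ (ℕ.*-zeroʳ s) (ℕ.*-zeroʳ a)))

      r-0 : r 0 ≗ q^ 0
      r-0 n = trans (sym (⊛-identityˡ (r 0) n)) (p⊛r 0 n)

      X Y : ℕ → Series
      X k = q^ 0 ⊕ ⊝ (q^ s ⊛ Q k)
      Y k = q^ 0 ⊕ ⊝ (q^ s′ ⊛ Q k)

      finite : ∀ N → ∏[ N ] X ⊛ ∏[ N ] Y ⊛ r (N + N) ≗ Δ (N + N) (λ i k → θ s s′ (i ⊖ N) ⊛ (r i ⊛ r k))
      finite N = finiteTripleProduct Q r Q-0 Q-+
        (λ n → ⊛-cancelˡ (q^ 0 ⊝⊝ Q (suc n)) (1-Q-0 n)) r-0 r-suc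
        (q^ s) (q^ s′) (θ s s′) θ-0 θ-x θ-y N N (N + N) refl

      factors : ∀ k → tripleFactor s s′ k ≗ X k ⊛ Y k ⊛ (q^ 0 ⊝⊝ Q (suc k))
      factors k = ⊛-cong {b = q^ 0 ⊝⊝ Q (suc k)} (⊛-cong (lem s) (lem s′)) (λ _ → refl)
        where
        lem : ∀ u → q^ 0 ⊝⊝ q^ (u + a * k) ≗ q^ 0 ⊕ ⊝ (q^ u ⊛ Q k)
        lem u n = cong (λ z → (q^ 0) n ℤ.- z) (sym (q^-+ u (a * k) n))

      n<u+a*n : ∀ u .{{_ : NonZero u}} n → n < u + a * n
      n<u+a*n u n = ℕ.+-mono-<-≤ (ℕ.>-nonZero⁻¹ u) (ℕ.m≤n*m n a)

    tripleFactor-admissible : Admissible (tripleFactor s s′)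
    tripleFactor-admissible k = ⊛-≈1 k (⊛-≈1 k
      (1-q^-≈1 (n<u+a*n s k)) (1-q^-≈1 (n<u+a*n s′ k))) (1-q^-≈1 (n<a*[1+n] k))

    private
      module _ (n : ℕ) where

        open import Relation.Binary.Reasoning.Setoid (T.setoid n)

        N : ℕ
        N = n + n

        r-stable : ∀ {m} → n ≤ m → r m ≈[ n ] r n
        r-stable {m} n≤m = subst (λ x → r x ≈[ n ] r n) (ℕ.m∸n+n≡m n≤m) (go (m ∸ n))
          where
          go : ∀ d → r (d + n) ≈[ n ] r n
          go zero    = T.refl n
          go (suc d) = begin
            r (suc d + n)                                    ≈⟨ ≗⇒≈ (⊛-identityˡ (r (suc d + n))) ⟨
            q^ 0 ⊛ r (suc d + n)                             ≈⟨ T.*-congʳ n {r (suc d + n)} (≈-weaken (ℕ.m≤n+m n d) (1-q^-≈1 (n<a*[1+n] (d + n)))) ⟨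
            (q^ 0 ⊝⊝ Q (suc (d + n))) ⊛ r (suc d + n)        ≈⟨ ≗⇒≈ (r-suc (d + n)) ⟩
            r (d + n)                                        ≈⟨ go d ⟩
            r n                                              ∎

        -- Put j = i - N, so k = N - j, with N = 2 n. If ∣j∣ ≤ n, both i and k are at least n, and r
        -- has reached its limit modulo q^(n+1) at both; if ∣j∣ > n, the theta term itself is 0
        -- modulo q^(n+1).
        term-stable : ∀ i k → i + k ≡ N + N →
                      θ s s′ (i ⊖ N) ⊛ (r i ⊛ r k) ≈[ n ] (r n ⊛ r n) ⊛ θ s s′ (i ⊖ N)
        term-stable i k eq with ℤ.∣ i ⊖ N ∣ ℕ.≤? n
        ... | no  ∣j∣>n = begin
          θ s s′ (i ⊖ N) ⊛ (r i ⊛ r k)  ≈⟨ T.*-congʳ n {r i ⊛ r k} θ≈0 ⟩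
          𝟎 ⊛ (r i ⊛ r k)               ≈⟨ T.zeroˡ n (r i ⊛ r k) ⟩
          𝟎                             ≈⟨ T.zeroʳ n (r n ⊛ r n) ⟨
          (r n ⊛ r n) ⊛ 𝟎               ≈⟨ T.*-congˡ n {r n ⊛ r n} θ≈0 ⟨
          (r n ⊛ r n) ⊛ θ s s′ (i ⊖ N)  ∎
          where
          θ≈0 : θ s s′ (i ⊖ N) ≈[ n ] 𝟎
          θ≈0 m m≤n = trans (cong (λ z → sgn (i ⊖ N) ℤ.* z)
            (q^-≈0 (ℕ.<-≤-trans (ℕ.≰⇒> ∣j∣>n) (∣j∣≤expo s s′ (i ⊖ N))) m m≤n)) (ℤ.*-zeroʳ (sgn (i ⊖ N)))
        ... | yes ∣j∣≤n = begin
          θ s s′ (i ⊖ N) ⊛ (r i ⊛ r k)  ≈⟨ T.*-congˡ n {θ s s′ (i ⊖ N)} (⊛-cong-≤ n (r-stable n≤i) (r-stable n≤k)) ⟩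
          θ s s′ (i ⊖ N) ⊛ (r n ⊛ r n)  ≈⟨ T.*-comm n (θ s s′ (i ⊖ N)) (r n ⊛ r n) ⟩
          (r n ⊛ r n) ⊛ θ s s′ (i ⊖ N)  ∎
          where
          N≤n+i : N ≤ n + i
          N≤n+i with ℕ.≤-total i N
          ... | inj₁ i≤N = ℕ.≤-trans (ℕ.m≤n+m∸n N i) (ℕ.≤-trans
                  (ℕ.+-monoʳ-≤ i (subst (_≤ n) (ℤ.∣⊖∣-≤ i≤N) ∣j∣≤n)) (ℕ.≤-reflexive (ℕ.+-comm i n)))
          ... | inj₂ N≤i = ℕ.≤-trans N≤i (ℕ.m≤n+m i n)
          i≤N+n : i ≤ N + n
          i≤N+n with ℕ.≤-total N i
          ... | inj₁ N≤i = ℕ.≤-trans (ℕ.m≤n+m∸n i N)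
                  (ℕ.+-monoʳ-≤ N (subst (_≤ n) (trans (ℤ.∣m⊖n∣≡∣n⊖m∣ i N) (ℤ.∣⊖∣-≤ N≤i)) ∣j∣≤n))
          ... | inj₂ i≤N = ℕ.≤-trans i≤N (ℕ.m≤m+n N n)
          n≤i : n ≤ i
          n≤i = ℕ.+-cancelˡ-≤ n n i N≤n+i
          n≤k : n ≤ k
          n≤k = ℕ.+-cancelˡ-≤ (N + n) n k (ℕ.≤-trans (ℕ.≤-reflexive (trans (ℕ.+-assoc N n n) (sym eq)))
            (ℕ.+-monoˡ-≤ k i≤N+n))

        cleared : ∏[ N ] X ⊛ ∏[ N ] Y ⊛ r (N + N) ≈[ n ] (r n ⊛ r n) ⊛ Δ (N + N) (λ i _ → θ s s′ (i ⊖ N))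
        cleared = begin
          ∏[ N ] X ⊛ ∏[ N ] Y ⊛ r (N + N)                            ≈⟨ ≗⇒≈ (finite N) ⟩
          Δ (N + N) (λ i k → θ s s′ (i ⊖ N) ⊛ (r i ⊛ r k))           ≈⟨ Δ-cong-≤ n (N + N) term-stable ⟩
          Δ (N + N) (λ i _ → (r n ⊛ r n) ⊛ θ s s′ (i ⊖ N))           ≈⟨ ≗⇒≈ (Δ-* (N + N) (r n ⊛ r n) (λ i _ → θ s s′ (i ⊖ N))) ⟨
          (r n ⊛ r n) ⊛ Δ (N + N) (λ i _ → θ s s′ (i ⊖ N))           ∎

        X-admissible : Admissible X
        X-admissible k = T.trans k (≗⇒≈ λ m → cong (λ z → (q^ 0) m ℤ.- z) (q^-+ s (a * k) m)) (1-q^-≈1 (n<u+a*n s k))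

        Y-admissible : Admissible Y
        Y-admissible k = T.trans k (≗⇒≈ λ m → cong (λ z → (q^ 0) m ℤ.- z) (q^-+ s′ (a * k) m)) (1-q^-≈1 (n<u+a*n s′ k))

        n≤N : n ≤ N
        n≤N = ℕ.m≤m+n n n

        Θ : Series
        Θ = Δ (N + N) (λ i _ → θ s s′ (i ⊖ N))

        -- In the limit the finite identity reads X Y r = r² Θ for the products X and Y in x and y.
        -- Multiplying by p², where p r = 1, leaves the triple product X Y p on the left and Θ on
        -- the right.
        product≈Θ : ∏[ n ] (tripleFactor s s′) ≈[ n ] Θ
        product≈Θ = begin
          ∏[ n ] (tripleFactor s s′)
            ≈⟨ ≗⇒≈ (∏-cong factors n) ⟩
          ∏[ n ] (λ k → X k ⊛ Y k ⊛ (q^ 0 ⊝⊝ Q (suc k)))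
            ≈⟨ ≗⇒≈ (S.trans (∏-⊛ (λ k → X k ⊛ Y k) (λ k → q^ 0 ⊝⊝ Q (suc k)) n) (S.*-congʳ {p n} (∏-⊛ X Y n))) ⟩
          ∏[ n ] X ⊛ ∏[ n ] Y ⊛ p n
            ≈⟨ ≗⇒≈ (insert-inverse (∏[ n ] X ⊛ ∏[ n ] Y) (p n) (r n) (p⊛r n)) ⟩
          (p n ⊛ p n) ⊛ (∏[ n ] X ⊛ ∏[ n ] Y ⊛ r n)
            ≈⟨ T.*-congˡ n {p n ⊛ p n} (⊛-cong-≤ n (⊛-cong-≤ n (∏-stable X-admissible n≤N) (∏-stable Y-admissible n≤N))
                 (r-stable (ℕ.≤-trans n≤N (ℕ.m≤m+n N N)))) ⟨
          (p n ⊛ p n) ⊛ (∏[ N ] X ⊛ ∏[ N ] Y ⊛ r (N + N))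
            ≈⟨ T.*-congˡ n {p n ⊛ p n} cleared ⟩
          (p n ⊛ p n) ⊛ ((r n ⊛ r n) ⊛ Θ)
            ≈⟨ ≗⇒≈ (cancel-inverse Θ (p n) (r n) (p⊛r n)) ⟩
          Θ ∎

    jacobiTripleProduct : ∀ n → (λ j → θ s s′ j n) ⇒ ∏∞ (tripleFactor s s′) n
    jacobiTripleProduct n = record
      -- The finite identity was taken with M = N = 2 n, so its summation index i - N runs from -2 n
      -- to 2 n.
      { support = symmetricRange (n + n)
      ; unique  = symmetricRange-unique (n + n)
      ; covers  = λ j nz → ∈-symmetricRange j (ℕ.≤-trans (θ-support s s′ j n nz) (ℕ.m≤m+n n n))
      ; total   = trans (sym (Δ-applyUpTo (n + n + (n + n)) (θ s s′) (_⊖ (n + n)) n))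
                        (sym (product≈Θ n n ℕ.≤-refl))
      }

-- Products of theta series as sums over ℤ², and residue classes modulo 5.

module Sections where

  open import Defs renaming (_⊖_ to _⊝⊝_)
  open FormalSeries
  open FiniteSums
  open InfiniteProducts
  open TripleProduct
  open import Data.Integer as ℤ using (ℤ; 0ℤ; 1ℤ; +_)
  import Data.Integer.DivMod as ℤ
  import Data.Integer.Properties as ℤ
  import Data.Integer.Tactic.RingSolver as ℤ-Solver
  open import Data.List using (List; []; _∷_; map; cartesianProduct)
  open import Data.List.Membership.Propositional.Properties using (∈-cartesianProduct⁺)
  import Data.List.Relation.Unary.Unique.Propositional.Properties as Unique
  open import Data.Nat as ℕ using (ℕ; zero; suc; _+_; _*_; _≤_; _<_; z≤n; s≤s; NonZero)
  import Data.Nat.Properties as ℕ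
  open import Data.Nat.Divisibility as ℕ using (divides)
  open import Data.Product using (_×_; _,_; proj₁; proj₂; ∃; ∃₂)
  open import Data.Product.Properties using (,-injective)
  open import Data.Sum using (_⊎_; inj₁; inj₂)
  open import Function using (_∘_)
  open import Relation.Binary.PropositionalEquality
  open import Relation.Nullary using (yes; no; contradiction)
  open import Relation.Nullary.Decidable using (from-no)

  ∑-× : ∀ {I J : Set} (g : I × J → ℤ) is js →
        ∑ g (cartesianProduct is js) ≡ ∑ (λ i → ∑ (λ j → g (i , j)) js) is
  ∑-× g []       js = refl
  ∑-× g (i ∷ is) js = trans (∑-++ g (map (i ,_) js) (cartesianProduct is js))
    (cong₂ ℤ._+_ (∑-map js) (∑-× g is js))
    where
    ∑-map : ∀ js → ∑ g (map (i ,_) js) ≡ ∑ (λ j → g (i , j)) js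
    ∑-map []       = refl
    ∑-map (j ∷ js) = cong (λ z → g (i , j) ℤ.+ z) (∑-map js)

  ∑-⊛ : ∀ {I : Set} (u : I → Series) b is n →
        ∑ (λ i → (u i ⊛ b) n) is ≡ ((λ k → ∑ (λ i → u i k) is) ⊛ b) n
  ∑-⊛ u b []       n = sym (⊛-zeroˡ b n)
  ∑-⊛ u b (i ∷ is) n = trans (cong (λ z → (u i ⊛ b) n ℤ.+ z) (∑-⊛ u b is n))
    (sym (⊛-distribʳ b (u i) (λ k → ∑ (λ i → u i k) is) n))

  ⊛-∑ : ∀ {I : Set} a (u : I → Series) is n →
        ∑ (λ i → (a ⊛ u i) n) is ≡ (a ⊛ (λ k → ∑ (λ i → u i k) is)) n
  ⊛-∑ a u is n = trans (∑-cong (λ i → ⊛-comm a (u i) n) is)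
    (trans (∑-⊛ u a is n) (⊛-comm (λ k → ∑ (λ i → u i k) is) a n))

  Bounded : (ℤ → Series) → Set
  Bounded u = ∀ j n → n < ℤ.∣ j ∣ → u j ≈[ n ] 𝟎

  -- Boundedness allows both sums to be cut to indices from -n to n without changing coefficients up
  -- to qⁿ; for finite sums the product distributes.
  ⇒-⊛ : ∀ {u v : ℤ → Series} {a b} → Bounded u → Bounded v →
        (∀ n → (λ j → u j n) ⇒ a n) → (∀ n → (λ j → v j n) ⇒ b n) →
        ∀ n → (λ (i , j) → (u i ⊛ v j) n) ⇒ (a ⊛ b) n
  ⇒-⊛ {u} {v} {a} {b} bu bv u⇒a v⇒b n = record
    { support = cartesianProduct (symmetricRange n) (symmetricRange n)
    ; unique  = Unique.cartesianProduct⁺ (symmetricRange-unique n) (symmetricRange-unique n)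
    ; covers  = λ (i , j) nz → ∈-cartesianProduct⁺ (∈-symmetricRange i (left i j nz)) (∈-symmetricRange j (right i j nz))
    ; total   = begin
        ∑ (λ (i , j) → (u i ⊛ v j) n) (cartesianProduct range range)
          ≡⟨ ∑-× (λ (i , j) → (u i ⊛ v j) n) range range ⟩
        ∑ (λ i → ∑ (λ j → (u i ⊛ v j) n) range) range
          ≡⟨ ∑-cong (λ i → ⊛-∑ (u i) v range n) range ⟩
        ∑ (λ i → (u i ⊛ (λ k → ∑ (λ j → v j k) range)) n) range
          ≡⟨ ∑-⊛ u (λ k → ∑ (λ j → v j k) range) range n ⟩
        ((λ k → ∑ (λ i → u i k) range) ⊛ (λ k → ∑ (λ j → v j k) range)) n
          ≡⟨ ⊛-cong-≤ n (partial bu u⇒a) (partial bv v⇒b) n ℕ.≤-refl ⟩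
        (a ⊛ b) n ∎ }
    where
    open ≡-Reasoning
    range : List ℤ
    range = symmetricRange n
    left : ∀ i j → (u i ⊛ v j) n ≢ 0ℤ → ℤ.∣ i ∣ ≤ n
    left i j nz with ℤ.∣ i ∣ ℕ.≤? n
    ... | yes i≤n = i≤n
    ... | no  i≰n = contradiction
      (T.trans n (⊛-cong-≤ {b = v j} n (bu i n (ℕ.≰⇒> i≰n)) (λ _ _ → refl)) (T.zeroˡ n (v j)) n ℕ.≤-refl) nz
    right : ∀ i j → (u i ⊛ v j) n ≢ 0ℤ → ℤ.∣ j ∣ ≤ n
    right i j nz with ℤ.∣ j ∣ ℕ.≤? n
    ... | yes j≤n = j≤n
    ... | no  j≰n = contradiction
      (T.trans n (⊛-cong-≤ {a = u i} n (λ _ _ → refl) (bv j n (ℕ.≰⇒> j≰n))) (T.zeroʳ n (u i)) n ℕ.≤-refl) nz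
    partial : ∀ {w : ℤ → Series} {c} → Bounded w → (∀ n → (λ j → w j n) ⇒ c n) →
              (λ k → ∑ (λ j → w j k) range) ≈[ n ] c
    partial {w} bw w⇒c k k≤n = ⇒-functional (record
      { support = range
      ; unique  = symmetricRange-unique n
      ; covers  = λ j nz → ∈-symmetricRange j (covers j nz)
      ; total   = refl }) (w⇒c k)
      where
      covers : ∀ j → w j k ≢ 0ℤ → ℤ.∣ j ∣ ≤ n
      covers j nz with ℤ.∣ j ∣ ℕ.≤? n
      ... | yes j≤n = j≤n
      ... | no  j≰n = contradiction (bw j n (ℕ.≰⇒> j≰n) k k≤n) nz

  θ-bounded : ∀ s s′ .{{_ : NonZero s}} .{{_ : NonZero s′}} → Bounded (θ s s′)
  θ-bounded s s′ j n n<∣j∣ k k≤n = trans (cong (λ z → sgn j ℤ.* z)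
    (q^-≈0 (ℕ.<-≤-trans n<∣j∣ (∣j∣≤expo s s′ j)) k k≤n)) (ℤ.*-zeroʳ (sgn j))

  •q^-⊛-•q^ : ∀ c m d n → (c • q^ m) ⊛ (d • q^ n) ≗ (c ℤ.* d) • q^ (m + n)
  •q^-⊛-•q^ c m d n k = trans (•-⊛ c (q^ m) (d • q^ n) k)
    (trans (cong (λ z → c ℤ.* z) (q^-•q^ d m n k)) (sym (ℤ.*-assoc c d _)))

  •q^-support : ∀ c m n → (c • q^ m) n ≢ 0ℤ → m ≡ n
  •q^-support c m n nz with n ℕ.≟ m
  ... | yes n≡m = sym n≡m
  ... | no  n≢m = contradiction (trans (cong (λ z → c ℤ.* z) (q^-off m n n≢m)) (ℤ.*-zeroʳ c)) nz

  section : ℕ → Series → Series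
  section r u n = u (n * 5 + r)

  q^-section : ∀ m r → section r (q^ (m * 5 + r)) ≗ q^ m
  q^-section m r n with n ℕ.≟ m
  ... | yes refl = trans (q^-self (m * 5 + r)) (sym (q^-self m))
  ... | no  n≢m  = trans (q^-off (m * 5 + r) (n * 5 + r) (n≢m ∘ ℕ.*-cancelʳ-≡ n m 5 ∘ ℕ.+-cancelʳ-≡ r (n * 5) (m * 5)))
                         (sym (q^-off m n n≢m))

  Sparse : Series → Set
  Sparse v = ∀ n r → 0 < r → r < 5 → v (n * 5 + r) ≡ 0ℤ

  -- A series in q⁵ multiplies each residue class separately. In the convolution, v is consumed five
  -- coefficients at a time, and the four between multiples of 5 are zero.
  ⊛-section : ∀ v u → Sparse v → ∀ {r} → r < 5 → section r (v ⊛ u) ≗ section 0 v ⊛ section r u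
  ⊛-section v u sp {r} r<5 zero = first r r<5
    where
    first : ∀ r → r < 5 → (v ⊛ u) r ≡ v 0 ℤ.* u r ℤ.+ 0ℤ
    first zero    _     = refl
    first (suc r) 1+r<5 = cong (λ z → v 0 ℤ.* u (suc r) ℤ.+ z)
      (trans (⊛-cong-≤ {b = u} r (λ k k≤r → sp 0 (suc k) (s≤s z≤n) (ℕ.≤-<-trans (s≤s k≤r) 1+r<5)) (λ _ _ → refl) r ℕ.≤-refl)
             (⊛-zeroˡ u r))
  ⊛-section v u sp {r} r<5 (suc n) = cong (λ z → v 0 ℤ.* u (5 + (n * 5 + r)) ℤ.+ z)
    (skip (sp 0 1 (s≤s z≤n) (s≤s (s≤s z≤n)))
    (skip (sp 0 2 (s≤s z≤n) (s≤s (s≤s (s≤s z≤n))))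
    (skip (sp 0 3 (s≤s z≤n) (s≤s (s≤s (s≤s (s≤s z≤n)))))
    (skip (sp 0 4 (s≤s z≤n) (s≤s (s≤s (s≤s (s≤s (s≤s z≤n))))))
    (⊛-section (λ k → v (5 + k)) u (λ m → sp (suc m)) r<5 n)))))
    where
    skip : ∀ {x y z w} → x ≡ 0ℤ → y ≡ z → x ℤ.* w ℤ.+ y ≡ z
    skip refl y≡z = trans (ℤ.+-identityˡ _) y≡z

  multiple⇒∣ : ∀ d z {c} → z ℤ.* + d ≡ c → d ℕ.∣ ℤ.∣ c ∣
  multiple⇒∣ d z refl = divides ℤ.∣ z ∣ (ℤ.abs-* z (+ d))

  -- Odd numbers are written 2 b - 1 to match the second branch of `shear`.
  halve : ∀ z → ∃ λ b → z ≡ b ℤ.* + 2 ⊎ z ≡ b ℤ.* + 2 ℤ.- 1ℤ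
  halve z with z ℤ.%ℕ 2 | ℤ.n%ℕd<d z 2 | ℤ.a≡a%ℕn+[a/ℕn]*n z 2
  ... | 0 | _ | eq = z ℤ./ℕ 2 , inj₁ (trans eq (ℤ.+-identityˡ _))
  ... | 1 | _ | eq = z ℤ./ℕ 2 ℤ.+ 1ℤ , inj₂ (trans eq (lem (z ℤ./ℕ 2)))
    where
    lem : ∀ q → 1ℤ ℤ.+ q ℤ.* + 2 ≡ (q ℤ.+ 1ℤ) ℤ.* + 2 ℤ.- 1ℤ
    lem = ℤ-Solver.solve-∀
  ... | suc (suc _) | s≤s (s≤s ()) | _

  odd≢even : ∀ b c → b ℤ.* + 2 ℤ.- 1ℤ ≢ c ℤ.* + 2
  odd≢even b c eq = from-no (2 ℕ.∣? 1) (multiple⇒∣ 2 (b ℤ.- c)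
    (trans (lem₁ b c) (trans (cong (λ z → b ℤ.* + 2 ℤ.- z) (sym eq)) (lem₂ b))))
    where
    lem₁ : ∀ b c → (b ℤ.- c) ℤ.* + 2 ≡ b ℤ.* + 2 ℤ.- c ℤ.* + 2
    lem₁ = ℤ-Solver.solve-∀
    lem₂ : ∀ b → b ℤ.* + 2 ℤ.- (b ℤ.* + 2 ℤ.- 1ℤ) ≡ 1ℤ
    lem₂ = ℤ-Solver.solve-∀

  -- Pairs with even, respectively odd, coordinate sum.
  shear : (ℤ × ℤ) ⊎ (ℤ × ℤ) → ℤ × ℤ
  shear (inj₁ (a , b)) = a , b ℤ.* + 2 ℤ.- a
  shear (inj₂ (a , b)) = a , b ℤ.* + 2 ℤ.- 1ℤ ℤ.- a

  shear-injective : ∀ {x y} → shear x ≡ shear y → x ≡ y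
  shear-injective {inj₁ (a , b)} {inj₁ (a′ , b′)} eq with refl , p ← ,-injective eq =
    cong (λ z → inj₁ (a , z)) (ℤ.*-cancelʳ-≡ b b′ (+ 2) (+-cancelʳ (ℤ.- a) _ _ p))
  shear-injective {inj₂ (a , b)} {inj₂ (a′ , b′)} eq with refl , p ← ,-injective eq =
    cong (λ z → inj₂ (a , z)) (ℤ.*-cancelʳ-≡ b b′ (+ 2) (+-cancelʳ (ℤ.- 1ℤ) _ _ (+-cancelʳ (ℤ.- a) _ _ p)))
  shear-injective {inj₁ (a , b)} {inj₂ (a′ , b′)} eq with refl , p ← ,-injective eq =
    contradiction (sym (+-cancelʳ (ℤ.- a) _ _ p)) (odd≢even b′ b)
  shear-injective {inj₂ (a , b)} {inj₁ (a′ , b′)} eq with refl , p ← ,-injective eq =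
    contradiction (+-cancelʳ (ℤ.- a) _ _ p) (odd≢even b b′)

  shear-surjective : ∀ x → ∃ λ y → shear y ≡ x
  shear-surjective (a , b) with halve (b ℤ.+ a)
  ... | c , inj₁ eq = inj₁ (a , c) , cong (a ,_) (trans (cong (λ z → z ℤ.- a) (sym eq)) (lem a b))
    where
    lem : ∀ a b → b ℤ.+ a ℤ.- a ≡ b
    lem = ℤ-Solver.solve-∀
  ... | c , inj₂ eq = inj₂ (a , c) , cong (a ,_) (trans (cong (λ z → z ℤ.- a) (sym eq)) (lem a b))
    where
    lem : ∀ a b → b ℤ.+ a ℤ.- a ≡ b
    lem = ℤ-Solver.solve-∀

  ⇒-shear : ∀ {g : ℤ × ℤ → ℤ} {s} → g ⇒ s → ∃₂ λ s₁ s₂ →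
            (λ (a , b) → g (a , b ℤ.* + 2 ℤ.- a)) ⇒ s₁ ×
            (λ (a , b) → g (a , b ℤ.* + 2 ℤ.- 1ℤ ℤ.- a)) ⇒ s₂ × s ≡ s₁ ℤ.+ s₂
  ⇒-shear p = ⇒-split (⇒-pullback shear shear-injective (λ x _ → shear-surjective x) p)

  ⇒-bijection : ∀ {I J : Set} {g : I → ℤ} {s} (φ : J → I) (ψ : I → J) →
                (∀ j → ψ (φ j) ≡ j) → (∀ i → φ (ψ i) ≡ i) → g ⇒ s → (λ j → g (φ j)) ⇒ s
  ⇒-bijection φ ψ ψφ φψ = ⇒-pullback φ
    (λ {x} {y} eq → trans (sym (ψφ x)) (trans (cong ψ eq) (ψφ y))) (λ i _ → ψ i , φψ i)

  reflect : ℤ × ℤ → ℤ × ℤ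
  reflect (a , b) = a , ℤ.- b

  reflect-involutive : ∀ x → reflect (reflect x) ≡ x
  reflect-involutive (a , b) = cong (a ,_) (ℤ.neg-involutive b)

  -- In terms of ω = (-1 + √-3) / 2: the quadratic forms underlying F₁, F₂ and G
  -- are norms in ℤ[ω], the first two hypotheses are multiplication by a power of
  -- ω, and the points missed by it cancel in pairs by the third.
  rearrange : ∀ {F₁ F₂ G : ℤ × ℤ → ℤ} {s₁ s₂ t} → F₁ ⇒ s₁ → F₂ ⇒ s₂ → G ⇒ t →
    (∀ a b → F₁ (a , a ℤ.- b ℤ.* + 2) ≡ G (b , a ℤ.* + 2 ℤ.- b)) →
    (∀ a b → F₂ (a , b ℤ.* + 2 ℤ.- 1ℤ ℤ.- a) ≡ G (b , b ℤ.- a ℤ.* + 2 ℤ.- 1ℤ)) →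
    (∀ a b → F₁ (a , a ℤ.- b ℤ.* + 2 ℤ.- 1ℤ) ≡ ℤ.- F₂ (b ℤ.- a , a ℤ.+ b)) →
    s₁ ℤ.+ s₂ ≡ t
  rearrange {F₁} {F₂} {G} {s₁} {s₂} {t} F₁⇒s₁ F₂⇒s₂ G⇒t good₁ good₂ bad
    -- All three sums are split by the parity of the coordinate sum. The even half x₁ of F₁ becomes
    -- the even half of G, the odd half x₂ of F₂ becomes the odd half of G, and y₁ cancels y₂.
    -- Negating the second coordinate of F₁ preserves parity and gives its even half the arguments
    -- (a , a - 2 b) of the first hypothesis.
    with x₁ , y₁ , p₁ , r₁ , refl ← ⇒-shear (⇒-bijection reflect reflect reflect-involutive reflect-involutive F₁⇒s₁)
       | y₂ , x₂ , r₂ , p₂ , refl ← ⇒-shear F₂⇒s₂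
       | z₁ , z₂ , g₁ , g₂ , refl ← ⇒-shear G⇒t = begin
    x₁ ℤ.+ y₁ ℤ.+ (y₂ ℤ.+ x₂)    ≡⟨ cong₂ (λ x y → x ℤ.+ y₁ ℤ.+ (y₂ ℤ.+ y)) x₁≡z₁ x₂≡z₂ ⟩
    z₁ ℤ.+ y₁ ℤ.+ (y₂ ℤ.+ z₂)    ≡⟨ cong (λ y → z₁ ℤ.+ y ℤ.+ (y₂ ℤ.+ z₂)) y₁≡-y₂ ⟩
    z₁ ℤ.- y₂ ℤ.+ (y₂ ℤ.+ z₂)    ≡⟨ lem z₁ y₂ z₂ ⟩
    z₁ ℤ.+ z₂                    ∎
    where
    open ≡-Reasoning
    lem : ∀ x y z → x ℤ.- y ℤ.+ (y ℤ.+ z) ≡ x ℤ.+ z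
    lem = ℤ-Solver.solve-∀
    swap back : ℤ × ℤ → ℤ × ℤ
    swap (a , b) = b , a
    back (a , b) = b , b ℤ.- a
    x₁≡z₁ : x₁ ≡ z₁
    x₁≡z₁ = ⇒-functional p₁ (⇒-cong eq (⇒-bijection swap swap (λ _ → refl) (λ _ → refl) g₁))
      where
      arg : ∀ a b → a ℤ.- b ℤ.* + 2 ≡ ℤ.- (b ℤ.* + 2 ℤ.- a)
      arg = ℤ-Solver.solve-∀
      eq : ∀ x → G (proj₂ x , proj₁ x ℤ.* + 2 ℤ.- proj₂ x) ≡ F₁ (proj₁ x , ℤ.- (proj₂ x ℤ.* + 2 ℤ.- proj₁ x))
      eq (a , b) = trans (sym (good₁ a b)) (cong (λ z → F₁ (a , z)) (arg a b))
    x₂≡z₂ : x₂ ≡ z₂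
    x₂≡z₂ = ⇒-functional p₂ (⇒-cong eq (⇒-bijection back forth back-forth forth-back g₂))
      where
      forth : ℤ × ℤ → ℤ × ℤ
      forth (b , c) = b ℤ.- c , b
      sub-sub : ∀ b c → b ℤ.- (b ℤ.- c) ≡ c
      sub-sub = ℤ-Solver.solve-∀
      back-forth : ∀ x → forth (back x) ≡ x
      back-forth (a , b) = cong (_, b) (sub-sub b a)
      forth-back : ∀ x → back (forth x) ≡ x
      forth-back (b , c) = cong (b ,_) (sub-sub b c)
      arg : ∀ a b → (b ℤ.- a) ℤ.* + 2 ℤ.- 1ℤ ℤ.- b ≡ b ℤ.- a ℤ.* + 2 ℤ.- 1ℤ
      arg = ℤ-Solver.solve-∀
      eq : ∀ x → G (proj₂ x , (proj₂ x ℤ.- proj₁ x) ℤ.* + 2 ℤ.- 1ℤ ℤ.- proj₂ x) ≡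
                 F₂ (proj₁ x , proj₂ x ℤ.* + 2 ℤ.- 1ℤ ℤ.- proj₁ x)
      eq (a , b) = trans (cong (λ z → G (b , z)) (arg a b)) (sym (good₂ a b))
    y₁≡-y₂ : y₁ ≡ ℤ.- y₂
    y₁≡-y₂ = ⇒-functional r₁ (⇒-cong eq (⇒-bijection to from to-from from-to (⇒-neg r₂)))
      where
      to from : ℤ × ℤ → ℤ × ℤ
      -- The shift of b by 1 compensates for the reflection, under which the odd half of F₁ is
      -- indexed by a - 2 b + 1 rather than a - 2 b - 1.
      to   (a , b) = b ℤ.- 1ℤ ℤ.- a , b ℤ.- 1ℤ
      from (a , b) = b ℤ.- a , b ℤ.+ 1ℤ
      lem₁ : ∀ a b → b ℤ.- 1ℤ ℤ.- (b ℤ.- 1ℤ ℤ.- a) ≡ a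
      lem₁ = ℤ-Solver.solve-∀
      lem₂ : ∀ b → b ℤ.- 1ℤ ℤ.+ 1ℤ ≡ b
      lem₂ = ℤ-Solver.solve-∀
      lem₃ : ∀ a b → b ℤ.+ 1ℤ ℤ.- 1ℤ ℤ.- (b ℤ.- a) ≡ a
      lem₃ = ℤ-Solver.solve-∀
      lem₄ : ∀ b → b ℤ.+ 1ℤ ℤ.- 1ℤ ≡ b
      lem₄ = ℤ-Solver.solve-∀
      to-from : ∀ x → from (to x) ≡ x
      to-from (a , b) = cong₂ _,_ (lem₁ a b) (lem₂ b)
      from-to : ∀ x → to (from x) ≡ x
      from-to (a , b) = cong₂ _,_ (lem₃ a b) (lem₄ b)
      arg₁ : ∀ a b → a ℤ.- (b ℤ.- 1ℤ) ℤ.* + 2 ℤ.- 1ℤ ≡ ℤ.- (b ℤ.* + 2 ℤ.- 1ℤ ℤ.- a)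
      arg₁ = ℤ-Solver.solve-∀
      arg₂ : ∀ a b → (b ℤ.- 1ℤ) ℤ.* + 2 ℤ.- (b ℤ.- 1ℤ ℤ.- a) ≡ a ℤ.+ (b ℤ.- 1ℤ)
      arg₂ = ℤ-Solver.solve-∀
      eq : ∀ x → ℤ.- F₂ (proj₁ (to x) , proj₂ (to x) ℤ.* + 2 ℤ.- proj₁ (to x)) ≡
                 F₁ (proj₁ x , ℤ.- (proj₂ x ℤ.* + 2 ℤ.- 1ℤ ℤ.- proj₁ x))
      eq (a , b) = trans (cong (λ z → ℤ.- F₂ (b ℤ.- 1ℤ ℤ.- a , z)) (arg₂ a b))
        (trans (sym (bad a (b ℤ.- 1ℤ))) (cong (λ z → F₁ (a , z)) (arg₁ a b)))

-- Residue classes of the pentagonal number series: the common scheme.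

module Dissection where

  open import Defs hiding (_⊖_)
  open FormalSeries
  open FiniteSums
  open InfiniteProducts
  open TripleProduct
  open Sections
  open import Data.Empty using (⊥-elim)
  open import Data.Integer as ℤ using (ℤ; 0ℤ; 1ℤ; -1ℤ; +_; -[1+_])
  import Data.Integer.DivMod as ℤ
  import Data.Integer.Properties as ℤ
  import Data.Integer.Tactic.RingSolver as ℤ-Solver
  open import Data.List using (List; []; _∷_)
  open import Data.List.Membership.Propositional using (_∈_)
  open import Data.List.Relation.Unary.Any using (here; there)
  open import Data.Nat as ℕ using (ℕ; zero; suc; _+_; _*_; _<_; s≤s; NonZero)
  import Data.Nat.Properties as ℕ
  import Data.Nat.Tactic.RingSolver as ℕ-Solver
  open import Data.Nat.Divisibility as ℕ using (divides)
  open import Data.Product using (_×_; _,_; proj₁; proj₂; ∃; ∃₂)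
  open import Data.Product.Properties using (,-injective)
  open import Data.Sum as Sum using (_⊎_; inj₁; inj₂)
  open import Relation.Binary.PropositionalEquality
  open import Relation.Nullary using (¬_)

  expo-5* : ∀ s s′ j → expo (5 * s) (5 * s′) j ≡ expo s s′ j * 5
  expo-5* s s′ (+ n) = lem s s′ n (tri n)
    where
    lem : ∀ s s′ n t → 5 * s * n + (5 * s + 5 * s′) * t ≡ (s * n + (s + s′) * t) * 5
    lem = ℕ-Solver.solve-∀
  expo-5* s s′ -[1+ n ] = lem s s′ (suc n) (tri (suc n))
    where
    lem : ∀ s s′ n t → 5 * s′ * n + (5 * s + 5 * s′) * t ≡ (s′ * n + (s + s′) * t) * 5
    lem = ℕ-Solver.solve-∀

  θ-5*-sparse : ∀ s s′ j → Sparse (θ (5 * s) (5 * s′) j)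
  θ-5*-sparse s s′ j n r@(suc _) _ r<5 = trans
    (cong (λ z → sgn j ℤ.* z) (q^-off (expo (5 * s) (5 * s′) j) (n * 5 + r) off)) (ℤ.*-zeroʳ (sgn j))
    where
    off : n * 5 + r ≢ expo (5 * s) (5 * s′) j
    off eq = ℕ.<⇒≱ r<5 (ℕ.∣⇒≤ (ℕ.∣m+n∣m⇒∣n
      (divides (expo s s′ j) (trans eq (expo-5* s s′ j))) (divides n refl)))

  θ-5*-section : ∀ s s′ j → section 0 (θ (5 * s) (5 * s′) j) ≗ θ s s′ j
  θ-5*-section s s′ j n = cong (λ z → sgn j ℤ.* z) (trans
    (cong (λ z → (q^ z) (n * 5 + 0)) (trans (expo-5* s s′ j) (sym (ℕ.+-identityʳ _))))
    (q^-section (expo s s′ j) 0 n))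

  module _ (s s′ : ℕ) .{{_ : NonZero s}} .{{_ : NonZero s′}} where
    instance
      private
        5s≢0 : NonZero (5 * s)
        5s≢0 = ℕ.m*n≢0 5 s
        5s′≢0 : NonZero (5 * s′)
        5s′≢0 = ℕ.m*n≢0 5 s′

    -- Read off from the theta series, whose exponents are all multiples of 5, and not from the
    -- product; the same holds for `tripleProduct-section`, which undoes the substitution of q⁵ for
    -- q.
    tripleProduct-sparse : Sparse (∏∞ (tripleFactor (5 * s) (5 * s′)))
    tripleProduct-sparse n r 0<r r<5 = ⇒-functional (jacobiTripleProduct (5 * s) (5 * s′) (n * 5 + r))
      (⇒-zero (λ j → θ-5*-sparse s s′ j n r 0<r r<5))

    tripleProduct-section : section 0 (∏∞ (tripleFactor (5 * s) (5 * s′))) ≗ ∏∞ (tripleFactor s s′)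
    tripleProduct-section n = ⇒-functional
      (⇒-cong (λ j → θ-5*-section s s′ j n) (jacobiTripleProduct (5 * s) (5 * s′) (n * 5 + 0)))
      (jacobiTripleProduct s s′ n)

  -- Exponents are compared after doubling, where they are polynomials over ℤ.
  record Half (n : ℕ) (z : ℤ) : Set where
    constructor half
    field doubled : + n ℤ.+ + n ≡ z
  open Half

  half-expo : ∀ s s′ j → Half (expo s s′ j) ((+ s ℤ.+ + s′) ℤ.* (j ℤ.* j) ℤ.+ (+ s ℤ.- + s′) ℤ.* j)
  half-expo s s′ j = half (2expo s s′ j)

  half-self : ∀ n → Half n (+ n ℤ.+ + n)
  half-self n = half refl

  half-+ : ∀ {m n x y} → Half m x → Half n y → Half (m + n) (x ℤ.+ y)
  half-+ {m} {n} (half refl) (half refl) = half (lem (+ m) (+ n))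
    where
    lem : ∀ m n → m ℤ.+ n ℤ.+ (m ℤ.+ n) ≡ m ℤ.+ m ℤ.+ (n ℤ.+ n)
    lem = ℤ-Solver.solve-∀

  half-* : ∀ {m x} → Half m x → ∀ k → Half (m * k) (x ℤ.* + k)
  half-* {m} (half refl) k = half (trans (cong₂ ℤ._+_ (ℤ.pos-* m k) (ℤ.pos-* m k))
    (sym (ℤ.*-distribʳ-+ (+ k) (+ m) (+ m))))

  half-injective : ∀ {m n x y} → Half m x → Half n y → x ≡ y → m ≡ n
  half-injective (half p) (half q) x≡y = 2*-injective (trans p (trans x≡y (sym q)))

  half-≡ : ∀ {m n x y} → Half m x → Half n y → m ≡ n → x ≡ y
  half-≡ (half p) (half q) refl = trans (sym p) q

  sgn-double : ∀ v → sgn (v ℤ.* + 2) ≡ 1ℤ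
  sgn-double v = begin
    sgn (v ℤ.* + 2)     ≡⟨ cong sgn (lem v) ⟩
    sgn (v ℤ.+ v)       ≡⟨ sgn-+ v v ⟩
    sgn v ℤ.* sgn v     ≡⟨ alt-square ℤ.∣ v ∣ ⟩
    1ℤ                  ∎
    where
    open ≡-Reasoning
    lem : ∀ v → v ℤ.* + 2 ≡ v ℤ.+ v
    lem = ℤ-Solver.solve-∀
    neg-square : ∀ x → ℤ.- x ℤ.* ℤ.- x ≡ x ℤ.* x
    neg-square = ℤ-Solver.solve-∀
    alt-square : ∀ n → alt n ℤ.* alt n ≡ 1ℤ
    alt-square zero    = refl
    alt-square (suc n) = trans (neg-square (alt n)) (alt-square n)

  sgn-even : ∀ {z} w v → z ≡ w ℤ.+ v ℤ.* + 2 → sgn z ≡ sgn w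
  sgn-even w v refl = trans (sgn-+ w (v ℤ.* + 2))
    (trans (cong (λ x → sgn w ℤ.* x) (sgn-double v)) (ℤ.*-identityʳ _))

  sgn-odd : ∀ {z} w v → z ≡ w ℤ.+ v ℤ.* + 2 ℤ.+ 1ℤ → sgn z ≡ ℤ.- sgn w
  sgn-odd w v refl = trans (sgn-+ (w ℤ.+ v ℤ.* + 2) 1ℤ)
    (trans (cong (ℤ._* -1ℤ) (sgn-even w v refl)) (lem (sgn w)))
    where
    lem : ∀ x → x ℤ.* -1ℤ ≡ ℤ.- x
    lem = ℤ-Solver.solve-∀

  -- Representatives centred at 1, with -1 in place of 4: modulo 5 the polynomial 3 i² - i is
  -- invariant under i ↦ 2 - i, so the pairs in question are 0 and 2, and -1 and 3.
  residues : List ℤ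
  residues = -1ℤ ∷ + 0 ∷ + 1 ∷ + 2 ∷ + 3 ∷ []

  residue : ∀ z → ∃₂ λ a i → z ≡ a ℤ.* + 5 ℤ.+ i × i ∈ residues
  residue z with z ℤ.%ℕ 5 | ℤ.n%ℕd<d z 5 | ℤ.a≡a%ℕn+[a/ℕn]*n z 5
  ... | 0 | _ | eq = z ℤ./ℕ 5 , + 0 , trans eq (ℤ.+-comm (+ 0) (z ℤ./ℕ 5 ℤ.* + 5)) , there (here refl)
  ... | 1 | _ | eq = z ℤ./ℕ 5 , + 1 , trans eq (ℤ.+-comm (+ 1) (z ℤ./ℕ 5 ℤ.* + 5)) , there (there (here refl))
  ... | 2 | _ | eq = z ℤ./ℕ 5 , + 2 , trans eq (ℤ.+-comm (+ 2) (z ℤ./ℕ 5 ℤ.* + 5)) , there (there (there (here refl)))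
  ... | 3 | _ | eq = z ℤ./ℕ 5 , + 3 , trans eq (ℤ.+-comm (+ 3) (z ℤ./ℕ 5 ℤ.* + 5)) , there (there (there (there (here refl))))
  ... | 4 | _ | eq = 1ℤ ℤ.+ z ℤ./ℕ 5 , -1ℤ , trans eq (lem (z ℤ./ℕ 5)) , here refl
    where
    lem : ∀ q → + 4 ℤ.+ q ℤ.* + 5 ≡ (1ℤ ℤ.+ q) ℤ.* + 5 ℤ.+ -1ℤ
    lem = ℤ-Solver.solve-∀
  ... | suc (suc (suc (suc (suc _)))) | s≤s (s≤s (s≤s (s≤s (s≤s ())))) | _

  -- Compares 2 r with twice the pentagonal number of i, modulo 5.
  Compatible : ℕ → ℤ → Set
  Compatible r i = 5 ℕ.∣ ℤ.∣ + r ℤ.+ + r ℤ.- (+ 3 ℤ.* (i ℤ.* i) ℤ.- i) ∣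

  -- Modulo 5, twice the pentagonal number of 5 a + i depends on i alone, and the multiple of 5
  -- coming from the second theta series disappears.
  compatible : ∀ a i m n r → expo 1 2 (a ℤ.* + 5 ℤ.+ i) + m * 5 ≡ n * 5 + r → Compatible r i
  compatible a i m n r eq = multiple⇒∣ 5
    -- The difference of the two sides divided by 5, written without i² because 3 i² - i has been
    -- subtracted.
    (+ 15 ℤ.* (a ℤ.* a) ℤ.+ + 6 ℤ.* (a ℤ.* i) ℤ.- a ℤ.+ (+ m ℤ.+ + m) ℤ.- (+ n ℤ.+ + n))
    (trans (lem₁ a i (+ m) (+ n)) (trans
      (cong (λ z → z ℤ.- (+ n ℤ.+ + n) ℤ.* + 5 ℤ.- (+ 3 ℤ.* (i ℤ.* i) ℤ.- i))
        (half-≡ (half-+ (half-expo 1 2 (a ℤ.* + 5 ℤ.+ i)) (half-* (half-self m) 5))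
                (half-+ (half-* (half-self n) 5) (half-self r)) eq))
      (lem₂ i (+ n) (+ r))))
    where
    lem₁ : ∀ a i m n →
      (+ 15 ℤ.* (a ℤ.* a) ℤ.+ + 6 ℤ.* (a ℤ.* i) ℤ.- a ℤ.+ (m ℤ.+ m) ℤ.- (n ℤ.+ n)) ℤ.* + 5 ≡
      (+ 1 ℤ.+ + 2) ℤ.* ((a ℤ.* + 5 ℤ.+ i) ℤ.* (a ℤ.* + 5 ℤ.+ i)) ℤ.+ (+ 1 ℤ.- + 2) ℤ.* (a ℤ.* + 5 ℤ.+ i)
        ℤ.+ (m ℤ.+ m) ℤ.* + 5 ℤ.- (n ℤ.+ n) ℤ.* + 5 ℤ.- (+ 3 ℤ.* (i ℤ.* i) ℤ.- i)
    lem₁ = ℤ-Solver.solve-∀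
    lem₂ : ∀ i n r → (n ℤ.+ n) ℤ.* + 5 ℤ.+ (r ℤ.+ r) ℤ.- (n ℤ.+ n) ℤ.* + 5 ℤ.- (+ 3 ℤ.* (i ℤ.* i) ℤ.- i)
                   ≡ r ℤ.+ r ℤ.- (+ 3 ℤ.* (i ℤ.* i) ℤ.- i)
    lem₂ = ℤ-Solver.solve-∀

  -- f₁ with its factors taken in threes, the form to which the triple product applies; see
  -- `f≗triple`.
  euler : Series
  euler = ∏∞ (tripleFactor 1 2)

  a*5-injective : ∀ c {a b} → a ℤ.* + 5 ℤ.+ c ≡ b ℤ.* + 5 ℤ.+ c → a ≡ b
  a*5-injective c {a} {b} eq = ℤ.*-cancelʳ-≡ a b (+ 5) (+-cancelʳ c (a ℤ.* + 5) (b ℤ.* + 5) eq)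

  classes-disjoint : ∀ c₁ c₂ → ¬ 5 ℕ.∣ ℤ.∣ c₁ ℤ.- c₂ ∣ → ∀ a b → a ℤ.* + 5 ℤ.+ c₁ ≢ b ℤ.* + 5 ℤ.+ c₂
  classes-disjoint c₁ c₂ c₁≢c₂ a b eq = c₁≢c₂ (multiple⇒∣ 5 (b ℤ.- a)
    (trans (lem₁ a b c₁ c₂) (trans (cong (λ z → c₁ ℤ.- c₂ ℤ.- z ℤ.+ (b ℤ.* + 5 ℤ.+ c₂)) eq) (lem₂ c₁ c₂ (b ℤ.* + 5 ℤ.+ c₂)))))
    where
    lem₁ : ∀ a b c d → (b ℤ.- a) ℤ.* + 5 ≡ c ℤ.- d ℤ.- (a ℤ.* + 5 ℤ.+ c) ℤ.+ (b ℤ.* + 5 ℤ.+ d)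
    lem₁ = ℤ-Solver.solve-∀
    lem₂ : ∀ c d z → c ℤ.- d ℤ.- z ℤ.+ z ≡ c ℤ.- d
    lem₂ = ℤ-Solver.solve-∀

  -- Incongruent c₁ and c₂ make the map from two copies of ℤ × ℤ injective, and every nonzero term
  -- lies in its image.
  ⇒-two-classes : ∀ {g : ℤ × ℤ → ℤ} {s} c₁ c₂ → ¬ 5 ℕ.∣ ℤ.∣ c₁ ℤ.- c₂ ∣ →
    (∀ j m → g (j , m) ≢ 0ℤ → ∃ λ a → j ≡ a ℤ.* + 5 ℤ.+ c₁ ⊎ j ≡ a ℤ.* + 5 ℤ.+ c₂) →
    g ⇒ s → ∃₂ λ s₁ s₂ → (λ (a , m) → g (a ℤ.* + 5 ℤ.+ c₁ , m)) ⇒ s₁ ×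
                         (λ (a , m) → g (a ℤ.* + 5 ℤ.+ c₂ , m)) ⇒ s₂ × s ≡ s₁ ℤ.+ s₂
  ⇒-two-classes {g} c₁ c₂ c₁≢c₂ covers p = ⇒-split (⇒-pullback φ φ-injective φ-covers p)
    where
    φ : (ℤ × ℤ) ⊎ (ℤ × ℤ) → ℤ × ℤ
    φ (inj₁ (a , m)) = a ℤ.* + 5 ℤ.+ c₁ , m
    φ (inj₂ (a , m)) = a ℤ.* + 5 ℤ.+ c₂ , m
    φ-injective : ∀ {x y} → φ x ≡ φ y → x ≡ y
    φ-injective {inj₁ (a , m)} {inj₁ (b , _)} eq with p , refl ← ,-injective eq =
      cong (λ z → inj₁ (z , m)) (a*5-injective c₁ p)
    φ-injective {inj₂ (a , m)} {inj₂ (b , _)} eq with p , refl ← ,-injective eq =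
      cong (λ z → inj₂ (z , m)) (a*5-injective c₂ p)
    φ-injective {inj₁ (a , m)} {inj₂ (b , _)} eq =
      ⊥-elim (classes-disjoint c₁ c₂ c₁≢c₂ a b (proj₁ (,-injective eq)))
    φ-injective {inj₂ (a , m)} {inj₁ (b , _)} eq =
      ⊥-elim (classes-disjoint c₁ c₂ c₁≢c₂ b a (sym (proj₁ (,-injective eq))))
    φ-covers : ∀ x → g x ≢ 0ℤ → ∃ λ y → φ y ≡ x
    φ-covers (j , m) nz with covers j m nz
    ... | a , inj₁ refl = inj₁ (a , m) , refl
    ... | a , inj₂ refl = inj₂ (a , m) , refl

  SumsTo : (ℤ → Series) → Series → Set
  SumsTo u a = ∀ n → (λ j → u j n) ⇒ a n

  ⇒-θ⊛θ : ∀ p p′ s s′ .{{_ : NonZero p}} .{{_ : NonZero p′}} .{{_ : NonZero s}} .{{_ : NonZero s′}} a b →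
    SumsTo (θ p p′) a → SumsTo (θ s s′) b →
    ∀ n → (λ (j , m) → (sgn (j ℤ.+ m) • q^ (expo p p′ j + expo s s′ m)) n) ⇒ (a ⊛ b) n
  ⇒-θ⊛θ p p′ s s′ a b a⇒ b⇒ n = ⇒-cong eq
    (⇒-⊛ {θ p p′} {θ s s′} {a} {b} (θ-bounded p p′) (θ-bounded s s′) a⇒ b⇒ n)
    where
    eq : ∀ x → (θ p p′ (proj₁ x) ⊛ θ s s′ (proj₂ x)) n ≡
               (sgn (proj₁ x ℤ.+ proj₂ x) • q^ (expo p p′ (proj₁ x) + expo s s′ (proj₂ x))) n
    eq (j , m) = trans (•q^-⊛-•q^ (sgn j) (expo p p′ j) (sgn m) (expo s s′ m) n)
      (cong (λ c → c ℤ.* (q^ (expo p p′ j + expo s s′ m)) n) (sym (sgn-+ j m)))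

  -- `lhs`: the exponents in the product of `euler` with a theta series in q⁵. `rhs`: the exponents
  -- in the product of f₅, as a theta series, with another one.
  lhs rhs : ℕ → ℕ → ℤ → ℤ → ℕ
  lhs s s′ j m = expo 1 2 j + expo s s′ m * 5
  rhs t t′ x y = expo 5 10 x + expo t t′ y

  -- The arithmetic of one class r. The indices c₁ and c₂ are those whose pentagonal number is r
  -- modulo 5, and ε is the sign of the right-hand side. The fields numbered 1, 2 and 3 are the
  -- hypotheses of `rearrange` in this order, separated into exponents and signs: 1 and 2 match
  -- terms with the other side, 3 cancels terms.
  record TwoClasses (r : ℕ) (s s′ t t′ : ℕ) (ε c₁ c₂ : ℤ) : Set where
    field
      c₁≢c₂     : ¬ 5 ℕ.∣ ℤ.∣ c₁ ℤ.- c₂ ∣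
      classes   : ∀ i → i ∈ residues → Compatible r i → i ≡ c₁ ⊎ i ≡ c₂
      exponent₁ : ∀ a b → lhs s s′ (a ℤ.* + 5 ℤ.+ c₁) (a ℤ.- b ℤ.* + 2) ≡
                  rhs t t′ b (a ℤ.* + 2 ℤ.- b) * 5 + r
      exponent₂ : ∀ a b → lhs s s′ (a ℤ.* + 5 ℤ.+ c₂) (b ℤ.* + 2 ℤ.- 1ℤ ℤ.- a) ≡
                  rhs t t′ b (b ℤ.- a ℤ.* + 2 ℤ.- 1ℤ) * 5 + r
      exponent₃ : ∀ a b → lhs s s′ (a ℤ.* + 5 ℤ.+ c₁) (a ℤ.- b ℤ.* + 2 ℤ.- 1ℤ) ≡
                  lhs s s′ ((b ℤ.- a) ℤ.* + 5 ℤ.+ c₂) (a ℤ.+ b)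
      sign₁     : ∀ a b → sgn (a ℤ.* + 5 ℤ.+ c₁ ℤ.+ (a ℤ.- b ℤ.* + 2)) ≡
                  ε ℤ.* sgn (b ℤ.+ (a ℤ.* + 2 ℤ.- b))
      sign₂     : ∀ a b → sgn (a ℤ.* + 5 ℤ.+ c₂ ℤ.+ (b ℤ.* + 2 ℤ.- 1ℤ ℤ.- a)) ≡
                  ε ℤ.* sgn (b ℤ.+ (b ℤ.- a ℤ.* + 2 ℤ.- 1ℤ))
      sign₃     : ∀ a b → sgn (a ℤ.* + 5 ℤ.+ c₁ ℤ.+ (a ℤ.- b ℤ.* + 2 ℤ.- 1ℤ)) ≡
                  ℤ.- sgn ((b ℤ.- a) ℤ.* + 5 ℤ.+ c₂ ℤ.+ (a ℤ.+ b))

  •q^-section : ∀ ε {c d} k m r n → c ≡ ε ℤ.* d → k ≡ m * 5 + r →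
                (c • q^ k) (n * 5 + r) ≡ ε ℤ.* (d • q^ m) n
  •q^-section ε {d = d} _ m r n p refl = trans (cong₂ ℤ._*_ p (q^-section m r n)) (ℤ.*-assoc ε d _)

  -- The indices j ≡ c₁ and j ≡ c₂ give the functions F₁ and F₂ of `rearrange`; other j contribute
  -- nothing to exponents congruent to r.
  coefficient : ∀ {r s s′ t t′ ε c₁ c₂} → TwoClasses r s s′ t t′ ε c₁ c₂ → ∀ {x y} n →
    (λ (j , m) → (sgn (j ℤ.+ m) • q^ (expo 1 2 j + expo s s′ m * 5)) (n * 5 + r)) ⇒ x →
    (λ (j , m) → (sgn (j ℤ.+ m) • q^ (expo 5 10 j + expo t t′ m)) n) ⇒ y → x ≡ ε ℤ.* y
  coefficient {r} {s} {s′} {t} {t′} {ε} {c₁} {c₂} tc {x} {y} n F⇒ G⇒ =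
    let s₁ , s₂ , p₁ , p₂ , eq = ⇒-two-classes c₁ c₂ c₁≢c₂ covers F⇒ in
    trans eq (rearrange p₁ p₂ (⇒-* ε G⇒)
      (λ a b → •q^-section ε (lhs s s′ (a ℤ.* + 5 ℤ.+ c₁) (a ℤ.- b ℤ.* + 2))
        (rhs t t′ b (a ℤ.* + 2 ℤ.- b)) r n (sign₁ a b) (exponent₁ a b))
      (λ a b → •q^-section ε (lhs s s′ (a ℤ.* + 5 ℤ.+ c₂) (b ℤ.* + 2 ℤ.- 1ℤ ℤ.- a))
        (rhs t t′ b (b ℤ.- a ℤ.* + 2 ℤ.- 1ℤ)) r n (sign₂ a b) (exponent₂ a b))
      (λ a b → trans (cong₂ (λ c z → c ℤ.* (q^ z) (n * 5 + r)) (sign₃ a b) (exponent₃ a b))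
                     (sym (ℤ.neg-distribˡ-* (sgn ((b ℤ.- a) ℤ.* + 5 ℤ.+ c₂ ℤ.+ (a ℤ.+ b))) _))))
    where
    open TwoClasses tc
    covers : ∀ j m → (sgn (j ℤ.+ m) • q^ lhs s s′ j m) (n * 5 + r) ≢ 0ℤ →
             ∃ λ a → j ≡ a ℤ.* + 5 ℤ.+ c₁ ⊎ j ≡ a ℤ.* + 5 ℤ.+ c₂
    covers j m nz = class (residue j) (•q^-support (sgn (j ℤ.+ m)) (lhs s s′ j m) (n * 5 + r) nz)
      where
      class : (∃₂ λ a i → j ≡ a ℤ.* + 5 ℤ.+ i × i ∈ residues) → lhs s s′ j m ≡ n * 5 + r →
              ∃ λ a → j ≡ a ℤ.* + 5 ℤ.+ c₁ ⊎ j ≡ a ℤ.* + 5 ℤ.+ c₂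
      class (a , i , refl , i∈) eq = a , Sum.map (cong (λ z → a ℤ.* + 5 ℤ.+ z)) (cong (λ z → a ℤ.* + 5 ℤ.+ z))
        (classes i i∈ (compatible a i (expo s s′ m) n r eq))

  -- The class of E is multiplied by M instead of being expressed as a quotient. As L is M at q⁵,
  -- the product of M with the class r of E is the class r of E L, and both sides become double
  -- theta sums.
  dissect : ∀ {r s s′ t t′ ε c₁ c₂} .{{_ : NonZero s}} .{{_ : NonZero s′}} .{{_ : NonZero t}} .{{_ : NonZero t′}} →
    TwoClasses r s s′ t t′ ε c₁ c₂ → r < 5 → ∀ {E L M P N} →
    SumsTo (θ 1 2) E → SumsTo (θ (5 * s) (5 * s′)) L → SumsTo (θ 5 10) P → SumsTo (θ t t′) N →
    Sparse L → section 0 L ≗ M → M ⊛ section r E ≗ ε • (P ⊛ N)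
  dissect {r} {s} {s′} {t} {t′} {ε} tc r<5 {E} {L} {M} {P} {N} E⇒ L⇒ P⇒ N⇒ L-sparse L-section n = begin
    (M ⊛ section r E) n              ≡⟨ ⊛-cong {b = section r E} L-section (λ _ → refl) n ⟨
    (section 0 L ⊛ section r E) n    ≡⟨ ⊛-section L E L-sparse r<5 n ⟨
    (L ⊛ E) (n * 5 + r)              ≡⟨ ⊛-comm L E (n * 5 + r) ⟩
    (E ⊛ L) (n * 5 + r)              ≡⟨ coefficient tc n
                                          (⇒-cong (λ x → cong (λ z → (sgn (proj₁ x ℤ.+ proj₂ x) • q^ (expo 1 2 (proj₁ x) + z)) (n * 5 + r))
                                            (expo-5* s s′ (proj₂ x)))
                                            (⇒-θ⊛θ 1 2 (5 * s) (5 * s′) E L E⇒ L⇒ (n * 5 + r)))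
                                          (⇒-θ⊛θ 5 10 t t′ P N P⇒ N⇒ n) ⟩
    ε ℤ.* (P ⊛ N) n                  ∎
    where
    open ≡-Reasoning
    instance
      5s≢0 : NonZero (5 * s)
      5s≢0 = ℕ.m*n≢0 5 s
      5s′≢0 : NonZero (5 * s′)
      5s′≢0 = ℕ.m*n≢0 5 s′

-- The five residue classes of the pentagonal number series.

module PentagonalSections where

  open import Defs hiding (_⊖_)
  open FormalSeries
  open FiniteSums
  open InfiniteProducts
  open TripleProduct
  open Sections
  open Dissection
  open import Data.Integer as ℤ using (ℤ; 0ℤ; 1ℤ; -1ℤ; +_; _+_; _*_; _-_; -_)
  import Data.Integer.Properties as ℤ
  open import Data.Integer.Tactic.RingSolver using (solve-∀)
  open import Data.List.Membership.Propositional using (_∈_)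
  open import Data.List.Relation.Unary.Any using (here; there)
  open import Data.Nat as ℕ using (ℕ; z≤n; s≤s)
  import Data.Nat.Properties as ℕ
  open import Data.Nat.Divisibility as ℕ using (_∣?_)
  open import Data.Product using (_,_; ∃)
  open import Data.Sum using (_⊎_; inj₁; inj₂)
  open import Relation.Binary.PropositionalEquality
  open import Relation.Nullary using (¬_; yes; no; contradiction)
  open import Relation.Nullary.Decidable using (from-no)

  half-lhs : ∀ s s′ j m → Half (expo 1 2 j ℕ.+ expo s s′ m ℕ.* 5) _
  half-lhs s s′ j m = half-+ (half-expo 1 2 j) (half-* (half-expo s s′ m) 5)

  half-rhs : ∀ t t′ r x y → Half ((expo 5 10 x ℕ.+ expo t t′ y) ℕ.* 5 ℕ.+ r) _
  half-rhs t t′ r x y = half-+ (half-* (half-+ (half-expo 5 10 x) (half-expo t t′ y)) 5) (half-self r)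

  private module Section₀ where

    -- An equation of doubled exponents: 3 j² - j for the pair (1, 2), 5 m² + 3 m for (4, 1), 15 x²
    -- - 5 x for (5, 10) and 5 y² + y for (3, 2). The final summand is 2 r.
    poly₁ : ∀ a b →
        (+ 3 * ((a * + 5 + + 0) * (a * + 5 + + 0)) + - (+ 1) * (a * + 5 + + 0))
        + (+ 5 * ((a - b * + 2) * (a - b * + 2)) + + 3 * (a - b * + 2)) * + 5 ≡
        ((+ 15 * (b * b) + - (+ 5) * b)
        + (+ 5 * ((a * + 2 - b) * (a * + 2 - b)) + + 1 * (a * + 2 - b))) * + 5 + + 0
    poly₁ = solve-∀
    poly₂ : ∀ a b →
        (+ 3 * ((a * + 5 + + 2) * (a * + 5 + + 2)) + - (+ 1) * (a * + 5 + + 2))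
        + (+ 5 * ((b * + 2 - 1ℤ - a) * (b * + 2 - 1ℤ - a)) + + 3 * (b * + 2 - 1ℤ - a)) * + 5 ≡
        ((+ 15 * (b * b) + - (+ 5) * b)
        + (+ 5 * ((b - a * + 2 - 1ℤ) * (b - a * + 2 - 1ℤ)) + + 1 * (b - a * + 2 - 1ℤ))) * + 5 + + 0
    poly₂ = solve-∀
    poly₃ : ∀ a b →
        (+ 3 * ((a * + 5 + + 0) * (a * + 5 + + 0)) + - (+ 1) * (a * + 5 + + 0))
        + (+ 5 * ((a - b * + 2 - 1ℤ) * (a - b * + 2 - 1ℤ)) + + 3 * (a - b * + 2 - 1ℤ)) * + 5 ≡
        (+ 3 * (((b - a) * + 5 + + 2) * ((b - a) * + 5 + + 2)) + - (+ 1) * ((b - a) * + 5 + + 2))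
        + (+ 5 * ((a + b) * (a + b)) + + 3 * (a + b)) * + 5
    poly₃ = solve-∀

    parity₁ : ∀ a b → a * + 5 + + 0 + (a - b * + 2) ≡ b + (a * + 2 - b) + (a * + 2 - b) * + 2
    parity₁ = solve-∀
    parity₂ : ∀ a b → a * + 5 + + 2 + (b * + 2 - 1ℤ - a) ≡ b + (b - a * + 2 - 1ℤ) + (a * + 3 + 1ℤ) * + 2
    parity₂ = solve-∀
    parity₃ : ∀ a b → a * + 5 + + 0 + (a - b * + 2 - 1ℤ) ≡ (b - a) * + 5 + + 2 + (a + b) + (a * + 5 - b * + 4 - + 2) * + 2 + 1ℤ
    parity₃ = solve-∀
    classes : ∀ i → i ∈ residues → Compatible 0 i → i ≡ + 0 ⊎ i ≡ + 2
    classes _ (here refl) c = contradiction c (from-no (5 ∣? 4))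
    classes _ (there (here refl)) _ = inj₁ refl
    classes _ (there (there (here refl))) c = contradiction c (from-no (5 ∣? 2))
    classes _ (there (there (there (here refl)))) _ = inj₂ refl
    classes _ (there (there (there (there (here refl))))) c = contradiction c (from-no (5 ∣? 24))

    -- The equation of class 0, with B on the left as the pair (4, 1) and A on the right as (3, 2).
    -- Pentagonal numbers divisible by 5 have index 0 or 2 modulo 5; these are even, hence ε = 1.
    twoClasses : TwoClasses 0 4 1 3 2 1ℤ (+ 0) (+ 2)
    twoClasses = record
      { c₁≢c₂     = from-no (5 ∣? 2)
      ; classes   = classes
      ; exponent₁ = λ a b → half-injective
          (half-lhs 4 1 (a * + 5 + + 0) (a - b * + 2))
          (half-rhs 3 2 0 b (a * + 2 - b)) (poly₁ a b)
      ; exponent₂ = λ a b → half-injective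
          (half-lhs 4 1 (a * + 5 + + 2) (b * + 2 - 1ℤ - a))
          (half-rhs 3 2 0 b (b - a * + 2 - 1ℤ)) (poly₂ a b)
      ; exponent₃ = λ a b → half-injective
          (half-lhs 4 1 (a * + 5 + + 0) (a - b * + 2 - 1ℤ))
          (half-lhs 4 1 ((b - a) * + 5 + + 2) (a + b)) (poly₃ a b)
      ; sign₁     = (λ a b → trans (sgn-even (b + (a * + 2 - b)) (a * + 2 - b) (parity₁ a b)) (sym (ℤ.*-identityˡ _)))
      ; sign₂     = (λ a b → trans (sgn-even (b + (b - a * + 2 - 1ℤ)) (a * + 3 + 1ℤ) (parity₂ a b)) (sym (ℤ.*-identityˡ _)))
      ; sign₃     = λ a b → sgn-odd ((b - a) * + 5 + + 2 + (a + b)) (a * + 5 - b * + 4 - + 2) (parity₃ a b)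
      }

  private module Section₂ where

    poly₁ : ∀ a b →
        (+ 3 * ((a * + 5 + -1ℤ) * (a * + 5 + -1ℤ)) + - (+ 1) * (a * + 5 + -1ℤ))
        + (+ 5 * ((a - b * + 2) * (a - b * + 2)) + + 1 * (a - b * + 2)) * + 5 ≡
        ((+ 15 * (b * b) + - (+ 5) * b)
        + (+ 5 * ((a * + 2 - b) * (a * + 2 - b)) + - (+ 3) * (a * + 2 - b))) * + 5 + + 4
    poly₁ = solve-∀
    poly₂ : ∀ a b →
        (+ 3 * ((a * + 5 + + 3) * (a * + 5 + + 3)) + - (+ 1) * (a * + 5 + + 3))
        + (+ 5 * ((b * + 2 - 1ℤ - a) * (b * + 2 - 1ℤ - a)) + + 1 * (b * + 2 - 1ℤ - a)) * + 5 ≡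
        ((+ 15 * (b * b) + - (+ 5) * b)
        + (+ 5 * ((b - a * + 2 - 1ℤ) * (b - a * + 2 - 1ℤ)) + - (+ 3) * (b - a * + 2 - 1ℤ))) * + 5 + + 4
    poly₂ = solve-∀
    poly₃ : ∀ a b →
        (+ 3 * ((a * + 5 + -1ℤ) * (a * + 5 + -1ℤ)) + - (+ 1) * (a * + 5 + -1ℤ))
        + (+ 5 * ((a - b * + 2 - 1ℤ) * (a - b * + 2 - 1ℤ)) + + 1 * (a - b * + 2 - 1ℤ)) * + 5 ≡
        (+ 3 * (((b - a) * + 5 + + 3) * ((b - a) * + 5 + + 3)) + - (+ 1) * ((b - a) * + 5 + + 3))
        + (+ 5 * ((a + b) * (a + b)) + + 1 * (a + b)) * + 5
    poly₃ = solve-∀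

    parity₁ : ∀ a b → a * + 5 + -1ℤ + (a - b * + 2) ≡ b + (a * + 2 - b) + (a * + 2 - b - 1ℤ) * + 2 + 1ℤ
    parity₁ = solve-∀
    parity₂ : ∀ a b → a * + 5 + + 3 + (b * + 2 - 1ℤ - a) ≡ b + (b - a * + 2 - 1ℤ) + (a * + 3 + 1ℤ) * + 2 + 1ℤ
    parity₂ = solve-∀
    parity₃ : ∀ a b → a * + 5 + -1ℤ + (a - b * + 2 - 1ℤ) ≡ (b - a) * + 5 + + 3 + (a + b) + (a * + 5 - b * + 4 - + 3) * + 2 + 1ℤ
    parity₃ = solve-∀
    classes : ∀ i → i ∈ residues → Compatible 2 i → i ≡ -1ℤ ⊎ i ≡ + 3
    classes _ (here refl) _ = inj₁ refl
    classes _ (there (here refl)) c = contradiction c (from-no (5 ∣? 4))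
    classes _ (there (there (here refl))) c = contradiction c (from-no (5 ∣? 2))
    classes _ (there (there (there (here refl)))) c = contradiction c (from-no (5 ∣? 6))
    classes _ (there (there (there (there (here refl))))) _ = inj₂ refl

    -- Now A is on the left and B on the right. The pair (1, 4) gives the same product as (4, 1)
    -- with the theta index negated, and this orientation is the one compatible with the
    -- substitutions of `rearrange`. The indices -1 and 3 are odd, hence ε = -1.
    twoClasses : TwoClasses 2 3 2 1 4 -1ℤ (-1ℤ) (+ 3)
    twoClasses = record
      { c₁≢c₂     = from-no (5 ∣? 4)
      ; classes   = classes
      ; exponent₁ = λ a b → half-injective
          (half-lhs 3 2 (a * + 5 + -1ℤ) (a - b * + 2))
          (half-rhs 1 4 2 b (a * + 2 - b)) (poly₁ a b)
      ; exponent₂ = λ a b → half-injective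
          (half-lhs 3 2 (a * + 5 + + 3) (b * + 2 - 1ℤ - a))
          (half-rhs 1 4 2 b (b - a * + 2 - 1ℤ)) (poly₂ a b)
      ; exponent₃ = λ a b → half-injective
          (half-lhs 3 2 (a * + 5 + -1ℤ) (a - b * + 2 - 1ℤ))
          (half-lhs 3 2 ((b - a) * + 5 + + 3) (a + b)) (poly₃ a b)
      ; sign₁     = (λ a b → trans (sgn-odd (b + (a * + 2 - b)) (a * + 2 - b - 1ℤ) (parity₁ a b)) (sym (ℤ.-1*i≡-i _)))
      ; sign₂     = (λ a b → trans (sgn-odd (b + (b - a * + 2 - 1ℤ)) (a * + 3 + 1ℤ) (parity₂ a b)) (sym (ℤ.-1*i≡-i _)))
      ; sign₃     = λ a b → sgn-odd ((b - a) * + 5 + + 3 + (a + b)) (a * + 5 - b * + 4 - + 3) (parity₃ a b)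
      }

  section₀ : ∏∞ (tripleFactor 4 1) ⊛ section 0 euler ≗ ∏∞ (tripleFactor 5 10) ⊛ ∏∞ (tripleFactor 3 2)
  section₀ n = trans
    (dissect Section₀.twoClasses (s≤s z≤n) (jacobiTripleProduct 1 2) (jacobiTripleProduct 20 5)
      (jacobiTripleProduct 5 10) (jacobiTripleProduct 3 2)
      (tripleProduct-sparse 4 1) (tripleProduct-section 4 1) n)
    (ℤ.*-identityˡ _)

  section₂ : ∏∞ (tripleFactor 3 2) ⊛ section 2 euler ≗ ⊝ (∏∞ (tripleFactor 5 10) ⊛ ∏∞ (tripleFactor 1 4))
  section₂ n = trans
    (dissect Section₂.twoClasses (s≤s (s≤s (s≤s z≤n))) (jacobiTripleProduct 1 2) (jacobiTripleProduct 15 10)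
      (jacobiTripleProduct 5 10) (jacobiTripleProduct 1 4)
      (tripleProduct-sparse 3 2) (tripleProduct-section 3 2) n)
    (ℤ.-1*i≡-i _)

  θ-compatible : ∀ a i n r → θ 1 2 (a * + 5 + i) (n ℕ.* 5 ℕ.+ r) ≢ 0ℤ → Compatible r i
  θ-compatible a i n r nz = compatible a i 0 n r
    (trans (ℕ.+-identityʳ _) (•q^-support (sgn (a * + 5 + i)) (expo 1 2 (a * + 5 + i)) (n ℕ.* 5 ℕ.+ r) nz))

  section-vanishes : ∀ r → (∀ i → i ∈ residues → ¬ Compatible r i) → section r euler ≗ 𝟎
  section-vanishes r incompatible n = ⇒-functional (jacobiTripleProduct 1 2 (n ℕ.* 5 ℕ.+ r)) (⇒-zero vanish)
    where
    vanish : ∀ j → θ 1 2 j (n ℕ.* 5 ℕ.+ r) ≡ 0ℤ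
    vanish j with a , i , refl , i∈ ← residue j with θ 1 2 (a * + 5 + i) (n ℕ.* 5 ℕ.+ r) ℤ.≟ 0ℤ
    ... | yes z  = z
    ... | no  nz = contradiction (θ-compatible a i n r nz) (incompatible i i∈)

  section₃ : section 3 euler ≗ 𝟎
  section₃ = section-vanishes 3 λ where
    _ (here refl)                                 → from-no (5 ∣? 2)
    _ (there (here refl))                         → from-no (5 ∣? 6)
    _ (there (there (here refl)))                 → from-no (5 ∣? 4)
    _ (there (there (there (here refl))))         → from-no (5 ∣? 4)
    _ (there (there (there (there (here refl))))) → from-no (5 ∣? 18)

  section₄ : section 4 euler ≗ 𝟎
  section₄ = section-vanishes 4 λ where
    _ (here refl)                                 → from-no (5 ∣? 4)
    _ (there (here refl))                         → from-no (5 ∣? 8)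
    _ (there (there (here refl)))                 → from-no (5 ∣? 6)
    _ (there (there (there (here refl))))         → from-no (5 ∣? 2)
    _ (there (there (there (there (here refl))))) → from-no (5 ∣? 16)

  section₁ : section 1 euler ≗ ⊝ ∏∞ (tripleFactor 5 10)
  section₁ n = ⇒-functional
    (⇒-pullback φ φ-injective φ-covers (jacobiTripleProduct 1 2 (n ℕ.* 5 ℕ.+ 1)))
    (⇒-cong eq (⇒-neg (jacobiTripleProduct 5 10 n)))
    where
    φ : ℤ → ℤ
    -- Only the residue 1 occurs. The index is reversed because j = 5 a + 1 leads to the exponent
    -- (15 a² + 5 a) / 2, whereas `expo 5 10` has the linear term with a minus sign.
    φ a = - a * + 5 + 1ℤ
    φ-injective : ∀ {a b} → φ a ≡ φ b → a ≡ b
    φ-injective eq = ℤ.neg-injective (a*5-injective 1ℤ eq)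
    φ-covers : ∀ j → θ 1 2 j (n ℕ.* 5 ℕ.+ 1) ≢ 0ℤ → ∃ λ a → φ a ≡ j
    φ-covers j nz with a , i , refl , i∈ ← residue j = cover {a} i∈ (θ-compatible a i n 1 nz)
      where
      cover : ∀ {a i} → i ∈ residues → Compatible 1 i → ∃ λ b → φ b ≡ a * + 5 + i
      cover {a} (there (there (here refl))) _ = - a , cong (λ z → z * + 5 + 1ℤ) (ℤ.neg-involutive a)
      cover (here refl) c = contradiction c (from-no (5 ∣? 2))
      cover (there (here refl)) c = contradiction c (from-no (5 ∣? 2))
      cover (there (there (there (here refl)))) c = contradiction c (from-no (5 ∣? 8))
      cover (there (there (there (there (here refl))))) c = contradiction c (from-no (5 ∣? 22))
    exponent : ∀ a → expo 1 2 (φ a) ≡ expo 5 10 a ℕ.* 5 ℕ.+ 1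
    exponent a = half-injective (half-expo 1 2 (φ a)) (half-+ (half-* (half-expo 5 10 a) 5) (half-self 1)) (poly a)
      where
      poly : ∀ a → (+ 1 + + 2) * ((- a * + 5 + 1ℤ) * (- a * + 5 + 1ℤ)) + (+ 1 - + 2) * (- a * + 5 + 1ℤ)
                 ≡ ((+ 5 + + 10) * (a * a) + (+ 5 - + 10) * a) * + 5 + (+ 1 + + 1)
      poly = solve-∀
    sign : ∀ a → sgn (φ a) ≡ - sgn a
    sign a = sgn-odd a (a * - (+ 3)) (parity a)
      where
      parity : ∀ a → - a * + 5 + 1ℤ ≡ a + a * - (+ 3) * + 2 + 1ℤ
      parity = solve-∀
    eq : ∀ a → - θ 5 10 a n ≡ θ 1 2 (φ a) (n ℕ.* 5 ℕ.+ 1)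
    eq a = trans (ℤ.neg-distribˡ-* (sgn a) _) (sym (cong₂ _*_ (sign a)
      (trans (cong (λ z → (q^ z) (n ℕ.* 5 ℕ.+ 1)) (exponent a)) (q^-section (expo 5 10 a) 1 n))))

-- Substitution of -q, and quotients with nonnegative coefficients.

module NonnegativeQuotients where

  open import Defs renaming (_⊖_ to _⊝⊝_)
  open FormalSeries
  open InfiniteProducts
  open import Data.Integer as ℤ using (ℤ; 0ℤ; 1ℤ; -1ℤ; +_)
  import Data.Integer.Properties as ℤ
  import Data.Integer.Tactic.RingSolver as ℤ-Solver
  open import Data.Nat as ℕ using (ℕ; zero; suc; _+_; _∸_; _%_; _<_; z≤n; s≤s; NonZero)
  import Data.Nat.DivMod as ℕ
  import Data.Nat.Properties as ℕ
  open import Function using (_∘_)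
  open import Relation.Binary.PropositionalEquality
  open import Relation.Nullary using (yes; no)

  -- Substitution of -q for q.
  σ : Series → Series
  σ a n = alt n ℤ.* a n

  σ-cong : ∀ {a b} → a ≗ b → σ a ≗ σ b
  σ-cong p n = cong (λ z → alt n ℤ.* z) (p n)

  -- Induction along the convolution; taking the tail anticommutes with σ, which is where the factor
  -- -1 comes from.
  σ-⊛ : ∀ a b → σ (a ⊛ b) ≗ σ a ⊛ σ b
  σ-⊛ a b zero = lem (a 0) (b 0)
    where
    lem : ∀ x y → 1ℤ ℤ.* (x ℤ.* y ℤ.+ 0ℤ) ≡ 1ℤ ℤ.* x ℤ.* (1ℤ ℤ.* y) ℤ.+ 0ℤ
    lem = ℤ-Solver.solve-∀
  σ-⊛ a b (suc n) = begin
    ℤ.- alt n ℤ.* (a 0 ℤ.* b (suc n) ℤ.+ (tail a ⊛ b) n)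
      ≡⟨ lem (alt n) (a 0) (b (suc n)) ((tail a ⊛ b) n) ⟩
    1ℤ ℤ.* a 0 ℤ.* (ℤ.- alt n ℤ.* b (suc n)) ℤ.+ -1ℤ ℤ.* (σ (tail a ⊛ b)) n
      ≡⟨ cong (λ z → σ a 0 ℤ.* σ b (suc n) ℤ.+ -1ℤ ℤ.* z) (σ-⊛ (tail a) b n) ⟩
    σ a 0 ℤ.* σ b (suc n) ℤ.+ -1ℤ ℤ.* (σ (tail a) ⊛ σ b) n
      ≡⟨ cong (λ z → σ a 0 ℤ.* σ b (suc n) ℤ.+ z) (•-⊛ -1ℤ (σ (tail a)) (σ b) n) ⟨
    σ a 0 ℤ.* σ b (suc n) ℤ.+ ((-1ℤ • σ (tail a)) ⊛ σ b) n
      ≡⟨ cong (λ z → σ a 0 ℤ.* σ b (suc n) ℤ.+ z)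
           (⊛-cong { -1ℤ • σ (tail a)} {tail (σ a)} {σ b} {σ b} (λ k → tail-σ (alt k) (a (suc k))) (λ _ → refl) n) ⟩
    (σ a ⊛ σ b) (suc n) ∎
    where
    open ≡-Reasoning
    lem : ∀ s x y z → ℤ.- s ℤ.* (x ℤ.* y ℤ.+ z) ≡ 1ℤ ℤ.* x ℤ.* (ℤ.- s ℤ.* y) ℤ.+ -1ℤ ℤ.* (s ℤ.* z)
    lem = ℤ-Solver.solve-∀
    tail-σ : ∀ s x → -1ℤ ℤ.* (s ℤ.* x) ≡ ℤ.- s ℤ.* x
    tail-σ = ℤ-Solver.solve-∀

  σ-1 : σ (q^ 0) ≗ q^ 0
  σ-1 zero    = refl
  σ-1 (suc n) = ℤ.*-zeroʳ (alt (suc n))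

  σ-∏ : ∀ u n → σ (∏[ n ] u) ≗ ∏[ n ] (σ ∘ u)
  σ-∏ u zero    = σ-1
  σ-∏ u (suc n) k = trans (σ-⊛ (∏[ n ] u) (u n) k)
    (⊛-cong {σ (∏[ n ] u)} {∏[ n ] (σ ∘ u)} {σ (u n)} {σ (u n)} (σ-∏ u n) (λ _ → refl) k)

  σ-∏∞ : ∀ u → σ (∏∞ u) ≗ ∏∞ (σ ∘ u)
  σ-∏∞ u n = σ-∏ u n n

  σ-admissible : ∀ {u} → Admissible u → Admissible (σ ∘ u)
  σ-admissible adm k i i≤k = trans (cong (λ z → alt i ℤ.* z) (adm k i i≤k)) (σ-1 i)

  μ π : ℕ → Series
  μ m = q^ 0 ⊝⊝ q^ m
  π m = q^ 0 ⊕ q^ m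

  σ-q^ : ∀ m → σ (q^ m) ≗ alt m • q^ m
  σ-q^ m n with n ℕ.≟ m
  ... | yes refl = refl
  ... | no  n≢m  = trans (cong (λ z → alt n ℤ.* z) (q^-off m n n≢m)) (trans (ℤ.*-zeroʳ (alt n))
                     (trans (sym (ℤ.*-zeroʳ (alt m))) (cong (λ z → alt m ℤ.* z) (sym (q^-off m n n≢m)))))

  σ-μ : ∀ m → σ (μ m) ≗ q^ 0 ⊕ (ℤ.- alt m) • q^ m
  σ-μ m n = trans (lem (alt n) ((q^ 0) n) ((q^ m) n)) (trans
    (cong₂ ℤ._-_ (σ-1 n) (σ-q^ m n)) (cong (λ z → (q^ 0) n ℤ.+ z) (ℤ.neg-distribˡ-* (alt m) ((q^ m) n))))
    where
    lem : ∀ s x y → s ℤ.* (x ℤ.- y) ≡ s ℤ.* x ℤ.- s ℤ.* y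
    lem = ℤ-Solver.solve-∀

  σ-μ-even : ∀ m → alt m ≡ 1ℤ → σ (μ m) ≗ μ m
  σ-μ-even m even n = trans (σ-μ m n) (cong (λ z → (q^ 0) n ℤ.+ z)
    (trans (cong (λ z → ℤ.- z ℤ.* (q^ m) n) even) (ℤ.-1*i≡-i ((q^ m) n))))

  σ-μ-odd : ∀ m → alt m ≡ -1ℤ → σ (μ m) ≗ π m
  σ-μ-odd m odd n = trans (σ-μ m n) (cong (λ z → (q^ 0) n ℤ.+ z)
    (trans (cong (λ z → ℤ.- z ℤ.* (q^ m) n) odd) (ℤ.*-identityˡ ((q^ m) n))))

  -- d ∣⁺ n: n / d has nonnegative coefficients and constant term 1.
  infix 4 _∣⁺_
  record _∣⁺_ (d n : Series) : Set where
    field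
      quotient : Series
      nonneg   : ∀ k → 0ℤ ℤ.≤ quotient k
      constant : quotient 0 ≡ 1ℤ
      divides  : d ⊛ quotient ≗ n

  *-nonneg : ∀ {x y} → 0ℤ ℤ.≤ x → 0ℤ ℤ.≤ y → 0ℤ ℤ.≤ x ℤ.* y
  *-nonneg {+ m} {+ n} _ _ = subst (0ℤ ℤ.≤_) (ℤ.pos-* m n) (ℤ.+≤+ z≤n)

  ⊛-nonneg : ∀ a b → (∀ k → 0ℤ ℤ.≤ a k) → (∀ k → 0ℤ ℤ.≤ b k) → ∀ n → 0ℤ ℤ.≤ (a ⊛ b) n
  ⊛-nonneg a b 0≤a 0≤b zero    = ℤ.+-mono-≤ {0ℤ} {a 0 ℤ.* b 0} {0ℤ} {0ℤ} (*-nonneg (0≤a 0) (0≤b 0)) ℤ.≤-refl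
  ⊛-nonneg a b 0≤a 0≤b (suc n) = ℤ.+-mono-≤ {0ℤ} {a 0 ℤ.* b (suc n)} {0ℤ} {(tail a ⊛ b) n} (*-nonneg (0≤a 0) (0≤b (suc n)))
    (⊛-nonneg (tail a) b (0≤a ∘ suc) 0≤b n)

  q^-nonneg : ∀ m k → 0ℤ ℤ.≤ (q^ m) k
  q^-nonneg zero    zero    = ℤ.+≤+ z≤n
  q^-nonneg zero    (suc k) = ℤ.≤-refl
  q^-nonneg (suc m) zero    = ℤ.≤-refl
  q^-nonneg (suc m) (suc k) = q^-nonneg m k

  ⊛-constant : ∀ {a b} → a 0 ≡ 1ℤ → b 0 ≡ 1ℤ → (a ⊛ b) 0 ≡ 1ℤ
  ⊛-constant p q = cong₂ (λ x y → x ℤ.* y ℤ.+ 0ℤ) p q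

  ∣⁺-refl : ∀ {a} → a ∣⁺ a
  ∣⁺-refl {a} = record
    { quotient = q^ 0 ; nonneg = q^-nonneg 0 ; constant = refl ; divides = ⊛-identityʳ a }

  1∣⁺ : ∀ {a} → (∀ k → 0ℤ ℤ.≤ a k) → a 0 ≡ 1ℤ → q^ 0 ∣⁺ a
  1∣⁺ {a} 0≤a a₀ = record { quotient = a ; nonneg = 0≤a ; constant = a₀ ; divides = ⊛-identityˡ a }

  ∣⁺-⊛ : ∀ {a b c d} → a ∣⁺ b → c ∣⁺ d → a ⊛ c ∣⁺ b ⊛ d
  ∣⁺-⊛ {a} {b} {c} {d} p q = record
    { quotient = x ⊛ y
    ; nonneg   = ⊛-nonneg x y (nonneg p) (nonneg q)
    ; constant = ⊛-constant {x} {y} (constant p) (constant q)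
    ; divides  = λ n → trans (interchange a c x y n)
                   (⊛-cong {a ⊛ x} {b} {c ⊛ y} {d} (divides p) (divides q) n) }
    where
    open _∣⁺_
    open import Algebra.Properties.CommutativeSemigroup S.*-commutativeSemigroup using (interchange)
    x y : Series
    x = quotient p
    y = quotient q

  ∣⁺-resp : ∀ {a b c d} → a ≗ c → b ≗ d → a ∣⁺ b → c ∣⁺ d
  ∣⁺-resp {a} {b} {c} {d} a≗c b≗d p = record
    { quotient = quotient ; nonneg = nonneg ; constant = constant
    ; divides  = λ n → trans (⊛-cong {c} {a} {quotient} {quotient} (λ k → sym (a≗c k)) (λ _ → refl) n)
                   (trans (divides n) (b≗d n)) }
    where open _∣⁺_ p

  -- The quotients of the factors again form a convergent product: modulo q^(k+1) both factors with
  -- index k are 1, hence so is their quotient.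
  ∏∞-∣⁺ : ∀ {u v} → Admissible u → Admissible v → (∀ k → u k ∣⁺ v k) → ∏∞ u ∣⁺ ∏∞ v
  ∏∞-∣⁺ {u} {v} adm-u adm-v p = record
    { quotient = ∏∞ w
    ; nonneg   = λ n → ∏-nonneg n n
    -- The coefficient of q⁰ in `∏∞` is taken from the empty product.
    ; constant = refl
    ; divides  = λ n → trans (sym (∏∞-⊛ {u} {w} adm-u adm-w n))
                   (∏∞-cong {λ k → u k ⊛ w k} {v} (λ k → divides (p k)) n) }
    where
    open _∣⁺_
    w : ℕ → Series
    w k = quotient (p k)
    adm-w : Admissible w
    adm-w k i i≤k = begin
      w k i               ≡⟨ ⊛-identityˡ (w k) i ⟨
      (q^ 0 ⊛ w k) i      ≡⟨ ⊛-cong-≤ {u k} {q^ 0} {w k} {w k} k (adm-u k) (λ _ _ → refl) i i≤k ⟨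
      (u k ⊛ w k) i       ≡⟨ divides (p k) i ⟩
      v k i               ≡⟨ adm-v k i i≤k ⟩
      (q^ 0) i            ∎
      where open ≡-Reasoning
    ∏-nonneg : ∀ n k → 0ℤ ℤ.≤ (∏[ n ] w) k
    ∏-nonneg zero    = q^-nonneg 0
    ∏-nonneg (suc n) = ⊛-nonneg (∏[ n ] w) (w n) (∏-nonneg n) (nonneg (p n))

  -- The expansion of 1 / (1 - qᵐ): evaluating `q^ 0` at the remainder gives 1 exactly at the
  -- multiples of m.
  geometric : (m : ℕ) .{{_ : NonZero m}} → Series
  geometric m n = (q^ 0) (n % m)

  q^-⊛-below : ∀ m a n → n < m → (q^ m ⊛ a) n ≡ 0ℤ
  q^-⊛-below (suc m) a zero    _         = refl
  q^-⊛-below (suc m) a (suc n) (s≤s n<m) = trans (ℤ.+-identityˡ _) (q^-⊛-below m a n n<m)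

  q^-⊛-shift : ∀ m a n → (q^ m ⊛ a) (m + n) ≡ a n
  q^-⊛-shift zero    a n = ⊛-identityˡ a n
  q^-⊛-shift (suc m) a n = trans (ℤ.+-identityˡ _) (q^-⊛-shift m a n)

  μ-⊛ : ∀ m a → μ m ⊛ a ≗ a ⊝⊝ (q^ m ⊛ a)
  μ-⊛ m a n = begin
    (μ m ⊛ a) n                            ≡⟨ ⊛-cong {μ m} {q^ 0 ⊕ -1ℤ • q^ m} {a} {a} (λ k → cong (λ z → (q^ 0) k ℤ.+ z) (sym (ℤ.-1*i≡-i ((q^ m) k)))) (λ _ → refl) n ⟩
    ((q^ 0 ⊕ -1ℤ • q^ m) ⊛ a) n            ≡⟨ ⊛-distribʳ a (q^ 0) (-1ℤ • q^ m) n ⟩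
    (q^ 0 ⊛ a) n ℤ.+ ((-1ℤ • q^ m) ⊛ a) n  ≡⟨ cong₂ ℤ._+_ (⊛-identityˡ a n) (•-⊛ -1ℤ (q^ m) a n) ⟩
    a n ℤ.+ -1ℤ ℤ.* (q^ m ⊛ a) n           ≡⟨ cong (λ z → a n ℤ.+ z) (ℤ.-1*i≡-i ((q^ m ⊛ a) n)) ⟩
    a n ℤ.- (q^ m ⊛ a) n                   ∎
    where open ≡-Reasoning

  μ⊛geometric : ∀ m .{{_ : NonZero m}} → μ m ⊛ geometric m ≗ q^ 0
  μ⊛geometric m n with n ℕ.<? m
  ... | yes n<m = trans (μ-⊛ m (geometric m) n) (trans
    (cong₂ (λ x y → (q^ 0) x ℤ.- y) (ℕ.m<n⇒m%n≡m n<m) (q^-⊛-below m (geometric m) n n<m)) (ℤ.+-identityʳ _))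
  ... | no  n≮m = trans (μ-⊛ m (geometric m) n) (trans (cancel (n ∸ m) (ℕ.m+[n∸m]≡n (ℕ.≮⇒≥ n≮m)))
    (sym (q^-vanish-0 n (ℕ.<-≤-trans (ℕ.>-nonZero⁻¹ m) (ℕ.≮⇒≥ n≮m)))))
    where
    q^-vanish-0 : ∀ n → 0 < n → (q^ 0) n ≡ 0ℤ
    q^-vanish-0 (suc n) _ = refl
    cancel : ∀ k → m + k ≡ n → (geometric m ⊝⊝ (q^ m ⊛ geometric m)) n ≡ 0ℤ
    cancel k refl = trans (cong₂ (λ x y → (q^ 0) x ℤ.- y)
      (trans (cong (_% m) (ℕ.+-comm m k)) (ℕ.[m+n]%n≡m%n k m)) (q^-⊛-shift m (geometric m) k))
      (ℤ.+-inverseʳ ((q^ 0) (k % m)))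

  μ∣⁺1 : ∀ m .{{_ : NonZero m}} → μ m ∣⁺ q^ 0
  μ∣⁺1 m@(suc _) = record
    { quotient = geometric m
    ; nonneg   = λ k → q^-nonneg 0 (k % m)
    ; constant = refl
    ; divides  = μ⊛geometric m }

  1∣⁺π : ∀ m .{{_ : NonZero m}} → q^ 0 ∣⁺ π m
  1∣⁺π m@(suc _) = 1∣⁺ (λ k → ℤ.+-mono-≤ (q^-nonneg 0 k) (q^-nonneg m k)) refl

  μ∣⁺π : ∀ m .{{_ : NonZero m}} → μ m ∣⁺ π m
  μ∣⁺π m = ∣⁺-resp (⊛-identityʳ (μ m)) (⊛-identityˡ (π m)) (∣⁺-⊛ (μ∣⁺1 m) (1∣⁺π m))

  π⊛μ : ∀ m → π m ⊛ μ m ≗ μ (m + m)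
  π⊛μ m n = begin
    (π m ⊛ μ m) n                                            ≡⟨ ⊛-distribʳ (μ m) (q^ 0) (q^ m) n ⟩
    (q^ 0 ⊛ μ m) n ℤ.+ (q^ m ⊛ μ m) n                        ≡⟨ cong₂ ℤ._+_ (⊛-identityˡ (μ m) n) (trans (⊛-comm (q^ m) (μ m) n) (μ-⊛ m (q^ m) n)) ⟩
    (q^ 0) n ℤ.- (q^ m) n ℤ.+ ((q^ m) n ℤ.- (q^ m ⊛ q^ m) n) ≡⟨ lem ((q^ 0) n) ((q^ m) n) ((q^ m ⊛ q^ m) n) ⟩
    (q^ 0) n ℤ.- (q^ m ⊛ q^ m) n                             ≡⟨ cong (λ z → (q^ 0) n ℤ.- z) (q^-+ m m n) ⟩
    μ (m + m) n                                              ∎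
    where
    open ≡-Reasoning
    lem : ∀ x y z → x ℤ.- y ℤ.+ (y ℤ.- z) ≡ x ℤ.- z
    lem = ℤ-Solver.solve-∀

  -- The reciprocal of 1 + qᵐ alone has alternating signs; together with 1 - qᵐ it becomes 1 / (1 -
  -- q²ᵐ).
  π⊛μ∣⁺1 : ∀ m .{{_ : NonZero m}} → π m ⊛ μ m ∣⁺ q^ 0
  π⊛μ∣⁺1 m@(suc _) = ∣⁺-resp (λ k → sym (π⊛μ m k)) (λ _ → refl) (μ∣⁺1 (m + m))

  μ⊛μ∣⁺1 : ∀ m .{{_ : NonZero m}} → μ m ⊛ μ m ∣⁺ q^ 0
  μ⊛μ∣⁺1 m = ∣⁺-resp (λ _ → refl) (⊛-identityˡ (q^ 0)) (∣⁺-⊛ (μ∣⁺1 m) (μ∣⁺1 m))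

  -- The last summand of the convolution is a n times b 0 = 1, and all others are nonnegative.
  ⊛-positive : ∀ a b → (∀ k → 0ℤ ℤ.< a k) → (∀ k → 0ℤ ℤ.≤ b k) → b 0 ≡ 1ℤ → ∀ n → 0ℤ ℤ.< (a ⊛ b) n
  ⊛-positive a b 0<a 0≤b b₀ n = subst (0ℤ ℤ.<_) (sym (last n)) (ℤ.+-mono-≤-< (init n) (0<a n))
    where
    front : ℕ → ℤ
    front zero    = 0ℤ
    front (suc n) = (a ⊛ tail b) n
    init : ∀ n → 0ℤ ℤ.≤ front n
    init zero    = ℤ.≤-refl
    init (suc n) = ⊛-nonneg a (tail b) (ℤ.<⇒≤ ∘ 0<a) (0≤b ∘ suc) n
    *b₀ : ∀ x → x ℤ.* b 0 ≡ x
    *b₀ x = trans (cong (λ z → x ℤ.* z) b₀) (ℤ.*-identityʳ x)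
    last : ∀ n → (a ⊛ b) n ≡ front n ℤ.+ a n
    last zero    = trans (ℤ.+-identityʳ _) (trans (*b₀ (a 0)) (sym (ℤ.+-identityˡ (a 0))))
    last (suc n) = trans (⊛-last a b n) (cong (λ z → (a ⊛ tail b) n ℤ.+ z) (*b₀ (a (suc n))))

-- Reordering of products in a commutative monoid.

module Rearranging where

  open import Algebra using (CommutativeMonoid)
  import Algebra.Solver.CommutativeMonoid as MonoidSolver

  module Rearrangements {c ℓ} (M : CommutativeMonoid c ℓ) where
    open CommutativeMonoid M
    open MonoidSolver M using (solve; _⊜_; id) renaming (_⊕_ to infixl 7 _⊙_)

    -- For the block of exponents 10 k + i, the letters mᵢ and pᵢ stand for 1 - q^(10k+i) and 1 +
    -- q^(10k+i). The first factor is the block of B at -q, the second that of f₁. The right-hand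
    -- side is grouped so that each group divides the one in the same position of `numerator₀`; each
    -- pᵢ other than p₅ stands next to its mᵢ.
    denominator₀ : ∀ m₁ m₂ m₃ m₄ m₅ m₆ m₇ m₈ m₉ m₁₀ p₁ p₅ p₉ →
      (ε ∙ (m₄ ∙ p₁ ∙ p₅) ∙ (p₉ ∙ m₆ ∙ m₁₀)) ∙
        (ε ∙ m₁ ∙ m₂ ∙ m₃ ∙ m₄ ∙ m₅ ∙ m₆ ∙ m₇ ∙ m₈ ∙ m₉ ∙ m₁₀) ≈
      (p₁ ∙ m₁) ∙ m₂ ∙ m₃ ∙ (m₄ ∙ m₄) ∙ p₅ ∙ m₅ ∙ (m₆ ∙ m₆) ∙ m₇ ∙ m₈ ∙ (p₉ ∙ m₉) ∙ m₁₀ ∙ m₁₀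
    denominator₀ = solve 13 (λ m₁ m₂ m₃ m₄ m₅ m₆ m₇ m₈ m₉ m₁₀ p₁ p₅ p₉ →
      (id ⊙ (m₄ ⊙ p₁ ⊙ p₅) ⊙ (p₉ ⊙ m₆ ⊙ m₁₀)) ⊙
        (id ⊙ m₁ ⊙ m₂ ⊙ m₃ ⊙ m₄ ⊙ m₅ ⊙ m₆ ⊙ m₇ ⊙ m₈ ⊙ m₉ ⊙ m₁₀) ⊜
      (p₁ ⊙ m₁) ⊙ m₂ ⊙ m₃ ⊙ (m₄ ⊙ m₄) ⊙ p₅ ⊙ m₅ ⊙ (m₆ ⊙ m₆) ⊙ m₇ ⊙ m₈ ⊙ (p₉ ⊙ m₉) ⊙ m₁₀ ⊙ m₁₀) refl

    -- The blocks of f₅ and A at -q. Units fill the positions in which the denominator has nothing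
    -- to cancel.
    numerator₀ : ∀ m₂ m₈ m₁₀ p₃ p₅ p₇ →
      (ε ∙ p₅ ∙ m₁₀) ∙ (ε ∙ (p₃ ∙ m₂ ∙ p₅) ∙ (m₈ ∙ p₇ ∙ m₁₀)) ≈
      ε ∙ m₂ ∙ p₃ ∙ ε ∙ p₅ ∙ p₅ ∙ ε ∙ p₇ ∙ m₈ ∙ ε ∙ m₁₀ ∙ m₁₀
    numerator₀ = solve 6 (λ m₂ m₈ m₁₀ p₃ p₅ p₇ →
      (id ⊙ p₅ ⊙ m₁₀) ⊙ (id ⊙ (p₃ ⊙ m₂ ⊙ p₅) ⊙ (m₈ ⊙ p₇ ⊙ m₁₀)) ⊜
      id ⊙ m₂ ⊙ p₃ ⊙ id ⊙ p₅ ⊙ p₅ ⊙ id ⊙ p₇ ⊙ m₈ ⊙ id ⊙ m₁₀ ⊙ m₁₀) refl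

    numerator₁ : ∀ m₁₀ p₅ →
      ε ∙ p₅ ∙ m₁₀ ≈ ε ∙ ε ∙ ε ∙ ε ∙ ε ∙ p₅ ∙ ε ∙ ε ∙ ε ∙ ε ∙ m₁₀
    numerator₁ = solve 2 (λ m₁₀ p₅ →
      id ⊙ p₅ ⊙ m₁₀ ⊜ id ⊙ id ⊙ id ⊙ id ⊙ id ⊙ p₅ ⊙ id ⊙ id ⊙ id ⊙ id ⊙ m₁₀) refl

    denominator₂ : ∀ m₁ m₂ m₃ m₄ m₅ m₆ m₇ m₈ m₉ m₁₀ p₃ p₅ p₇ →
      (ε ∙ (p₃ ∙ m₂ ∙ p₅) ∙ (m₈ ∙ p₇ ∙ m₁₀)) ∙
        (ε ∙ m₁ ∙ m₂ ∙ m₃ ∙ m₄ ∙ m₅ ∙ m₆ ∙ m₇ ∙ m₈ ∙ m₉ ∙ m₁₀) ≈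
      m₁ ∙ (m₂ ∙ m₂) ∙ (p₃ ∙ m₃) ∙ m₄ ∙ p₅ ∙ m₅ ∙ m₆ ∙ (p₇ ∙ m₇) ∙ (m₈ ∙ m₈) ∙ m₉ ∙ m₁₀ ∙ m₁₀
    denominator₂ = solve 13 (λ m₁ m₂ m₃ m₄ m₅ m₆ m₇ m₈ m₉ m₁₀ p₃ p₅ p₇ →
      (id ⊙ (p₃ ⊙ m₂ ⊙ p₅) ⊙ (m₈ ⊙ p₇ ⊙ m₁₀)) ⊙
        (id ⊙ m₁ ⊙ m₂ ⊙ m₃ ⊙ m₄ ⊙ m₅ ⊙ m₆ ⊙ m₇ ⊙ m₈ ⊙ m₉ ⊙ m₁₀) ⊜
      m₁ ⊙ (m₂ ⊙ m₂) ⊙ (p₃ ⊙ m₃) ⊙ m₄ ⊙ p₅ ⊙ m₅ ⊙ m₆ ⊙ (p₇ ⊙ m₇) ⊙ (m₈ ⊙ m₈) ⊙ m₉ ⊙ m₁₀ ⊙ m₁₀) refl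

    numerator₂ : ∀ m₄ m₆ m₁₀ p₁ p₅ p₉ →
      (ε ∙ p₅ ∙ m₁₀) ∙ (ε ∙ (p₁ ∙ m₄ ∙ p₅) ∙ (m₆ ∙ p₉ ∙ m₁₀)) ≈
      p₁ ∙ ε ∙ ε ∙ m₄ ∙ p₅ ∙ p₅ ∙ m₆ ∙ ε ∙ ε ∙ p₉ ∙ m₁₀ ∙ m₁₀
    numerator₂ = solve 6 (λ m₄ m₆ m₁₀ p₁ p₅ p₉ →
      (id ⊙ p₅ ⊙ m₁₀) ⊙ (id ⊙ (p₁ ⊙ m₄ ⊙ p₅) ⊙ (m₆ ⊙ p₉ ⊙ m₁₀)) ⊜
      p₁ ⊙ id ⊙ id ⊙ m₄ ⊙ p₅ ⊙ p₅ ⊙ m₆ ⊙ id ⊙ id ⊙ p₉ ⊙ m₁₀ ⊙ m₁₀) refl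

    -- In one block, f₁ is m₁ m₂, f₄ is n₄, and f₂ is m₂ or, taken two factors at a
    -- time, n₂ n₄.
    eulerBlock : ∀ m₁ m₂ p₁ n₂ n₄ → p₁ ∙ m₁ ≈ n₂ →
      (ε ∙ p₁ ∙ m₂) ∙ ((ε ∙ m₁ ∙ m₂) ∙ n₄) ≈ m₂ ∙ (m₂ ∙ (ε ∙ n₂ ∙ n₄))
    eulerBlock m₁ m₂ p₁ n₂ n₄ p = trans (solve 4 (λ m₁ m₂ p₁ n₄ →
        (id ⊙ p₁ ⊙ m₂) ⊙ ((id ⊙ m₁ ⊙ m₂) ⊙ n₄) ⊜ m₂ ⊙ (m₂ ⊙ (id ⊙ (p₁ ⊙ m₁) ⊙ n₄))) refl m₁ m₂ p₁ n₄)
      (∙-congˡ (∙-congˡ (∙-congʳ (∙-congˡ p))))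

    -- Both hypotheses have the value c³, for s = f₁(-q), a = f₁, b = f₄, c = f₂ and v = f₅. The
    -- trailing units are those produced by unfolding the powers `v ↑ 2` and `c ↑ 3`.
    eulerQuotient : ∀ s a b c v x → s ∙ (a ∙ b) ≈ c ∙ (c ∙ c) → (a ∙ b ∙ (v ∙ (v ∙ ε))) ∙ x ≈ c ∙ (c ∙ (c ∙ ε)) →
      (a ∙ b) ∙ (v ∙ (v ∙ x)) ≈ (a ∙ b) ∙ s
    eulerQuotient s a b c v x p q = trans
      (solve 4 (λ a b v x → (a ⊙ b) ⊙ (v ⊙ (v ⊙ x)) ⊜ (a ⊙ b ⊙ (v ⊙ (v ⊙ id))) ⊙ x) refl a b v x)
      (trans q (trans (∙-congˡ (∙-congˡ (identityʳ c))) (trans (sym p) (comm s (a ∙ b)))))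

-- A criterion for positive coefficients, and product formulas for fⱼ.

module EulerProducts where

  open import Defs renaming (_⊖_ to _⊝⊝_)
  open FormalSeries
  open InfiniteProducts
  open TripleProduct
  open NonnegativeQuotients
  open Rearranging
  open import Data.Integer as ℤ using (ℤ; 0ℤ; 1ℤ; -1ℤ; +_)
  import Data.Integer.Properties as ℤ
  open import Data.Nat as ℕ using (ℕ; zero; suc; _+_; _*_; z≤n; s≤s; NonZero)
  import Data.Nat.Properties as ℕ
  open import Data.Nat.DivMod using (n%1≡0)
  import Data.Nat.Tactic.RingSolver as ℕ-Solver
  open import Function using (_∘_)
  open import Relation.Binary.PropositionalEquality

  open Rearrangements S.*-commutativeMonoid

  module Positivity
    (F R : Series) (F≗ : F ≗ μ 1 ⊛ R) (R∣⁺1 : R ∣⁺ q^ 0) where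

    open import Algebra.Properties.CommutativeSemigroup S.*-commutativeSemigroup using (interchange)
    open _∣⁺_

    F-0 : F 0 ≡ 1ℤ
    F-0 = trans (F≗ 0) (⊛-constant {μ 1} {R} refl (trans (sym lem) (divides R∣⁺1 0)))
      where
      lem : (R ⊛ quotient R∣⁺1) 0 ≡ R 0
      lem = trans (ℤ.+-identityʳ _) (trans (cong (λ z → R 0 ℤ.* z) (constant R∣⁺1)) (ℤ.*-identityʳ (R 0)))

    -- Here X = C / F, and 1 / F is 1 / (1 - q) times 1 / R. All coefficients of 1 / (1 - q) are 1;
    -- the rest, C / R, is nonnegative with constant term 1, so strict positivity survives the
    -- product.
    positive : ∀ X C → (∀ n → 0ℤ ℤ.≤ C n) → C 0 ≡ 1ℤ → F ⊛ X ≗ C → ∀ n → 0ℤ ℤ.< X n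
    positive X C 0≤C C₀ FX≗C n = subst (0ℤ ℤ.<_) (sym (X≗ n))
      (⊛-positive (geometric 1) (D ⊛ C) (λ k → subst (λ z → 0ℤ ℤ.< (q^ 0) z) (sym (n%1≡0 k)) (ℤ.+<+ (s≤s z≤n)))
        (⊛-nonneg D C (nonneg R∣⁺1) 0≤C) (⊛-constant {D} {C} (constant R∣⁺1) C₀) n)
      where
      D : Series
      D = quotient R∣⁺1
      inverse : F ⊛ (geometric 1 ⊛ D) ≗ q^ 0
      inverse k = begin
        (F ⊛ (geometric 1 ⊛ D)) k          ≡⟨ ⊛-cong {F} {μ 1 ⊛ R} {geometric 1 ⊛ D} {geometric 1 ⊛ D} F≗ (λ _ → refl) k ⟩
        ((μ 1 ⊛ R) ⊛ (geometric 1 ⊛ D)) k  ≡⟨ interchange (μ 1) R (geometric 1) D k ⟩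
        ((μ 1 ⊛ geometric 1) ⊛ (R ⊛ D)) k  ≡⟨ ⊛-cong {μ 1 ⊛ geometric 1} {q^ 0} {R ⊛ D} {q^ 0} (μ⊛geometric 1) (divides R∣⁺1) k ⟩
        (q^ 0 ⊛ q^ 0) k                    ≡⟨ ⊛-identityˡ (q^ 0) k ⟩
        (q^ 0) k                           ∎
        where open ≡-Reasoning
      X≗ : X ≗ geometric 1 ⊛ (D ⊛ C)
      X≗ = ⊛-cancelˡ F F-0 λ k → begin
        (F ⊛ X) k                          ≡⟨ FX≗C k ⟩
        C k                                ≡⟨ ⊛-identityˡ C k ⟨
        (q^ 0 ⊛ C) k                       ≡⟨ ⊛-cong {F ⊛ (geometric 1 ⊛ D)} {q^ 0} {C} {C} inverse (λ _ → refl) k ⟨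
        ((F ⊛ (geometric 1 ⊛ D)) ⊛ C) k    ≡⟨ ⊛-assoc F (geometric 1 ⊛ D) C k ⟩
        (F ⊛ ((geometric 1 ⊛ D) ⊛ C)) k    ≡⟨ ⊛-cong {F} {F} {(geometric 1 ⊛ D) ⊛ C} {geometric 1 ⊛ (D ⊛ C)} (λ _ → refl) (⊛-assoc (geometric 1) D C) k ⟩
        (F ⊛ (geometric 1 ⊛ (D ⊛ C))) k    ∎
        where open ≡-Reasoning

    positive₁ : ∀ X P → F ⊛ (F ⊛ X) ≗ P → F ∣⁺ P → ∀ n → 0ℤ ℤ.< X n
    positive₁ X P FFX≗P F∣⁺P = positive X (quotient F∣⁺P) (nonneg F∣⁺P) (constant F∣⁺P)
      (⊛-cancelˡ F F-0 λ k → trans (FFX≗P k) (sym (divides F∣⁺P k)))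

    -- With M E = P N taken at -q, the product F X is σ P σ N / (σ M F), which is nonnegative by the
    -- last hypothesis. One F is spent there, the other in `positive`.
    positive₂ : ∀ X E M P N → F ⊛ (F ⊛ X) ≗ σ E → M ⊛ E ≗ P ⊛ N → M 0 ≡ 1ℤ →
                σ M ⊛ F ∣⁺ σ P ⊛ σ N → ∀ n → 0ℤ ℤ.< X n
    positive₂ X E M P N FFX≗σE ME≗PN M₀ d = positive X (quotient d) (nonneg d) (constant d)
      (⊛-cancelˡ (σ M ⊛ F) (⊛-constant {σ M} {F} (trans (ℤ.*-identityˡ (M 0)) M₀) F-0) λ k → begin
        ((σ M ⊛ F) ⊛ (F ⊛ X)) k    ≡⟨ ⊛-assoc (σ M) F (F ⊛ X) k ⟩
        (σ M ⊛ (F ⊛ (F ⊛ X))) k    ≡⟨ ⊛-cong {σ M} {σ M} {F ⊛ (F ⊛ X)} {σ E} (λ _ → refl) FFX≗σE k ⟩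
        (σ M ⊛ σ E) k              ≡⟨ σ-⊛ M E k ⟨
        σ (M ⊛ E) k                ≡⟨ σ-cong {M ⊛ E} {P ⊛ N} ME≗PN k ⟩
        σ (P ⊛ N) k                ≡⟨ σ-⊛ P N k ⟩
        (σ P ⊛ σ N) k              ≡⟨ divides d k ⟨
        ((σ M ⊛ F) ⊛ quotient d) k ∎)
      where open ≡-Reasoning

  eulerFactor : ℕ → ℕ → Series
  eulerFactor j k = μ (j * suc k)

  eulerFactor-admissible : ∀ j .{{_ : NonZero j}} → Admissible (eulerFactor j)
  eulerFactor-admissible j k = 1-q^-≈1 (ℕ.m≤n*m (suc k) j)

  f≗∏∞ : ∀ j .{{_ : NonZero j}} → f j ≗ ∏∞ (eulerFactor j)
  f≗∏∞ j n = go n n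
    where
    go : ∀ N → ∏1-q^ j N ≗ ∏[ N ] (eulerFactor j)
    go zero    k = refl
    go (suc N) k = ⊛-cong {∏1-q^ j N} {∏[ N ] (eulerFactor j)} {μ (j * suc N)} {μ (j * suc N)} (go N) (λ _ → refl) k

  blocks : ℕ → (ℕ → Series) → ℕ → Series
  blocks b u k = ∏[ b ] (λ i → u (k * b + i))

  ∏-≈1 : ∀ b {u : ℕ → Series} {n} → (∀ i → u i ≈[ n ] q^ 0) → ∏[ b ] u ≈[ n ] q^ 0
  ∏-≈1 zero    p k k≤n = refl
  ∏-≈1 (suc b) {u} {n} p = ⊛-≈1 {∏[ b ] u} {u b} n (∏-≈1 b p) (p b)

  blocks-admissible : ∀ b .{{_ : NonZero b}} {u} → Admissible u → Admissible (blocks b u)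
  blocks-admissible b {u} adm k = ∏-≈1 b (λ i →
    ≈-weaken {u (k * b + i)} (ℕ.≤-trans (ℕ.m≤m*n k b) (ℕ.m≤m+n (k * b) i)) (adm (k * b + i)))

  ⊛-admissible : ∀ {u v} → Admissible u → Admissible v → Admissible (λ k → u k ⊛ v k)
  ⊛-admissible {u} {v} p q k = ⊛-≈1 {u k} {v k} k (p k) (q k)

  μ-cong : ∀ {m n} → m ≡ n → μ m ≗ μ n
  μ-cong refl _ = refl

  -- Three consecutive factors of fⱼ form one factor of (qʲ, q²ʲ, q³ʲ; q³ʲ)_∞. Together with the
  -- triple product this is Euler's pentagonal number theorem at qʲ.
  f≗triple : ∀ j .{{_ : NonZero j}} → f j ≗ ∏∞ (tripleFactor j (j + j))
  f≗triple j n = trans (f≗∏∞ j n) (trans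
    (∏∞-blocks 3 {eulerFactor j} (eulerFactor-admissible j) n)
    (∏∞-cong {blocks 3 (eulerFactor j)} {tripleFactor j (j + j)} block n))
    where
    exponent₀ : ∀ j k → j * suc (k * 3 + 0) ≡ j + (j + (j + j)) * k
    exponent₀ = ℕ-Solver.solve-∀
    exponent₁ : ∀ j k → j * suc (k * 3 + 1) ≡ j + j + (j + (j + j)) * k
    exponent₁ = ℕ-Solver.solve-∀
    exponent₂ : ∀ j k → j * suc (k * 3 + 2) ≡ (j + (j + j)) * suc k
    exponent₂ = ℕ-Solver.solve-∀
    block : ∀ k → blocks 3 (eulerFactor j) k ≗ tripleFactor j (j + j) k
    block k = ⊛-cong {q^ 0 ⊛ u 0 ⊛ u 1} {v₀ ⊛ v₁} {u 2} {v₂}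
      (⊛-cong {q^ 0 ⊛ u 0} {v₀} {u 1} {v₁}
        (λ i → trans (⊛-identityˡ (u 0) i) (μ-cong (exponent₀ j k) i)) (μ-cong (exponent₁ j k)))
      (μ-cong (exponent₂ j k))
      where
      u : ℕ → Series
      u i = eulerFactor j (k * 3 + i)
      v₀ v₁ v₂ : Series
      v₀ = μ (j + (j + (j + j)) * k)
      v₁ = μ (j + j + (j + (j + j)) * k)
      v₂ = μ ((j + (j + j)) * suc k)

  σ-μ≗μ : ∀ {m n} → m ≡ n → alt n ≡ 1ℤ → σ (μ m) ≗ μ n
  σ-μ≗μ {m} refl = σ-μ-even m

  σ-μ≗π : ∀ {m n} → m ≡ n → alt n ≡ -1ℤ → σ (μ m) ≗ π n
  σ-μ≗π {m} refl = σ-μ-odd m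

  alt-period : ∀ b → alt b ≡ 1ℤ → ∀ k i → alt (k * b + i) ≡ alt i
  alt-period b b-even zero    i = refl
  alt-period b b-even (suc k) i = begin
    alt (b + k * b + i)           ≡⟨ cong alt (ℕ.+-assoc b (k * b) i) ⟩
    alt (b + (k * b + i))         ≡⟨ alt-+ b (k * b + i) ⟩
    alt b ℤ.* alt (k * b + i)     ≡⟨ cong₂ ℤ._*_ b-even (alt-period b b-even k i) ⟩
    1ℤ ℤ.* alt i                  ≡⟨ ℤ.*-identityˡ (alt i) ⟩
    alt i                         ∎
    where open ≡-Reasoning

  -- The even exponents of f₁(-q) and f₁ give f₂ twice. At an odd exponent o the two factors
  -- multiply to 1 - q^(2o), and the numbers 2 o together with the multiples of 4 are all even
  -- numbers, which is the third f₂.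
  σf₁⊛f₁⊛f₄ : σ (f 1) ⊛ (f 1 ⊛ f 4) ≗ f 2 ⊛ (f 2 ⊛ f 2)
  σf₁⊛f₁⊛f₄ n = begin
    (σ (f 1) ⊛ (f 1 ⊛ f 4)) n
      ≡⟨ ⊛-cong {σ (f 1)} {∏∞ (blocks 2 σf₁)} {f 1 ⊛ f 4} {∏∞ (blocks 2 f₁) ⊛ ∏∞ f₄} σf₁≗
           (⊛-cong {f 1} {∏∞ (blocks 2 f₁)} {f 4} {∏∞ f₄} f₁≗ (f≗∏∞ 4)) n ⟩
    (∏∞ (blocks 2 σf₁) ⊛ (∏∞ (blocks 2 f₁) ⊛ ∏∞ f₄)) n
      ≡⟨ ∏∞-⊛³ {blocks 2 σf₁} {blocks 2 f₁} {f₄} (blocks-admissible 2 {σf₁} adm-σf₁) (blocks-admissible 2 {f₁} adm-f₁) adm-f₄ n ⟨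
    ∏∞ (λ k → blocks 2 σf₁ k ⊛ (blocks 2 f₁ k ⊛ f₄ k)) n
      ≡⟨ ∏∞-cong {λ k → blocks 2 σf₁ k ⊛ (blocks 2 f₁ k ⊛ f₄ k)} {λ k → f₂ k ⊛ (f₂ k ⊛ blocks 2 f₂ k)} block n ⟩
    ∏∞ (λ k → f₂ k ⊛ (f₂ k ⊛ blocks 2 f₂ k)) n
      ≡⟨ ∏∞-⊛³ {f₂} {f₂} {blocks 2 f₂} adm-f₂ adm-f₂ (blocks-admissible 2 {f₂} adm-f₂) n ⟩
    (∏∞ f₂ ⊛ (∏∞ f₂ ⊛ ∏∞ (blocks 2 f₂))) n
      ≡⟨ ⊛-cong {f 2} {∏∞ f₂} {f 2 ⊛ f 2} {∏∞ f₂ ⊛ ∏∞ (blocks 2 f₂)} (f≗∏∞ 2)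
           (⊛-cong {f 2} {∏∞ f₂} {f 2} {∏∞ (blocks 2 f₂)} (f≗∏∞ 2) f₂≗) n ⟨
    (f 2 ⊛ (f 2 ⊛ f 2)) n ∎
    where
    open ≡-Reasoning
    f₁ f₂ f₄ σf₁ : ℕ → Series
    f₁ = eulerFactor 1
    f₂ = eulerFactor 2
    f₄ = eulerFactor 4
    σf₁ = σ ∘ f₁
    adm-f₁ : Admissible f₁
    adm-f₁ = eulerFactor-admissible 1
    adm-f₂ : Admissible f₂
    adm-f₂ = eulerFactor-admissible 2
    adm-f₄ : Admissible f₄
    adm-f₄ = eulerFactor-admissible 4
    adm-σf₁ : Admissible σf₁
    adm-σf₁ = σ-admissible {f₁} adm-f₁
    f₁≗ : f 1 ≗ ∏∞ (blocks 2 f₁)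
    f₁≗ k = trans (f≗∏∞ 1 k) (∏∞-blocks 2 {f₁} adm-f₁ k)
    f₂≗ : f 2 ≗ ∏∞ (blocks 2 f₂)
    f₂≗ k = trans (f≗∏∞ 2 k) (∏∞-blocks 2 {f₂} adm-f₂ k)
    σf₁≗ : σ (f 1) ≗ ∏∞ (blocks 2 σf₁)
    σf₁≗ k = trans (σ-cong {f 1} {∏∞ f₁} (f≗∏∞ 1) k) (trans (σ-∏∞ f₁ k) (∏∞-blocks 2 {σf₁} adm-σf₁ k))
    ∏∞-⊛³ : ∀ {u v w} → Admissible u → Admissible v → Admissible w →
            ∏∞ (λ k → u k ⊛ (v k ⊛ w k)) ≗ ∏∞ u ⊛ (∏∞ v ⊛ ∏∞ w)
    ∏∞-⊛³ {u} {v} {w} p q r k = trans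
      (∏∞-⊛ {u} {λ k → v k ⊛ w k} p (⊛-admissible {v} {w} q r) k)
      (⊛-cong {∏∞ u} {∏∞ u} {∏∞ (λ k → v k ⊛ w k)} {∏∞ v ⊛ ∏∞ w} (λ _ → refl) (∏∞-⊛ {v} {w} q r) k)
    block : ∀ k → blocks 2 σf₁ k ⊛ (blocks 2 f₁ k ⊛ f₄ k) ≗ f₂ k ⊛ (f₂ k ⊛ blocks 2 f₂ k)
    block k n = begin
      (blocks 2 σf₁ k ⊛ (blocks 2 f₁ k ⊛ f₄ k)) n
        ≡⟨ ⊛-cong {blocks 2 σf₁ k} {q^ 0 ⊛ p₁ ⊛ m₂} {blocks 2 f₁ k ⊛ f₄ k} {q^ 0 ⊛ m₁ ⊛ m₂ ⊛ f₄ k}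
             (⊛-cong {q^ 0 ⊛ σf₁ (k * 2 + 0)} {q^ 0 ⊛ p₁} {σf₁ (k * 2 + 1)} {m₂}
               (⊛-cong {q^ 0} {q^ 0} {σf₁ (k * 2 + 0)} {p₁} (λ _ → refl) (σ-μ≗π (e₁ k) (alt-period 2 refl k 1)))
               (σ-μ≗μ (e₂ k) (alt-period 2 refl k 2)))
             (⊛-cong {blocks 2 f₁ k} {q^ 0 ⊛ m₁ ⊛ m₂} {f₄ k} {f₄ k}
               (⊛-cong {q^ 0 ⊛ f₁ (k * 2 + 0)} {q^ 0 ⊛ m₁} {f₁ (k * 2 + 1)} {m₂}
                 (⊛-cong {q^ 0} {q^ 0} {f₁ (k * 2 + 0)} {m₁} (λ _ → refl) (μ-cong (e₁ k))) (μ-cong (e₂ k)))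
               (λ _ → refl)) n ⟩
      (q^ 0 ⊛ p₁ ⊛ m₂ ⊛ (q^ 0 ⊛ m₁ ⊛ m₂ ⊛ f₄ k)) n
        ≡⟨ eulerBlock m₁ m₂ p₁ n₂ (f₄ k) (π⊛μ (k * 2 + 1)) n ⟩
      (m₂ ⊛ (m₂ ⊛ (q^ 0 ⊛ n₂ ⊛ f₄ k))) n
        ≡⟨ ⊛-cong {m₂} {f₂ k} {m₂ ⊛ (q^ 0 ⊛ n₂ ⊛ f₄ k)} {f₂ k ⊛ blocks 2 f₂ k} (μ-cong (e₃ k))
             (⊛-cong {m₂} {f₂ k} {q^ 0 ⊛ n₂ ⊛ f₄ k} {blocks 2 f₂ k} (μ-cong (e₃ k))
               (⊛-cong {q^ 0 ⊛ n₂} {q^ 0 ⊛ f₂ (k * 2 + 0)} {f₄ k} {f₂ (k * 2 + 1)}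
                 (⊛-cong {q^ 0} {q^ 0} {n₂} {f₂ (k * 2 + 0)} (λ _ → refl) (μ-cong (e₄ k))) (μ-cong (e₅ k)))) n ⟩
      (f₂ k ⊛ (f₂ k ⊛ blocks 2 f₂ k)) n ∎
      where
      m₁ m₂ p₁ n₂ : Series
      m₁ = μ (k * 2 + 1)
      m₂ = μ (k * 2 + 2)
      p₁ = π (k * 2 + 1)
      n₂ = μ (k * 2 + 1 + (k * 2 + 1))
      e₁ : ∀ k → 1 * suc (k * 2 + 0) ≡ k * 2 + 1
      e₁ = ℕ-Solver.solve-∀
      e₂ : ∀ k → 1 * suc (k * 2 + 1) ≡ k * 2 + 2
      e₂ = ℕ-Solver.solve-∀
      e₃ : ∀ k → k * 2 + 2 ≡ 2 * suc k
      e₃ = ℕ-Solver.solve-∀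
      e₄ : ∀ k → k * 2 + 1 + (k * 2 + 1) ≡ 2 * suc (k * 2 + 0)
      e₄ = ℕ-Solver.solve-∀
      e₅ : ∀ k → 4 * suc k ≡ 2 * suc (k * 2 + 1)
      e₅ = ℕ-Solver.solve-∀

-- Comparison of the products in blocks of ten exponents.

module Blocks where

  open import Defs
  open FormalSeries
  open InfiniteProducts
  open TripleProduct
  open NonnegativeQuotients
  open Rearranging
  open EulerProducts
  open import Algebra using (CommutativeMonoid)
  open import Level using (0ℓ)
  open import Data.Integer as ℤ using (1ℤ; -1ℤ)
  open import Data.Nat using (ℕ; zero; suc; _+_; _*_; NonZero)
  import Data.Nat as ℕ
  import Data.Nat.Properties as ℕ
  import Data.Nat.Tactic.RingSolver as ℕ-Solver
  open import Data.Product using (_,_)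
  open import Function using (_∘_)
  open import Relation.Binary.PropositionalEquality

  σTriple : ℕ → ℕ → ℕ → Series
  σTriple s s′ = σ ∘ tripleFactor s s′

  σEuler : ℕ → ℕ → Series
  σEuler j = σ ∘ eulerFactor j

  -- A copy of _⊛_ that does not unfold: comparing long products coefficient by
  -- coefficient is infeasible.
  infixl 7 _⊡_
  opaque
    _⊡_ : Series → Series → Series
    _⊡_ = _⊛_

    ⊛≗⊡ : ∀ a b → a ⊛ b ≗ a ⊡ b
    ⊛≗⊡ a b n = refl

    ⊡-cong : ∀ {a b c d} → a ≗ b → c ≗ d → a ⊡ c ≗ b ⊡ d
    ⊡-cong = ⊛-cong

    ⊡-assoc : ∀ a b c → (a ⊡ b) ⊡ c ≗ a ⊡ (b ⊡ c)
    ⊡-assoc = ⊛-assoc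

    ⊡-identityˡ : ∀ a → q^ 0 ⊡ a ≗ a
    ⊡-identityˡ = ⊛-identityˡ

    ⊡-identityʳ : ∀ a → a ⊡ q^ 0 ≗ a
    ⊡-identityʳ = ⊛-identityʳ

    ⊡-comm : ∀ a b → a ⊡ b ≗ b ⊡ a
    ⊡-comm = ⊛-comm

    ∣⁺-⊡ : ∀ {a b c d} → a ∣⁺ b → c ∣⁺ d → a ⊡ c ∣⁺ b ⊡ d
    ∣⁺-⊡ = ∣⁺-⊛

  ⊡-commutativeMonoid : CommutativeMonoid 0ℓ 0ℓ
  ⊡-commutativeMonoid = record
    { Carrier = Series ; _≈_ = _≗_ ; _∙_ = _⊡_ ; ε = q^ 0
    ; isCommutativeMonoid = record
      { isMonoid = record
        { isSemigroup = record
          { isMagma = record { isEquivalence = S.isEquivalence ; ∙-cong = ⊡-cong }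
          ; assoc = ⊡-assoc }
        ; identity = ⊡-identityˡ , ⊡-identityʳ }
      ; comm = ⊡-comm } }

  open Rearrangements ⊡-commutativeMonoid

  ⊛≗⊡-cong : ∀ {a b c d} → a ≗ c → b ≗ d → a ⊛ b ≗ c ⊡ d
  ⊛≗⊡-cong {a} {b} p q n = trans (⊛≗⊡ a b n) (⊡-cong p q n)

  ∏⊡[_] : ℕ → (ℕ → Series) → Series
  ∏⊡[ zero ]  u = q^ 0
  ∏⊡[ suc n ] u = ∏⊡[ n ] u ⊡ u n

  ∏≗∏⊡ : ∀ {u v : ℕ → Series} → (∀ k → u k ≗ v k) → ∀ n → ∏[ n ] u ≗ ∏⊡[ n ] v
  ∏≗∏⊡ p zero    = λ _ → refl
  ∏≗∏⊡ {u} p (suc n) = ⊛≗⊡-cong {∏[ n ] u} {u n} (∏≗∏⊡ p n) (p n)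

  blocks≗∏⊡ : ∀ b (u : ℕ → Series) k v → (∀ i → u (k * b + i) ≗ v i) → blocks b u k ≗ ∏⊡[ b ] v
  blocks≗∏⊡ b u k v p = ∏≗∏⊡ {λ i → u (k * b + i)} {v} p b

  block² : ∀ (u : ℕ → Series) k x y → u (k * 2 + 0) ≗ x → u (k * 2 + 1) ≗ y → blocks 2 u k ≗ q^ 0 ⊡ x ⊡ y
  block² u k x y p q = ⊛≗⊡-cong {q^ 0 ⊛ u (k * 2 + 0)} {u (k * 2 + 1)} {q^ 0 ⊡ x} {y}
    (⊛≗⊡-cong {q^ 0} {u (k * 2 + 0)} {q^ 0} {x} (λ _ → refl) p) q

  σ-⊛≗⊡ : ∀ a b c d → σ a ≗ c → σ b ≗ d → σ (a ⊛ b) ≗ c ⊡ d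
  σ-⊛≗⊡ a b c d p q n = trans (σ-⊛ a b n) (⊛≗⊡-cong {σ a} {σ b} {c} {d} p q n)

  -- Period 10 is common to the triples, which repeat modulo 5, and to the parity of the exponent,
  -- which decides whether σ keeps 1 - qᵐ or changes it to 1 + qᵐ.
  module Block (k : ℕ) where

    m p : ℕ → Series
    m i = μ (k * 10 + i)
    p i = π (k * 10 + i)

    even : ∀ {n} i → n ≡ k * 10 + i → alt i ≡ 1ℤ → σ (μ n) ≗ m i
    even {n} i n≡ i-even = (σ-μ≗μ n≡ (trans (alt-period 10 refl k i) i-even))

    odd : ∀ {n} i → n ≡ k * 10 + i → alt i ≡ -1ℤ → σ (μ n) ≗ p i
    odd {n} i n≡ i-odd = (σ-μ≗π n≡ (trans (alt-period 10 refl k i) i-odd))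

    f₁-block : blocks 10 (eulerFactor 1) k ≗ ∏⊡[ 10 ] (λ i → m (suc i))
    f₁-block = blocks≗∏⊡ 10 (eulerFactor 1) k (λ i → m (suc i))
      (λ i → μ-cong (trans (ℕ.*-identityˡ (suc (k * 10 + i))) (sym (ℕ.+-suc (k * 10) i))))

    private
      e₅ : ∀ k → 5 * suc (k * 2 + 0) ≡ k * 10 + 5
      e₅ = ℕ-Solver.solve-∀
      e₁₀ : ∀ k → 5 * suc (k * 2 + 1) ≡ k * 10 + 10
      e₁₀ = ℕ-Solver.solve-∀
      e₁ : ∀ k → 1 + 5 * (k * 2 + 0) ≡ k * 10 + 1
      e₁ = ℕ-Solver.solve-∀
      e₂ : ∀ k → 2 + 5 * (k * 2 + 0) ≡ k * 10 + 2
      e₂ = ℕ-Solver.solve-∀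
      e₃ : ∀ k → 3 + 5 * (k * 2 + 0) ≡ k * 10 + 3
      e₃ = ℕ-Solver.solve-∀
      e₄ : ∀ k → 4 + 5 * (k * 2 + 0) ≡ k * 10 + 4
      e₄ = ℕ-Solver.solve-∀
      e₆ : ∀ k → 1 + 5 * (k * 2 + 1) ≡ k * 10 + 6
      e₆ = ℕ-Solver.solve-∀
      e₇ : ∀ k → 2 + 5 * (k * 2 + 1) ≡ k * 10 + 7
      e₇ = ℕ-Solver.solve-∀
      e₈ : ∀ k → 3 + 5 * (k * 2 + 1) ≡ k * 10 + 8
      e₈ = ℕ-Solver.solve-∀
      e₉ : ∀ k → 4 + 5 * (k * 2 + 1) ≡ k * 10 + 9
      e₉ = ℕ-Solver.solve-∀

    σf₅-block : blocks 2 (σEuler 5) k ≗ q^ 0 ⊡ p 5 ⊡ m 10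
    σf₅-block = block² (σEuler 5) k (p 5) (m 10)
      (odd {5 * suc (k * 2 + 0)} 5 (e₅ k) refl) (even {5 * suc (k * 2 + 1)} 10 (e₁₀ k) refl)

    -- The exponents are stated with 5 in place of s + s′, so that both kinds of
    -- triples share e₁, … , e₁₀.
    σTriple-block : ∀ s s′ → s + s′ ≡ 5 → ∀ a₀ b₀ c₀ a₁ b₁ c₁ →
      σ (μ (s + 5 * (k * 2 + 0))) ≗ a₀ → σ (μ (s′ + 5 * (k * 2 + 0))) ≗ b₀ → σ (μ (5 * suc (k * 2 + 0))) ≗ c₀ →
      σ (μ (s + 5 * (k * 2 + 1))) ≗ a₁ → σ (μ (s′ + 5 * (k * 2 + 1))) ≗ b₁ → σ (μ (5 * suc (k * 2 + 1))) ≗ c₁ →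
      blocks 2 (σTriple s s′) k ≗ q^ 0 ⊡ (a₀ ⊡ b₀ ⊡ c₀) ⊡ (a₁ ⊡ b₁ ⊡ c₁)
    σTriple-block s s′ eq a₀ b₀ c₀ a₁ b₁ c₁ α₀ β₀ γ₀ α₁ β₁ γ₁ = block² (σTriple s s′) k (a₀ ⊡ b₀ ⊡ c₀) (a₁ ⊡ b₁ ⊡ c₁)
      (triple (k * 2 + 0) a₀ b₀ c₀ α₀ β₀ γ₀) (triple (k * 2 + 1) a₁ b₁ c₁ α₁ β₁ γ₁)
      where
      triple : ∀ j a b c → σ (μ (s + 5 * j)) ≗ a → σ (μ (s′ + 5 * j)) ≗ b → σ (μ (5 * suc j)) ≗ c →
               σ (tripleFactor s s′ j) ≗ a ⊡ b ⊡ c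
      triple j a b c α β γ = σ-⊛≗⊡ (μ (s + (s + s′) * j) ⊛ μ (s′ + (s + s′) * j)) (μ ((s + s′) * suc j)) (a ⊡ b) c
        (σ-⊛≗⊡ (μ (s + (s + s′) * j)) (μ (s′ + (s + s′) * j)) a b
        (subst (λ z → σ (μ (s + z * j)) ≗ a) (sym eq) α)
        (subst (λ z → σ (μ (s′ + z * j)) ≗ b) (sym eq) β))
        (subst (λ z → σ (μ (z * suc j)) ≗ c) (sym eq) γ)

    σT₄₁-block : blocks 2 (σTriple 4 1) k ≗ q^ 0 ⊡ (m 4 ⊡ p 1 ⊡ p 5) ⊡ (p 9 ⊡ m 6 ⊡ m 10)
    σT₄₁-block = σTriple-block 4 1 refl (m 4) (p 1) (p 5) (p 9) (m 6) (m 10)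
      (even {4 + 5 * (k * 2 + 0)} 4 (e₄ k) refl)
      (odd {1 + 5 * (k * 2 + 0)} 1 (e₁ k) refl)
      (odd {5 * suc (k * 2 + 0)} 5 (e₅ k) refl)
      (odd {4 + 5 * (k * 2 + 1)} 9 (e₉ k) refl)
      (even {1 + 5 * (k * 2 + 1)} 6 (e₆ k) refl)
      (even {5 * suc (k * 2 + 1)} 10 (e₁₀ k) refl)

    σT₁₄-block : blocks 2 (σTriple 1 4) k ≗ q^ 0 ⊡ (p 1 ⊡ m 4 ⊡ p 5) ⊡ (m 6 ⊡ p 9 ⊡ m 10)
    σT₁₄-block = σTriple-block 1 4 refl (p 1) (m 4) (p 5) (m 6) (p 9) (m 10)
      (odd {1 + 5 * (k * 2 + 0)} 1 (e₁ k) refl)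
      (even {4 + 5 * (k * 2 + 0)} 4 (e₄ k) refl)
      (odd {5 * suc (k * 2 + 0)} 5 (e₅ k) refl)
      (even {1 + 5 * (k * 2 + 1)} 6 (e₆ k) refl)
      (odd {4 + 5 * (k * 2 + 1)} 9 (e₉ k) refl)
      (even {5 * suc (k * 2 + 1)} 10 (e₁₀ k) refl)

    σT₃₂-block : blocks 2 (σTriple 3 2) k ≗ q^ 0 ⊡ (p 3 ⊡ m 2 ⊡ p 5) ⊡ (m 8 ⊡ p 7 ⊡ m 10)
    σT₃₂-block = σTriple-block 3 2 refl (p 3) (m 2) (p 5) (m 8) (p 7) (m 10)
      (odd {3 + 5 * (k * 2 + 0)} 3 (e₃ k) refl)
      (even {2 + 5 * (k * 2 + 0)} 2 (e₂ k) refl)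
      (odd {5 * suc (k * 2 + 0)} 5 (e₅ k) refl)
      (even {3 + 5 * (k * 2 + 1)} 8 (e₈ k) refl)
      (odd {2 + 5 * (k * 2 + 1)} 7 (e₇ k) refl)
      (even {5 * suc (k * 2 + 1)} 10 (e₁₀ k) refl)

    instance
      positive-exponent : ∀ {i} → NonZero (k * 10 + suc i)
      positive-exponent {i} = ℕ.≢-nonZero (λ eq → ℕ.1+n≢0 (trans (sym (ℕ.+-suc (k * 10) i)) eq))

    infixl 5 _⊗_
    _⊗_ : ∀ {a b c d} → a ∣⁺ b → c ∣⁺ d → a ⊡ c ∣⁺ b ⊡ d
    _⊗_ = ∣⁺-⊡

    -- In this and the following rules, i refers to the exponent 10 k + i + 1, so that exponents are
    -- visibly positive.
    inv : ∀ i → m (suc i) ∣⁺ q^ 0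
    inv i = μ∣⁺1 (k * 10 + suc i)
    inv² : ∀ i → m (suc i) ⊡ m (suc i) ∣⁺ q^ 0
    inv² i = ∣⁺-resp (⊛≗⊡ (m (suc i)) (m (suc i))) (λ _ → refl) (μ⊛μ∣⁺1 (k * 10 + suc i))
    inv± : ∀ i → p (suc i) ⊡ m (suc i) ∣⁺ q^ 0
    inv± i = ∣⁺-resp (⊛≗⊡ (p (suc i)) (m (suc i))) (λ _ → refl) (π⊛μ∣⁺1 (k * 10 + suc i))
    same : ∀ a → a ∣⁺ a
    same a = ∣⁺-refl
    flip : ∀ i → m (suc i) ∣⁺ p (suc i)
    flip i = μ∣⁺π (k * 10 + suc i)

    private
      transport : ∀ {a b c d} a′ b′ c′ d′ x y → a ≗ a′ → b ≗ b′ → c ≗ c′ → d ≗ d′ →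
                  a′ ⊡ b′ ≗ x → c′ ⊡ d′ ≗ y → x ∣⁺ y → a ⊛ b ∣⁺ c ⊛ d
      transport {a} {b} {c} {d} a′ b′ c′ d′ x y pa pb pc pd px py = ∣⁺-resp {x} {y} {a ⊛ b} {c ⊛ d}
        (λ n → sym (trans (⊛≗⊡-cong {a} {b} {a′} {b′} pa pb n) (px n)))
        (λ n → sym (trans (⊛≗⊡-cong {c} {d} {c′} {d′} pc pd n) (py n)))

    -- The quotient consists of 1 / (1 - q²ᵐ) at the offsets 1 and 9, of (1 + qᵐ) / (1 - qᵐ) at 3, 5
    -- and 7, and of 1 / (1 - qᵐ)² at 4 and 6.
    block₀ : blocks 2 (σTriple 4 1) k ⊛ blocks 10 (eulerFactor 1) k ∣⁺ blocks 2 (σEuler 5) k ⊛ blocks 2 (σTriple 3 2) k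
    block₀ = transport
      {blocks 2 (σTriple 4 1) k} {blocks 10 (eulerFactor 1) k}
      {blocks 2 (σEuler 5) k} {blocks 2 (σTriple 3 2) k} _ _ _ _ _ _
      σT₄₁-block f₁-block σf₅-block σT₃₂-block
      (denominator₀ (m 1) (m 2) (m 3) (m 4) (m 5) (m 6) (m 7) (m 8) (m 9) (m 10) (p 1) (p 5) (p 9))
      (numerator₀ (m 2) (m 8) (m 10) (p 3) (p 5) (p 7))
      (inv± 0 ⊗ same (m 2) ⊗ flip 2 ⊗ inv² 3 ⊗ same (p 5) ⊗ flip 4 ⊗ inv² 5 ⊗ flip 6 ⊗ same (m 8) ⊗
       inv± 8 ⊗ same (m 10) ⊗ same (m 10))

    block₁ : blocks 10 (eulerFactor 1) k ∣⁺ blocks 2 (σEuler 5) k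
    block₁ = ∣⁺-resp {_} {_} {blocks 10 (eulerFactor 1) k} {blocks 2 (σEuler 5) k}
      (λ n → sym (f₁-block n)) (λ n → sym (trans (σf₅-block n) (numerator₁ (m 10) (p 5) n)))
      (same (q^ 0) ⊗ inv 0 ⊗ inv 1 ⊗ inv 2 ⊗ inv 3 ⊗ flip 4 ⊗ inv 5 ⊗ inv 6 ⊗ inv 7 ⊗ inv 8 ⊗ same (m 10))

    block₂ : blocks 2 (σTriple 3 2) k ⊛ blocks 10 (eulerFactor 1) k ∣⁺ blocks 2 (σEuler 5) k ⊛ blocks 2 (σTriple 1 4) k
    block₂ = transport
      {blocks 2 (σTriple 3 2) k} {blocks 10 (eulerFactor 1) k}
      {blocks 2 (σEuler 5) k} {blocks 2 (σTriple 1 4) k} _ _ _ _ _ _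
      σT₃₂-block f₁-block σf₅-block σT₁₄-block
      (denominator₂ (m 1) (m 2) (m 3) (m 4) (m 5) (m 6) (m 7) (m 8) (m 9) (m 10) (p 3) (p 5) (p 7))
      (numerator₂ (m 4) (m 6) (m 10) (p 1) (p 5) (p 9))
      (flip 0 ⊗ inv² 1 ⊗ inv± 2 ⊗ same (m 4) ⊗ same (p 5) ⊗ flip 4 ⊗ same (m 6) ⊗ inv± 6 ⊗ inv² 7 ⊗
       flip 8 ⊗ same (m 10) ⊗ same (m 10))

-- Signs of the residue classes of a series A with f₅² A = f₁(-q).

module SignsOfSections where

  open import Defs
  open FormalSeries
  open InfiniteProducts
  open TripleProduct
  open Sections
  open Dissection
  open PentagonalSections
  open NonnegativeQuotients
  open EulerProducts
  open Blocks
  open import Data.Integer as ℤ using (ℤ; 0ℤ; 1ℤ; -1ℤ; _<_)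
  import Data.Integer.Properties as ℤ
  open import Data.Nat using (ℕ; zero; suc; _+_; _*_; NonZero; z≤n; s≤s)
  import Data.Nat as ℕ
  import Data.Nat.Properties as ℕ
  open import Function using (_∘_)
  open import Relation.Binary.PropositionalEquality

  -- Blocks of different lengths are matched: ten factors of f₁ range over the same exponents as two
  -- factors of a triple product with s + s′ = 5, or two factors of f₅.
  ∏∞-blocks-∣⁺ : ∀ {t u v w} → Admissible t → Admissible u → Admissible v → Admissible w →
    (∀ k → blocks 2 t k ⊛ blocks 10 u k ∣⁺ blocks 2 v k ⊛ blocks 2 w k) → ∏∞ t ⊛ ∏∞ u ∣⁺ ∏∞ v ⊛ ∏∞ w
  ∏∞-blocks-∣⁺ {t} {u} {v} {w} at au av aw p = ∣⁺-resp
    {∏∞ (λ k → blocks 2 t k ⊛ blocks 10 u k)} {∏∞ (λ k → blocks 2 v k ⊛ blocks 2 w k)} {∏∞ t ⊛ ∏∞ u} {∏∞ v ⊛ ∏∞ w}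
    (λ n → trans (∏∞-⊛ {blocks 2 t} {blocks 10 u} bt bu n)
      (sym (⊛-cong {∏∞ t} {∏∞ (blocks 2 t)} {∏∞ u} {∏∞ (blocks 10 u)} (∏∞-blocks 2 {t} at) (∏∞-blocks 10 {u} au) n)))
    (λ n → trans (∏∞-⊛ {blocks 2 v} {blocks 2 w} bv bw n)
      (sym (⊛-cong {∏∞ v} {∏∞ (blocks 2 v)} {∏∞ w} {∏∞ (blocks 2 w)} (∏∞-blocks 2 {v} av) (∏∞-blocks 2 {w} aw) n)))
    (∏∞-∣⁺ {λ k → blocks 2 t k ⊛ blocks 10 u k} {λ k → blocks 2 v k ⊛ blocks 2 w k}
      (⊛-admissible {blocks 2 t} {blocks 10 u} bt bu) (⊛-admissible {blocks 2 v} {blocks 2 w} bv bw) p)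
    where
    bt : Admissible (blocks 2 t)
    bt = blocks-admissible 2 {t} at
    bu : Admissible (blocks 10 u)
    bu = blocks-admissible 10 {u} au
    bv : Admissible (blocks 2 v)
    bv = blocks-admissible 2 {v} av
    bw : Admissible (blocks 2 w)
    bw = blocks-admissible 2 {w} aw

  T₃₂ T₄₁ T₁₄ P : Series
  T₃₂ = ∏∞ (tripleFactor 3 2)
  T₄₁ = ∏∞ (tripleFactor 4 1)
  T₁₄ = ∏∞ (tripleFactor 1 4)
  P   = ∏∞ (tripleFactor 5 10)

  σTriple-admissible : ∀ s s′ .{{_ : NonZero s}} .{{_ : NonZero s′}} → Admissible (σTriple s s′)
  σTriple-admissible s s′ = σ-admissible {tripleFactor s s′} (tripleFactor-admissible s s′)

  σEuler-admissible : ∀ j .{{_ : NonZero j}} → Admissible (σEuler j)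
  σEuler-admissible j = σ-admissible {eulerFactor j} (eulerFactor-admissible j)

  σP≗ : σ P ≗ ∏∞ (σEuler 5)
  σP≗ n = trans (σ-cong {P} {∏∞ (eulerFactor 5)} (λ k → trans (sym (f≗triple 5 k)) (f≗∏∞ 5 k)) n) (σ-∏∞ (eulerFactor 5) n)

  σT≗ : ∀ s s′ → ∏∞ (σTriple s s′) ≗ σ (∏∞ (tripleFactor s s′))
  σT≗ s s′ n = sym (σ-∏∞ (tripleFactor s s′) n)

  quotient₀ : σ T₄₁ ⊛ f 1 ∣⁺ σ P ⊛ σ T₃₂
  quotient₀ = ∣⁺-resp
    {∏∞ (σTriple 4 1) ⊛ ∏∞ (eulerFactor 1)} {∏∞ (σEuler 5) ⊛ ∏∞ (σTriple 3 2)}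
    {σ T₄₁ ⊛ f 1} {σ P ⊛ σ T₃₂}
    (⊛-cong {∏∞ (σTriple 4 1)} {σ T₄₁} {∏∞ (eulerFactor 1)} {f 1} (σT≗ 4 1) (λ n → sym (f≗∏∞ 1 n)))
    (⊛-cong {∏∞ (σEuler 5)} {σ P} {∏∞ (σTriple 3 2)} {σ T₃₂} (λ n → sym (σP≗ n)) (σT≗ 3 2))
    (∏∞-blocks-∣⁺ {σTriple 4 1} {eulerFactor 1} {σEuler 5} {σTriple 3 2}
      (σTriple-admissible 4 1) (eulerFactor-admissible 1) (σEuler-admissible 5) (σTriple-admissible 3 2) Block.block₀)

  quotient₁ : f 1 ∣⁺ σ P
  quotient₁ = ∣⁺-resp {∏∞ (blocks 10 (eulerFactor 1))} {∏∞ (blocks 2 (σEuler 5))} {f 1} {σ P}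
    (λ n → sym (trans (f≗∏∞ 1 n) (∏∞-blocks 10 {eulerFactor 1} (eulerFactor-admissible 1) n)))
    (λ n → sym (trans (σP≗ n) (∏∞-blocks 2 {σEuler 5} (σEuler-admissible 5) n)))
    (∏∞-∣⁺ {blocks 10 (eulerFactor 1)} {blocks 2 (σEuler 5)}
      (blocks-admissible 10 {eulerFactor 1} (eulerFactor-admissible 1))
      (blocks-admissible 2 {σEuler 5} (σEuler-admissible 5)) Block.block₁)

  quotient₂ : σ T₃₂ ⊛ f 1 ∣⁺ σ P ⊛ σ T₁₄
  quotient₂ = ∣⁺-resp
    {∏∞ (σTriple 3 2) ⊛ ∏∞ (eulerFactor 1)} {∏∞ (σEuler 5) ⊛ ∏∞ (σTriple 1 4)}
    {σ T₃₂ ⊛ f 1} {σ P ⊛ σ T₁₄}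
    (⊛-cong {∏∞ (σTriple 3 2)} {σ T₃₂} {∏∞ (eulerFactor 1)} {f 1} (σT≗ 3 2) (λ n → sym (f≗∏∞ 1 n)))
    (⊛-cong {∏∞ (σEuler 5)} {σ P} {∏∞ (σTriple 1 4)} {σ T₁₄} (λ n → sym (σP≗ n)) (σT≗ 1 4))
    (∏∞-blocks-∣⁺ {σTriple 3 2} {eulerFactor 1} {σEuler 5} {σTriple 1 4}
      (σTriple-admissible 3 2) (eulerFactor-admissible 1) (σEuler-admissible 5) (σTriple-admissible 1 4) Block.block₂)

  ∏∞-head : ∀ {u} → Admissible u → ∏∞ u ≗ u 0 ⊛ ∏∞ (u ∘ suc)
  ∏∞-head {u} adm n = begin
    ∏∞ u n                                  ≡⟨ ∏∞-≈ {u} adm {n} {suc n} (ℕ.n≤1+n n) n ℕ.≤-refl ⟩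
    (∏[ 1 + n ] u) n                        ≡⟨ ∏-+ u 1 n n ⟩
    (q^ 0 ⊛ u 0 ⊛ ∏[ n ] (u ∘ suc)) n       ≡⟨ ⊛-cong-≤ {q^ 0 ⊛ u 0} {u 0} {∏[ n ] (u ∘ suc)} {∏∞ (u ∘ suc)} n
                                                 (λ k _ → ⊛-identityˡ (u 0) k)
                                                 (λ k k≤n → sym (∏∞-≈ {u ∘ suc} adm-suc {n} {n} ℕ.≤-refl k k≤n)) n ℕ.≤-refl ⟩
    (u 0 ⊛ ∏∞ (u ∘ suc)) n                  ∎
    where
    open ≡-Reasoning
    adm-suc : Admissible (u ∘ suc)
    adm-suc k = ≈-weaken {u (suc k)} {q^ 0} (ℕ.n≤1+n k) (adm (suc k))

  -- f₁ / (1 - q), obtained by dropping the first factor.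
  R : Series
  R = ∏∞ (eulerFactor 1 ∘ suc)

  f₁≗μ⊛R : f 1 ≗ μ 1 ⊛ R
  f₁≗μ⊛R n = trans (f≗∏∞ 1 n) (∏∞-head {eulerFactor 1} (eulerFactor-admissible 1) n)

  R∣⁺1 : R ∣⁺ q^ 0
  R∣⁺1 = ∣⁺-resp {R} {∏∞ (λ _ → q^ 0)} {R} {q^ 0} (λ _ → refl) (λ n → ∏-1 n n)
    (∏∞-∣⁺ {eulerFactor 1 ∘ suc} {λ _ → q^ 0}
      (λ k → ≈-weaken {eulerFactor 1 (suc k)} {q^ 0} (ℕ.n≤1+n k) (eulerFactor-admissible 1 (suc k))) (λ _ _ _ → refl)
      (λ k → μ∣⁺1 (1 * suc (suc k))))
    where
    ∏-1 : ∀ n → ∏[ n ] (λ _ → q^ 0) ≗ q^ 0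
    ∏-1 zero    k = refl
    ∏-1 (suc n) k = trans (⊛-identityʳ (∏[ n ] (λ _ → q^ 0)) k) (∏-1 n k)

  open Positivity (f 1) R f₁≗μ⊛R R∣⁺1

  -- As 5 is odd, the sign of 5 n + r is that of n times that of r.
  section-σ : ∀ r a → section r (σ a) ≗ alt r • σ (section r a)
  section-σ r a n = trans (cong (λ z → z ℤ.* a (n * 5 + r)) (begin
    alt (n * 5 + r)        ≡⟨ alt-+ (n * 5) r ⟩
    alt (n * 5) ℤ.* alt r  ≡⟨ cong (ℤ._* alt r) (alt-5 n) ⟩
    alt n ℤ.* alt r        ≡⟨ ℤ.*-comm (alt n) (alt r) ⟩
    alt r ℤ.* alt n        ∎)) (ℤ.*-assoc (alt r) (alt n) (a (n * 5 + r)))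
    where
    open ≡-Reasoning
    alt-5 : ∀ n → alt (n * 5) ≡ alt n
    alt-5 zero    = refl
    alt-5 (suc n) = trans (alt-+ 5 (n * 5)) (trans (ℤ.-1*i≡-i (alt (n * 5))) (cong (λ z → ℤ.- z) (alt-5 n)))

  module SectionsOf (A : Series) (A-eq : f 5 ⊛ (f 5 ⊛ A) ≗ σ (f 1)) where

    f₅-sparse : Sparse (f 5)
    f₅-sparse n r 0<r r<5 = trans (f≗triple 5 (n * 5 + r)) (tripleProduct-sparse 1 2 n r 0<r r<5)

    f₅-section : section 0 (f 5) ≗ f 1
    f₅-section n = trans (f≗triple 5 (n * 5 + 0)) (trans (tripleProduct-section 1 2 n) (sym (f≗triple 1 n)))

    -- The factors f₅ are series in q⁵ whose class 0 is f₁, so in the class r of f₅² A = f₁(-q) each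
    -- of them turns into f₁.
    quadratic : ∀ r → r ℕ.< 5 → f 1 ⊛ (f 1 ⊛ section r A) ≗ alt r • σ (section r euler)
    quadratic r r<5 n = begin
      (f 1 ⊛ (f 1 ⊛ section r A)) n
        ≡⟨ ⊛-cong {section 0 (f 5)} {f 1} {section r (f 5 ⊛ A)} {f 1 ⊛ section r A} f₅-section
             (λ k → trans (⊛-section (f 5) A f₅-sparse r<5 k)
               (⊛-cong {section 0 (f 5)} {f 1} {section r A} {section r A} f₅-section (λ _ → refl) k)) n ⟨
      (section 0 (f 5) ⊛ section r (f 5 ⊛ A)) n
        ≡⟨ ⊛-section (f 5) (f 5 ⊛ A) f₅-sparse r<5 n ⟨
      (f 5 ⊛ (f 5 ⊛ A)) (n * 5 + r)
        ≡⟨ A-eq (n * 5 + r) ⟩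
      σ (f 1) (n * 5 + r)
        ≡⟨ section-σ r (f 1) n ⟩
      alt r ℤ.* σ (section r (f 1)) n
        ≡⟨ cong (λ z → alt r ℤ.* (alt n ℤ.* z)) (f≗triple 1 (n * 5 + r)) ⟩
      alt r ℤ.* σ (section r euler) n ∎
      where open ≡-Reasoning

    T-constant : ∀ s s′ .{{_ : NonZero s}} .{{_ : NonZero s′}} → ∏∞ (tripleFactor s s′) 0 ≡ 1ℤ
    T-constant s s′ = refl

    section₀-positive : ∀ n → 0ℤ < section 0 A n
    section₀-positive = positive₂ (section 0 A) (section 0 euler) T₄₁ P T₃₂
      (λ n → trans (quadratic 0 (s≤s z≤n) n) (ℤ.*-identityˡ (σ (section 0 euler) n)))
      section₀ (T-constant 4 1) quotient₀

    section₁-positive : ∀ n → 0ℤ < section 1 A n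
    section₁-positive = positive₁ (section 1 A) (σ P)
      -- The sign of the odd class 1 cancels the minus sign in `section₁`.
      (λ n → trans (quadratic 1 (s≤s (s≤s z≤n)) n) (trans (cong (λ z → -1ℤ ℤ.* (alt n ℤ.* z)) (section₁ n)) (sign (alt n) (P n))))
      quotient₁
      where
      sign : ∀ x y → -1ℤ ℤ.* (x ℤ.* (ℤ.- y)) ≡ x ℤ.* y
      sign x y = trans (ℤ.-1*i≡-i (x ℤ.* (ℤ.- y))) (trans (ℤ.neg-distribʳ-* x (ℤ.- y)) (cong (λ z → x ℤ.* z) (ℤ.neg-involutive y)))

    ⊛-⊝ : ∀ a b → a ⊛ (⊝ b) ≗ ⊝ (a ⊛ b)
    ⊛-⊝ a b n = sym (-‿distribʳ-* a b n)
      where open import Algebra.Properties.Ring S.ring using (-‿distribʳ-*)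

    -- The criterion is applied to the negatives of both A and the pentagonal class, which removes
    -- the minus sign of `section₂`.
    section₂-negative : ∀ n → section 2 A n < 0ℤ
    section₂-negative n = ℤ.neg-cancel-< (positive₂ (⊝ section 2 A) (⊝ section 2 euler) T₃₂ P T₁₄
      (λ k → begin
        (f 1 ⊛ (f 1 ⊛ (⊝ section 2 A))) k   ≡⟨ ⊛-cong {f 1} {f 1} {f 1 ⊛ (⊝ section 2 A)} {⊝ (f 1 ⊛ section 2 A)} (λ _ → refl) (⊛-⊝ (f 1) (section 2 A)) k ⟩
        (f 1 ⊛ (⊝ (f 1 ⊛ section 2 A))) k   ≡⟨ ⊛-⊝ (f 1) (f 1 ⊛ section 2 A) k ⟩
        ℤ.- (f 1 ⊛ (f 1 ⊛ section 2 A)) k   ≡⟨ cong (λ z → ℤ.- z) (trans (quadratic 2 (s≤s (s≤s (s≤s z≤n))) k) (ℤ.*-identityˡ (σ (section 2 euler) k))) ⟩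
        ℤ.- (alt k ℤ.* section 2 euler k)   ≡⟨ ℤ.neg-distribʳ-* (alt k) (section 2 euler k) ⟩
        alt k ℤ.* (ℤ.- section 2 euler k)   ∎)
      (λ k → trans (⊛-⊝ T₃₂ (section 2 euler) k) (trans (cong (λ z → ℤ.- z) (section₂ k)) (ℤ.neg-involutive ((P ⊛ T₁₄) k))))
      (T-constant 3 2) quotient₂ n)
      where open ≡-Reasoning

    vanishes : ∀ r → r ℕ.< 5 → section r euler ≗ 𝟎 → section r A ≗ 𝟎
    vanishes r r<5 E≗0 = ⊛-cancelˡ (f 1) F-0 (⊛-cancelˡ (f 1) F-0 λ n → begin
      (f 1 ⊛ (f 1 ⊛ section r A)) n    ≡⟨ quadratic r r<5 n ⟩
      alt r ℤ.* (alt n ℤ.* section r euler n)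
        ≡⟨ cong (λ z → alt r ℤ.* z) (trans (cong (λ z → alt n ℤ.* z) (E≗0 n)) (ℤ.*-zeroʳ (alt n))) ⟩
      alt r ℤ.* 0ℤ                     ≡⟨ ℤ.*-zeroʳ (alt r) ⟩
      0ℤ                               ≡⟨ S.zeroʳ (f 1) n ⟨
      (f 1 ⊛ 𝟎) n                      ≡⟨ ⊛-cong {f 1} {f 1} {f 1 ⊛ 𝟎} {𝟎} (λ _ → refl) (S.zeroʳ (f 1)) n ⟨
      (f 1 ⊛ (f 1 ⊛ 𝟎)) n              ∎)
      where open ≡-Reasoning

    section₃-zero : ∀ n → section 3 A n ≡ 0ℤ
    section₃-zero = vanishes 3 (s≤s (s≤s (s≤s (s≤s z≤n)))) section₃

    section₄-zero : ∀ n → section 4 A n ≡ 0ℤ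
    section₄-zero = vanishes 4 (s≤s (s≤s (s≤s (s≤s (s≤s z≤n))))) section₄

-- Application to the sequence generated by f₂³ / (f₁ f₄ f₅²).

open import Defs
open FormalSeries
open InfiniteProducts
open Rearranging
open NonnegativeQuotients
open EulerProducts
open SignsOfSections
open import Data.Nat using (ℕ; _+_; _*_)
import Data.Nat.Properties as ℕ
open import Data.Integer using (0ℤ; _<_; _>_)
open import Data.Product using (_×_; _,_)
open import Relation.Binary.PropositionalEquality using (_≡_; _≗_; refl; subst; trans)

open Rearrangements S.*-commutativeMonoid using (eulerQuotient)

divide : ∀ s a b c v x → s ⊛ (a ⊛ b) ≗ c ⊛ (c ⊛ c) → (a ⊛ b ⊛ v ↑ 2) ⊛ x ≗ c ↑ 3 →
         (a ⊛ b) ⊛ (v ⊛ (v ⊛ x)) ≗ (a ⊛ b) ⊛ s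
divide = eulerQuotient

-- The defining equation and f₂³ = f₁(-q) f₁ f₄ have the common factor f₁ f₄, which has constant
-- term 1 and can be cancelled.
f₅²⊛a : f 5 ⊛ (f 5 ⊛ a₁⁻¹2³4⁻¹5⁻²) ≗ σ (f 1)
f₅²⊛a = ⊛-cancelˡ (f 1 ⊛ f 4) refl
  (divide (σ (f 1)) (f 1) (f 4) (f 2) (f 5) a₁⁻¹2³4⁻¹5⁻² σf₁⊛f₁⊛f₄ a₁⁻¹2³4⁻¹5⁻²-defining)

open SectionsOf a₁⁻¹2³4⁻¹5⁻² f₅²⊛a

theorem5p2 : (n : ℕ) →
    (a₁⁻¹2³4⁻¹5⁻² (5 * n) > 0ℤ) ×
    (a₁⁻¹2³4⁻¹5⁻² (5 * n + 1) > 0ℤ) ×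
    (a₁⁻¹2³4⁻¹5⁻² (5 * n + 2) < 0ℤ) ×
    (a₁⁻¹2³4⁻¹5⁻² (5 * n + 3) ≡ 0ℤ) ×
    (a₁⁻¹2³4⁻¹5⁻² (5 * n + 4) ≡ 0ℤ)
theorem5p2 n =
  subst (λ m → a₁⁻¹2³4⁻¹5⁻² m > 0ℤ) (trans (ℕ.+-identityʳ (n * 5)) (ℕ.*-comm n 5)) (section₀-positive n) ,
  subst (λ m → a₁⁻¹2³4⁻¹5⁻² (m + 1) > 0ℤ) (ℕ.*-comm n 5) (section₁-positive n) ,
  subst (λ m → a₁⁻¹2³4⁻¹5⁻² (m + 2) < 0ℤ) (ℕ.*-comm n 5) (section₂-negative n) ,
  subst (λ m → a₁⁻¹2³4⁻¹5⁻² (m + 3) ≡ 0ℤ) (ℕ.*-comm n 5) (section₃-zero n) ,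
  subst (λ m → a₁⁻¹2³4⁻¹5⁻² (m + 4) ≡ 0ℤ) (ℕ.*-comm n 5) (section₄-zero n)
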